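{- Let $k,n$ be positive integers with $k\le n$ and $w\in\mathfrak S_n$. Then: (a) $\mathcal B_w(n,k)$ is isomorphic as a poset to $\mathcal C_w(n,k+1)$, via the isomorphism sending a commutation class $[\rho]$ of admissible orders to the reversal set $\mathrm{Rev}_{n,k,w}(\rho)$ (which is the same for all representatives of the class). (b) $\mathcal B_w(n,k)\cong\mathcal C_w(n,k+1)$ is a ranked poset with a unique minimal element and a unique maximal element, corresponding to the reversal sets $\emptyset$ and $\mathrm{Inv}_{k+1}(w)$ respectively. (c) There is a natural bijection between the maximal chains of $\mathcal C_w(n,k+1)$ and $\mathcal A_w(n,k+1)$, namely the map sending a maximal chain $\emptyset\lessdot R_1\lessdot R_2\lessdot\dots\lessdot R_N$ (with $N=|\mathrm{Inv}_{k+1}(w)|$) to the total order of $\mathrm{Inv}_{k+1}(w)$ whose $j$-th element is the unique element of $R_j\setminus R_{j-1}$ (with $R_0=\emptyset$).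
   Context: $\mathfrak S_n$ is the symmetric group on $[n]=\{1,\dots,n\}$. For $m\ge0$, $\binom{[n]}{m}$ denotes the set of $m$-element subsets of $[n]$, each written $[x_1,\dots,x_m]$ with $x_1<\dots<x_m$. For $X=[x_1,\dots,x_m]$ and $i\in[m]$, $X_i$ is $X$ with $x_i$ removed, and the packet is $P(X)=\{X_1,\dots,X_m\}$; its lex order is $(X_m,X_{m-1},\dots,X_1)$ and its antilex order is $(X_1,X_2,\dots,X_m)$. A prefix of $P(X)$ is a set $\{X_m,X_{m-1},\dots,X_i\}$ and a suffix is a set $\{X_i,X_{i-1},\dots,X_1\}$ (the empty set counts as both). The $m$-inversion set is $\mathrm{Inv}_m(w)=\{[x_1,\dots,x_m]\in\binom{[n]}{m}: w^{ -1}(x_1)>\dots>w^{ -1}(x_m)\}$ (so $\mathrm{Inv}_m(w)=\emptyset$ for $m>n$). $X=[x_1,\dots,x_m]$ is an $m$-quasi-inversion of $w$ if exactly one of the pairs $[x_a,x_b]$, $a<b$, is not in $\mathrm{Inv}_2(w)$; then $P(X)\cap\mathrm{Inv}_{m-1}(w)=\{X_i,X_{i+1}\}$ for some $i$. The permanent poset $\mathcal P_w(n,m)$ is $\mathrm{Inv}_m(w)$ with the reflexive-transitive closure of the quasi-inversion relations: whenever $X\in\binom{[n]}{m+1}$ is a quasi-inversion with $P(X)\cap\mathrm{Inv}_m(w)=\{X_i,X_{i+1}\}$, set $X_i<X_{i+1}$ if $m-i$ is odd and $X_{i+1}<X_i$ if $m-i$ is even (this is a partial order). An $m$-admissible order for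 $w$ is a total order $\rho$ of $\mathrm{Inv}_m(w)$ that is a linear extension of $\mathcal P_w(n,m)$ and such that for every $X\in\mathrm{Inv}_{m+1}(w)$ the restriction $\rho|_{P(X)}$ is the lex or antilex order of $P(X)$; $\mathcal A_w(n,m)$ denotes the set of these. Its reversal set is $\mathrm{Rev}_{n,m,w}(\rho)=\{X\in\mathrm{Inv}_{m+1}(w):\rho|_{P(X)}=(X_1,\dots,X_{m+1})\}$. Two elements of $\mathrm{Inv}_m(w)$ commute if they are incomparable in $\mathcal P_w(n,m)$ and there is no $Z\in\binom{[n]}{m+1}$ with both in $P(Z)$; two total orders of $\mathrm{Inv}_m(w)$ are commutation equivalent ($\sim_w$) if related by a sequence of swaps of adjacent commuting elements; $[\rho]$ is the class of $\rho$. For $X\in\mathrm{Inv}_{m+1}(w)$, $P(X)$ is flippable in $\rho$ if its elements occupy consecutive positions of $\rho$; if moreover $\rho|_{P(X)}$ is lex, the lex-to-antilex packet flip at $P(X)$ reverses that block. $\mathcal B_w(n,m)$ is the poset on $\mathcal A_w(n,m)/\!\sim_w$ with $[\rho]\le[\sigma]$ iff $\sigma$ can be obtained from $\rho$ by a sequence of commutations and lex-to-antilex packet flips. A subset $R\subseteq\mathrm{Inv}_m(w)$ is consistent (with respect to $w$) if it is a lower order ideal of $\mathcal P_w(n,m)$ and for every $X\in\mathrm{Inv}_{m+1}(w)$ the set $P(X)\cap R$ is a prefix or a suffix of $P(X)$. $\mathcal C_w(n,m)$ is the poset on consistent subsets of $\mathrm{Inv}_m(w)$ in which $R\le R'$ iff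 there is a chain of consistent sets $R=R_0\subset R_1\subset\dots\subset R_t=R'$ with $|R_{j+1}\setminus R_j|=1$ for all $j$ (single step inclusion). -}

module Defs where

open import Level using (Level; 0ℓ; _⊔_) renaming (suc to lsuc)
open import Data.Nat.Base using (ℕ; suc; _∸_)
open import Data.Nat.Divisibility using (_∣_)
import Data.Nat.Base as ℕ
open import Data.Fin.Base using (Fin; zero; suc; toℕ; inject₁)
import Data.Fin.Base as Fin
import Data.Fin.Properties as Fin
open import Data.Fin.Permutation using (Permutation′; _⟨$⟩ˡ_)
open import Data.List.Base as List using (List; []; _∷_; _++_; reverse; filter)
open import Data.List.Membership.Propositional using (_∈_)
import Data.List.Membership.DecPropositional as DecMembership
open import Data.List.Relation.Unary.All using (All)
open import Data.List.Relation.Unary.Any using (Any)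
open import Data.List.Relation.Unary.Linked using (Linked)
open import Data.List.Relation.Unary.Unique.Propositional using (Unique)
open import Data.List.Relation.Binary.Pointwise using (Pointwise)
open import Data.Product using (_×_; _,_; ∃; ∃₂; ∃!)
open import Data.Sum.Base using (_⊎_)
open import Data.Vec.Base using (Vec; []; _∷_; lookup; removeAt)
import Data.Vec.Properties as Vec
open import Function.Bundles using (_⇔_)
open import Relation.Binary.Core using (Rel)
open import Relation.Binary.Construct.Closure.ReflexiveTransitive using (Star)
import Relation.Binary.Construct.NonStrictToStrict as ToStrict
open import Relation.Binary.Definitions using (DecidableEquality)
open import Relation.Binary.PropositionalEquality.Core using (_≡_)
open import Relation.Nullary.Negation.Core using (¬_)
open import Relation.Unary using (Pred; Decidable; _⊆_; _≐_; _∩_; _∪_; _∖_; ｛_｝; ∅)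

private
  variable
    a ℓ₁ ℓ₂ : Level
    m n : ℕ

------------------------------------------------------------------------
-- Subsets of [n] and packets

-- [n] is Fin n, with every element shifted down by one.  The m-element
-- subset [x₁,…,xₘ] is the increasing vector of its elements; vectors that
-- are not increasing are excluded by the predicates below.

Increasing : Pred (Vec (Fin n) m) 0ℓ
Increasing X = ∀ {i j} → i Fin.< j → lookup X i Fin.< lookup X j

-- With positions counted from 0, removeAt X i is X_{i+1}.
-- antilex X is (X₁,X₂,…) and lex X is (…,X₂,X₁).

antilex : Vec (Fin n) (suc m) → List (Vec (Fin n) m)
antilex X = List.tabulate (removeAt X)

lex : Vec (Fin n) (suc m) → List (Vec (Fin n) m)
lex X = reverse (antilex X)

Packet : Vec (Fin n) (suc m) → Pred (Vec (Fin n) m) 0ℓ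
Packet X Y = Y ∈ antilex X

infix 4 _≟ᵛ_

_≟ᵛ_ : DecidableEquality (Vec (Fin n) m)
_≟ᵛ_ = Vec.≡-dec Fin._≟_

infix 9 _∣ₚ_

_∣ₚ_ : List (Vec (Fin n) m) → Vec (Fin n) (suc m) → List (Vec (Fin n) m)
ρ ∣ₚ X = filter (_∈? antilex X) ρ
  where open DecMembership _≟ᵛ_ using (_∈?_)

-- The empty set arises both from i ≥ m + 1 in IsPrefix and from i = 0 in
-- IsSuffix.

IsPrefix : Vec (Fin n) (suc m) → Pred (Pred (Vec (Fin n) m) 0ℓ) 0ℓ
IsPrefix X A = ∃ λ (i : ℕ) → A ≐ λ Y → ∃ λ j → i ℕ.≤ toℕ j × Y ≡ removeAt X j

IsSuffix : Vec (Fin n) (suc m) → Pred (Pred (Vec (Fin n) m) 0ℓ) 0ℓ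
IsSuffix X A = ∃ λ (i : ℕ) → A ≐ λ Y → ∃ λ j → toℕ j ℕ.< i × Y ≡ removeAt X j

------------------------------------------------------------------------
-- Inversion sets and the permanent order

Inv : Permutation′ n → Pred (Vec (Fin n) m) 0ℓ
Inv w X = Increasing X ×
          (∀ {i j} → i Fin.< j → (w ⟨$⟩ˡ lookup X j) Fin.< (w ⟨$⟩ˡ lookup X i))

IsQuasiInversion : Permutation′ n → Pred (Vec (Fin n) m) 0ℓ
IsQuasiInversion {m = m} w X =
  Increasing X ×
  ∃! _≡_ λ ((a , b) : Fin m × Fin m) →
    a Fin.< b × ¬ Inv w (lookup X a ∷ lookup X b ∷ [])

-- The 0-based position i stands for the index i + 1, so the parity that
-- matters is that of m - (i + 1).

data PermanentStep {n m} (w : Permutation′ n) : Rel (Vec (Fin n) m) 0ℓ where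
  odd  : (X : Vec (Fin n) (suc m)) (i : Fin m) →
         IsQuasiInversion w X →
         Packet X ∩ Inv w ≐ ｛ removeAt X (inject₁ i) ｝ ∪ ｛ removeAt X (suc i) ｝ →
         ¬ 2 ∣ m ∸ suc (toℕ i) →
         PermanentStep w (removeAt X (inject₁ i)) (removeAt X (suc i))
  even : (X : Vec (Fin n) (suc m)) (i : Fin m) →
         IsQuasiInversion w X →
         Packet X ∩ Inv w ≐ ｛ removeAt X (inject₁ i) ｝ ∪ ｛ removeAt X (suc i) ｝ →
         2 ∣ m ∸ suc (toℕ i) →
         PermanentStep w (removeAt X (suc i)) (removeAt X (inject₁ i))

-- The order of the permanent poset.  Its steps only relate elements of
-- Inv w, which is the underlying set of the poset.

Permanent : Permutation′ n → Rel (Vec (Fin n) m) 0ℓ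
Permanent w = Star (PermanentStep w)

------------------------------------------------------------------------
-- Admissible orders

-- A total order of a finite set is the list of its elements, from the
-- smallest to the largest.

IsTotalOrderOf : Pred (Vec (Fin n) m) 0ℓ → Pred (List (Vec (Fin n) m)) 0ℓ
IsTotalOrderOf S ρ = Unique ρ × (∀ X → X ∈ ρ ⇔ S X)

IsLinearExtension : Permutation′ n → Pred (List (Vec (Fin n) m)) 0ℓ
IsLinearExtension w ρ =
  ∀ i j → Permanent w (List.lookup ρ i) (List.lookup ρ j) → i Fin.≤ j

record AdmissibleOrder (w : Permutation′ n) (m : ℕ) : Set where
  field
    order           : List (Vec (Fin n) m)
    totalOrder      : IsTotalOrderOf (Inv w) order
    linearExtension : IsLinearExtension w order
    lexOrAntilex    : ∀ (X : Vec (Fin n) (suc m)) → Inv w X →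
                      order ∣ₚ X ≡ lex X ⊎ order ∣ₚ X ≡ antilex X

open AdmissibleOrder public using (order)

Rev : (w : Permutation′ n) → AdmissibleOrder w m → Pred (Vec (Fin n) (suc m)) 0ℓ
Rev w ρ X = Inv w X × order ρ ∣ₚ X ≡ antilex X

Commute : Permutation′ n → Rel (Vec (Fin n) m) 0ℓ
Commute {n} {m} w X Y =
  ¬ Permanent w X Y × ¬ Permanent w Y X ×
  ¬ (∃ λ (Z : Vec (Fin n) (suc m)) → Increasing Z × Packet Z X × Packet Z Y)

data Commutation {n m} (w : Permutation′ n) : Rel (List (Vec (Fin n) m)) 0ℓ where
  swap : ∀ xs {X Y} ys → Commute w X Y →
         Commutation w (xs ++ X ∷ Y ∷ ys) (xs ++ Y ∷ X ∷ ys)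

data PacketFlip {n m} (w : Permutation′ n) : Rel (List (Vec (Fin n) m)) 0ℓ where
  flip : ∀ xs (X : Vec (Fin n) (suc m)) ys → Inv w X →
         PacketFlip w (xs ++ lex X ++ ys) (xs ++ antilex X ++ ys)

-- Commutation equivalence; Commutation is already symmetric.

_∼ᴮ_ : {w : Permutation′ n} → Rel (AdmissibleOrder w m) 0ℓ
_∼ᴮ_ {w = w} ρ σ = Star (Commutation w) (order ρ) (order σ)

-- The order on commutation classes, on representatives.

_≤ᴮ_ : {w : Permutation′ n} → Rel (AdmissibleOrder w m) 0ℓ
_≤ᴮ_ {w = w} ρ σ =
  Star (λ τ υ → Commutation w τ υ ⊎ PacketFlip w τ υ) (order ρ) (order σ)

------------------------------------------------------------------------
-- Consistent sets

-- Subsets of the finite set Inv w are decidable predicates, compared by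
-- extensional equality.

record ConsistentSet (w : Permutation′ n) (m : ℕ) : Set₁ where
  field
    set            : Pred (Vec (Fin n) m) 0ℓ
    decidable      : Decidable set
    inversions     : set ⊆ Inv w
    lowerIdeal     : ∀ {X Y} → Permanent w X Y → set Y → set X
    prefixOrSuffix : ∀ (X : Vec (Fin n) (suc m)) → Inv w X →
                     IsPrefix X (Packet X ∩ set) ⊎ IsSuffix X (Packet X ∩ set)

open ConsistentSet public using (set)

_≈ᶜ_ : {w : Permutation′ n} → Rel (ConsistentSet w m) 0ℓ
R ≈ᶜ S = set R ≐ set S

Adds : {w : Permutation′ n} → Vec (Fin n) m → Rel (ConsistentSet w m) 0ℓ
Adds X R S = set R ⊆ set S × set S ∖ set R ≐ ｛ X ｝

-- The last set of the chain need only have the same elements as S.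

_≤ᶜ_ : {w : Permutation′ n} → Rel (ConsistentSet w m) (lsuc 0ℓ)
R ≤ᶜ S = ∃ λ T → Star (λ U V → ∃ λ X → Adds X U V) R T × T ≈ᶜ S

------------------------------------------------------------------------
-- Order-theoretic notions, relative to an equality and a partial order

module _ {A : Set a} (_≈_ : Rel A ℓ₁) (_≤_ : Rel A ℓ₂) where

  open ToStrict _≈_ _≤_ using (_<_)

  Minimal : Pred A _
  Minimal x = ∀ y → y ≤ x → y ≈ x

  Maximal : Pred A _
  Maximal x = ∀ y → x ≤ y → x ≈ y

  IsUniqueMinimal : Pred A _
  IsUniqueMinimal x = Minimal x × (∀ y → Minimal y → y ≈ x)

  IsUniqueMaximal : Pred A _
  IsUniqueMaximal x = Maximal x × (∀ y → Maximal y → y ≈ x)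

  Covers : Rel A _
  Covers y x = x < y × ¬ (∃ λ z → x < z × z < y)

  record IsRanked : Set (a ⊔ ℓ₁ ⊔ ℓ₂) where
    field
      rank         : A → ℕ
      rank-cong    : ∀ {x y} → x ≈ y → rank x ≡ rank y
      rank-minimal : ∀ {x} → Minimal x → rank x ≡ 0
      rank-mono    : ∀ {x y} → x < y → rank x ℕ.< rank y
      rank-cover   : ∀ {x y} → Covers y x → rank y ≡ suc (rank x)

  -- A finite chain is the increasing list of its elements.

  IsChain : Pred (List A) _
  IsChain = Linked _<_

  Contained : Rel (List A) _
  Contained xs ys = All (λ x → Any (x ≈_) ys) xs

  record MaximalChain : Set (a ⊔ ℓ₁ ⊔ ℓ₂) where
    field
      chain   : List A
      isChain : IsChain chain
      maximal : ∀ ys → IsChain ys → Contained chain ys → Contained ys chain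

open MaximalChain public using (chain)

------------------------------------------------------------------------
-- Maximal chains of consistent sets

MaximalChainᶜ : Permutation′ n → ℕ → Set₁
MaximalChainᶜ w m = MaximalChain (_≈ᶜ_ {m = m} {w = w}) _≤ᶜ_

_≈ᴹ_ : {w : Permutation′ n} → Rel (MaximalChainᶜ w m) _
c ≈ᴹ d = Pointwise _≈ᶜ_ (chain c) (chain d)

_≡ᴬ_ : {w : Permutation′ n} → Rel (AdmissibleOrder w m) 0ℓ
ρ ≡ᴬ σ = order ρ ≡ order σ

-- Increments R (R₁ ∷ … ∷ R_N) (X₁ ∷ … ∷ X_N) says that, with R₀ = R, each
-- R_j is the union of R_{j-1} and one further element, X_j.

data Increments {n m} {w : Permutation′ n} :
     ConsistentSet w m → List (ConsistentSet w m) → List (Vec (Fin n) m) → Set₁ where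
  []  : ∀ {R} → Increments R [] []
  _∷_ : ∀ {R S Ss X Xs} →
        Adds X R S → Increments S Ss Xs → Increments R (S ∷ Ss) (X ∷ Xs)

-- The chain is ∅, R₁, …, R_N and ρ lists the elements added at each step.

IsLabelling : {w : Permutation′ n} → MaximalChainᶜ w m → AdmissibleOrder w m → Set₁
IsLabelling c ρ =
  ∃₂ λ R₀ Rs → chain c ≡ R₀ ∷ Rs × set R₀ ≐ ∅ × Increments R₀ Rs (order ρ)

{-# OPTIONS --safe #-}

-- Say that x ≺ y if (x , y) is an inversion of w (x < y, with y before x in w) and x ◁ y if x < y
-- and x comes before y in w.  Then Inv w consists of the ≺-chains, and the steps of the permanent
-- order are the moves of one element of a chain along ◁, to the left or to the right according to
-- the number of elements above it.
--
-- Reversal sets are consistent by comparing the faces that the packets of a packet share, and two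
-- admissible orders with the same reversal set differ only in pairs that commute.  The two facts
-- that need an induction remove an element a that is extremal, i.e. a ≺ x or a ◁ x for every other
-- x (or a ≺ x or x ◁ a for every other x).
--
-- (1) Every consistent U is a reversal set.  The chains without a that have to precede the chains
--     through a, the chains through a, and the remaining chains without a are put in this order,
--     where a chain X with a ≺ X precedes exactly when a ∷ X lies in U.  Consistency of U says that
--     no relation points backwards between the three parts, and the parts are ordered by induction.
--
-- (2) Every nonempty consistent R has an element X such that R ∖ {X} is consistent: if some a ∷ Y
--     lies in R, let Y be the last such chain in an order, with reversal set R, of the chains
--     without a; otherwise use induction.  Here the side on which a is extremal has to fit the
--     parity.  Complements, with ◁ reversed, give elements that can be added.
--
-- If R and R ∪ {X} are the reversal sets of ρ and σ, let an element be high if it follows some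
-- element of P(X) both in ρ and in σ.  Moving the high elements above P(X) and the others below it
-- only commutes commuting elements, because P(X) is reversed between ρ and σ.  So P(X) can be
-- flipped, which together with (1) and (2) gives the isomorphism and the rank function.

module Submission where

open import Defs
open import Data.Nat.Base using (ℕ; suc; _≤_)
open import Data.Fin.Permutation using (Permutation′; _⟨$⟩ˡ_; _⟨$⟩ʳ_; inverseʳ; inverseˡ)
open import Data.Product.Base using (_×_; ∃; ∃₂; _,_; proj₁; proj₂)
open import Function.Definitions using (Congruent; Bijective)
open import Relation.Binary.Structures using (IsEquivalence; IsPartialOrder)
open import Relation.Binary.Morphism.Structures using (IsOrderIsomorphism)
open import Relation.Unary using (Pred; Decidable; _⊆_; _≐_; _∩_; _∪_; ｛_｝; ∅)
open import Level using (0ℓ; _⊔_)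
open import Data.Empty using (⊥; ⊥-elim)
open import Data.Fin.Base as Fin using (Fin; zero; suc; toℕ; inject₁)
import Data.Fin.Properties as Fin
open import Data.List.Base as List using (List; []; _∷_; _++_; [_]; reverse; filter)
import Data.List.Properties as List
import Data.List.Membership.DecPropositional as DecMembership
open import Data.List.Membership.Propositional using (_∈_; _∉_; lose; find)
open import Data.List.Membership.Propositional.Properties
open import Data.List.Relation.Binary.Pointwise using (Pointwise; []; _∷_)
open import Data.List.Relation.Unary.All as All using (All; []; _∷_)
import Data.List.Relation.Unary.All.Properties as All
open import Data.List.Relation.Unary.AllPairs as AllPairs using (AllPairs; []; _∷_)
import Data.List.Relation.Unary.AllPairs.Properties as AllPairs
open import Data.List.Relation.Unary.Any as Any using (Any; here; there)
import Data.List.Relation.Unary.Any.Properties as Any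
open import Data.List.Relation.Unary.Linked as Linked using (Linked; []; [-]; _∷_)
import Data.List.Relation.Unary.Linked.Properties as Linked
open import Data.List.Relation.Unary.Unique.Propositional using (Unique)
import Data.List.Relation.Unary.Unique.Propositional.Properties as Unique
open import Data.Nat.Base as ℕ using (zero; z≤n; s≤s; s<s; _∸_)
open import Data.Nat.Divisibility using (_∣_; _∣?_; _∣0; ∣m+n∣m⇒∣n; ∣m∣n⇒∣m+n; ∣-refl; ∣1⇒≡1)
import Data.Nat.Properties as ℕ
open import Data.Sum.Base as Sum using (_⊎_; inj₁; inj₂; [_,_]′)
open import Data.Vec.Base using (Vec; []; _∷_; lookup; removeAt; head)
import Data.Vec.Properties as Vec
open import Data.Vec.Relation.Unary.All as VAll using ([]; _∷_) renaming (All to VAll)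
import Data.Vec.Relation.Unary.All.Properties as VAll
open import Data.Vec.Relation.Unary.AllPairs as VAllPairs using ([]; _∷_) renaming (AllPairs to VAllPairs)
open import Function.Base using (_∘_; id; case_of_)
open import Function.Bundles using (_⇔_; mk⇔; Equivalence)
open import Relation.Binary.Construct.Closure.ReflexiveTransitive as Star using (Star; ε; _◅_; _◅◅_)
import Relation.Binary.Construct.NonStrictToStrict as ToStrict
open import Relation.Binary.Core using (Rel)
open import Relation.Binary.Definitions using (Transitive; DecidableEquality; tri<; tri≈; tri>)
  renaming (Decidable to Decidable₂)
open import Relation.Binary.PropositionalEquality
  using (_≡_; _≢_; refl; sym; trans; cong; cong₂; subst; subst₂)
open import Relation.Nullary using (¬_; Dec; yes; no; contradiction; ¬?; _×-dec_; _⊎-dec_)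
open import Relation.Nullary.Decidable using (map′; decidable-stable)

-- Vectors with one entry removed, and filtered lists

module _ {a p} {A : Set a} {P : Pred A p} where

  all-removeAt : ∀ {k} {X : Vec A (suc k)} → VAll P X → ∀ i → VAll P (removeAt X i)
  all-removeAt (_ ∷ pX) zero = pX
  all-removeAt (px ∷ pX@(_ ∷ _)) (suc i) = px ∷ all-removeAt pX i

  -- An entry lost in one of the two faces survives in the other, because the removed positions
  -- differ.
  all-removeAt⁻ : ∀ {k} (X : Vec A (suc k)) {i j} → i ≢ j →
                  VAll P (removeAt X i) → VAll P (removeAt X j) → VAll P X
  all-removeAt⁻ (x ∷ []) {zero} {zero} i≢j _ _ = contradiction refl i≢j
  all-removeAt⁻ (x ∷ _ ∷ _) {zero} {zero} i≢j _ _ = contradiction refl i≢j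
  all-removeAt⁻ (x ∷ _ ∷ _) {zero} {suc j} i≢j pX (px ∷ _) = px ∷ pX
  all-removeAt⁻ (x ∷ _ ∷ _) {suc i} {zero} i≢j (px ∷ _) pX = px ∷ pX
  all-removeAt⁻ (x ∷ X@(_ ∷ _)) {suc i} {suc j} i≢j (px ∷ p) (_ ∷ q) =
    px ∷ all-removeAt⁻ X (i≢j ∘ cong suc) p q

allPairs-removeAt : ∀ {a r} {A : Set a} {R : Rel A r} {k} {X : Vec A (suc k)} →
                    VAllPairs R X → ∀ i → VAllPairs R (removeAt X i)
allPairs-removeAt (_ ∷ rX) zero = rX
allPairs-removeAt (rx ∷ rX@(_ ∷ _)) (suc i) = all-removeAt rx i ∷ allPairs-removeAt rX i

filter-length≤ : ∀ {a p} {A : Set a} {P : Pred A p} (P? : Decidable P) {xs : List A} {n} →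
                 List.length xs ℕ.≤ n → List.length (List.filter P? xs) ℕ.≤ n
filter-length≤ P? {xs} = ℕ.≤-trans (List.length-filter P? xs)

last-satisfying : ∀ {a p r} {A : Set a} {R : Rel A r} {P : Pred A p} → Decidable P →
                  ∀ {xs} → AllPairs R xs →
                  (∀ {x} → x ∈ xs → ¬ P x) ⊎
                  ∃ λ x → x ∈ xs × P x × (∀ {y} → y ∈ xs → P y → y ≡ x ⊎ R y x)
last-satisfying P? [] = inj₁ λ ()
last-satisfying P? {x ∷ xs} (Rx ∷ Rxs) with last-satisfying P? Rxs
... | inj₂ (y , y∈ , py , last) = inj₂ (y , there y∈ , py , λ where
        (here refl) _  → inj₂ (All.lookup Rx y∈)
        (there z∈) pz → last z∈ pz)
... | inj₁ none with P? x
...   | yes px = inj₂ (x , here refl , px , λ where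
          (here refl) _ → inj₁ refl
          (there z∈) pz → contradiction pz (none z∈))
...   | no ¬px = inj₁ λ where
          (here refl) → ¬px
          (there z∈)  → none z∈

-- Chains of two orders and their consistent sets

-- An abstraction of ≺ and ◁ in which ◁ can be reversed.

record TwoOrders (A : Set) : Set₁ where
  infix 4 _≺_ _◁_ _≺?_ _≟_
  field
    _≺_ _◁_  : Rel A 0ℓ
    ≺-trans  : Transitive _≺_
    ≺-irrefl : ∀ {x} → ¬ x ≺ x
    ◁-trans  : Transitive _◁_
    ◁-irrefl : ∀ {x} → ¬ x ◁ x
    ≺⇒⋪      : ∀ {x y} → x ≺ y → ¬ x ◁ y
    ≺⇒⋫      : ∀ {x y} → x ≺ y → ¬ y ◁ x
    _≺?_     : Decidable₂ _≺_
    _≟_      : DecidableEquality A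

mirror : ∀ {A} → TwoOrders A → TwoOrders A
mirror O = record
  { _≺_ = _≺_ ; _◁_ = λ x y → y ◁ x
  ; ≺-trans = ≺-trans ; ≺-irrefl = ≺-irrefl
  ; ◁-trans = λ p q → ◁-trans q p ; ◁-irrefl = ◁-irrefl
  ; ≺⇒⋪ = ≺⇒⋫ ; ≺⇒⋫ = ≺⇒⋪ ; _≺?_ = _≺?_ ; _≟_ = _≟_ }
  where open TwoOrders O

module Chains {A : Set} (O : TwoOrders A) where
  open TwoOrders O public

  -- Only the parity of the index matters. By this recursion `Side (suc t) x y` is `Side t y x` by
  -- definition, so the change of direction between chains of consecutive lengths needs no
  -- arithmetic.
  Side : ℕ → Rel A 0ℓ
  Side zero    x y = x ◁ y
  Side (suc t) x y = Side t y x

  side-trans : ∀ t → Transitive (Side t)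
  side-trans zero    = ◁-trans
  side-trans (suc t) = λ p q → side-trans t q p

  side-irrefl : ∀ t {x} → ¬ Side t x x
  side-irrefl zero    = ◁-irrefl
  side-irrefl (suc t) = side-irrefl t

  side-asym : ∀ t {x y} → Side t x y → ¬ Side t y x
  side-asym t p q = side-irrefl t (side-trans t p q)

  ≺⇒¬side : ∀ t {x y} → x ≺ y → ¬ Side t x y
  ≺⇒¬side zero          = ≺⇒⋪
  ≺⇒¬side (suc zero)    = ≺⇒⋫
  ≺⇒¬side (suc (suc t)) = ≺⇒¬side t

  same-or-opposite-side : ∀ s t → (∀ {x y} → Side s x y → Side t x y) ⊎
                                  (∀ {x y} → Side s x y → Side t y x)
  same-or-opposite-side zero zero = inj₁ id
  same-or-opposite-side zero (suc t) = Sum.swap (same-or-opposite-side zero t)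
  same-or-opposite-side (suc s) t =
    Sum.swap (Sum.map (λ f p → f p) (λ f p → f p) (same-or-opposite-side s t))

  Chain : ∀ {k} → Pred (Vec A k) 0ℓ
  Chain = VAllPairs _≺_

  infix 4 _∈ᶜ_

  _∈ᶜ_ : ∀ {k} → Vec A k → List A → Set
  X ∈ᶜ as = Chain X × VAll (_∈ as) X

  chain-∷ : ∀ {k a} {X : Vec A (suc k)} → a ≺ head X → Chain X → Chain (a ∷ X)
  chain-∷ a≺x (x≺X ∷ cX) = (a≺x ∷ VAll.map (≺-trans a≺x) x≺X) ∷ x≺X ∷ cX

  ∈ᶜ-removeAt : ∀ {k as} {X : Vec A (suc k)} → X ∈ᶜ as → ∀ i → removeAt X i ∈ᶜ as
  ∈ᶜ-removeAt (cX , X⊆as) i = allPairs-removeAt cX i , all-removeAt X⊆as i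

  ∈ᶜ-there : ∀ {k a as} {X : Vec A k} → X ∈ᶜ as → X ∈ᶜ a ∷ as
  ∈ᶜ-there (cX , X⊆as) = cX , VAll.map there X⊆as

  ∈ᶜ-∷ : ∀ {k a as} {X : Vec A (suc k)} → a ≺ head X → X ∈ᶜ as → a ∷ X ∈ᶜ a ∷ as
  ∈ᶜ-∷ a≺x X∈ = chain-∷ a≺x (proj₁ X∈) , here refl ∷ proj₂ (∈ᶜ-there X∈)

  -- The coordinates of a chain move alternately to the left and to the right, which is why the
  -- direction depends only on the number of coordinates that follow.

  data Step : ∀ {k} → Rel (Vec A k) 0ℓ where
    here  : ∀ {k x y} {X : Vec A k} → Side k x y → Step (x ∷ X) (y ∷ X)
    there : ∀ {k x} {X Y : Vec A k} → Step X Y → Step (x ∷ X) (x ∷ Y)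

  step-irrefl : ∀ {k} {X : Vec A k} → ¬ Step X X
  step-irrefl {suc k} (here s)  = side-irrefl k s
  step-irrefl         (there s) = step-irrefl s

  -- The prefix-or-suffix condition is split in two: neither the set nor its complement skips a face
  -- between two of its own. Complementation exchanges `convex` and `coconvex`, so results on
  -- removal also give results on insertion. Everything is relative to chains in `as`, which allows
  -- elements to be deleted one at a time.
  record Consistent (as : List A) {k} (U : Pred (Vec A (suc k)) 0ℓ) : Set where
    field
      dec      : Decidable U
      lower    : ∀ {X Y} → X ∈ᶜ as → Y ∈ᶜ as → Step X Y → U Y → U X
      convex   : ∀ Z {i j l} → Z ∈ᶜ as → i Fin.< j → j Fin.< l →
                 U (removeAt Z i) → U (removeAt Z l) → U (removeAt Z j)
      coconvex : ∀ Z {i j l} → Z ∈ᶜ as → i Fin.< j → j Fin.< l →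
                 ¬ U (removeAt Z i) → ¬ U (removeAt Z l) → ¬ U (removeAt Z j)

  consistent-⊆ : ∀ {as bs k} {U : Pred (Vec A (suc k)) 0ℓ} →
                 (∀ {x} → x ∈ as → x ∈ bs) → Consistent bs U → Consistent as U
  consistent-⊆ as⊆bs con = record
    { dec = dec
    ; lower = λ X∈ Y∈ → lower (widen X∈) (widen Y∈)
    ; convex = λ Z Z∈ → convex Z (widen Z∈)
    ; coconvex = λ Z Z∈ → coconvex Z (widen Z∈) }
    where
    open Consistent con
    widen : ∀ {k} {X : Vec A k} → X ∈ᶜ _ → X ∈ᶜ _
    widen (cX , X⊆as) = cX , VAll.map as⊆bs X⊆as

  -- The relations that any order with reversal set U has to satisfy.

  data Edge {k} (U : Pred (Vec A (suc k)) 0ℓ) (X Y : Vec A k) : Set where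
    step    : Step X Y → Edge U X Y
    antilexᵉ : ∀ Z {i j} → Chain Z → i Fin.< j → U Z →
              X ≡ removeAt Z i → Y ≡ removeAt Z j → Edge U X Y
    lexᵉ     : ∀ Z {i j} → Chain Z → j Fin.< i → ¬ U Z →
              X ≡ removeAt Z i → Y ≡ removeAt Z j → Edge U X Y

  -- Deleting the common head keeps the number of coordinates after a moved one. A packet of a chain
  -- `Z` with both vectors in it comes from a packet without the head: if one of them dropped the
  -- head of `Z`, then `a` would occur twice in `Z`.
  edge-∷⁻ : ∀ {k a} {U : Pred (Vec A (2 ℕ.+ k)) 0ℓ} {X Y : Vec A k} →
            Edge U (a ∷ X) (a ∷ Y) → Edge (U ∘ (a ∷_)) X Y
  edge-∷⁻ {k} (step (here s)) = contradiction s (side-irrefl k)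
  edge-∷⁻ (step (there s)) = step s
  edge-∷⁻ (antilexᵉ (a ∷ a ∷ Z) {zero} {suc j} ((a≺a ∷ _) ∷ _) i<j u refl refl) =
    contradiction a≺a ≺-irrefl
  edge-∷⁻ (antilexᵉ (a ∷ Z@(_ ∷ _)) {suc i} {suc j} (_ ∷ cZ) (s<s i<j) u refl refl) =
    antilexᵉ Z cZ i<j u refl refl
  edge-∷⁻ (lexᵉ (a ∷ a ∷ Z) {suc i} {zero} ((a≺a ∷ _) ∷ _) j<i ¬u refl refl) =
    contradiction a≺a ≺-irrefl
  edge-∷⁻ (lexᵉ (a ∷ Z@(_ ∷ _)) {suc i} {suc j} (_ ∷ cZ) (s<s j<i) ¬u refl refl) =
    lexᵉ Z cZ j<i ¬u refl refl

  -- Sorting chains along the edges of a consistent set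

  record Sorted (as : List A) {k} (U : Pred (Vec A (suc k)) 0ℓ) : Set where
    field
      list     : List (Vec A k)
      sound    : All (_∈ᶜ as) list
      complete : ∀ {X} → X ∈ᶜ as → X ∈ list
      sorted   : AllPairs (λ X Y → X ≢ Y × ¬ Edge U Y X) list

  -- `Low` selects the chains avoiding `a` that are placed before the chains through `a`. If
  -- `a ≺ head X`, then `X` is the first face of `a ∷ X`, and membership of `a ∷ X` in `U` dictates
  -- the choice. Otherwise the only danger is a step that moves the head to or from `a`; `low-head`
  -- and `¬low-head` say that the choice respects its direction.
  module _ {a : A} {as : List A} {k} {U : Pred (Vec A (2 ℕ.+ k)) 0ℓ}
           (con : Consistent (a ∷ as) U) (a-minimal : ∀ {x} → x ∈ as → ¬ x ≺ a)
           {Low : Pred (Vec A (suc k)) 0ℓ} (low? : Decidable Low)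
           (low⇒U : ∀ {X} → Low X → a ≺ head X → U (a ∷ X))
           (¬low⇒¬U : ∀ {X} → ¬ Low X → a ≺ head X → ¬ U (a ∷ X))
           (low-head : ∀ {X} → X ∈ᶜ as → Low X → a ≺ head X ⊎ Side k (head X) a)
           (¬low-head : ∀ {X} → X ∈ᶜ as → ¬ Low X → a ≺ head X ⊎ Side k a (head X))
           where
    open Consistent con

    below-∷ : ∀ {X Y} → X ∈ᶜ as → Low X → Y ∈ᶜ a ∷ as → head Y ≡ a → ¬ Edge U Y X
    below-∷ {x ∷ X} {_ ∷ Y} X∈ lX Y∈ refl (step (here s)) with low-head X∈ lX
    ... | inj₁ a≺x = ≺⇒¬side k a≺x s
    ... | inj₂ r   = side-asym k s r
    below-∷ {x ∷ X} {_ ∷ Y} X∈ lX Y∈ refl (step (there s)) with low-head X∈ lX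
    ... | inj₁ a≺x = ≺-irrefl a≺x
    ... | inj₂ r   = side-irrefl k r
    below-∷ X∈ lX Y∈ refl (antilexᵉ (z ∷ z′ ∷ Z) {zero} {suc j} ((z≺a ∷ _) ∷ _) i<j u refl refl)
      with low-head X∈ lX
    ... | inj₁ a≺z = ≺-irrefl (≺-trans z≺a a≺z)
    ... | inj₂ r   = ≺⇒¬side k z≺a r
    below-∷ X∈ lX Y∈ refl (antilexᵉ (z ∷ z′ ∷ Z) {suc i} {suc j} _ i<j u refl refl)
      with low-head X∈ lX
    ... | inj₁ a≺a = ≺-irrefl a≺a
    ... | inj₂ r   = side-irrefl k r
    below-∷ X∈ lX Y∈ refl (lexᵉ (z ∷ Z@(_ ∷ _)) {suc i} {zero} ((a≺z ∷ _) ∷ _) j<i ¬u refl refl) =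
      ¬u (low⇒U lX a≺z)
    below-∷ X∈ lX Y∈ refl (lexᵉ (z ∷ z′ ∷ Z) {suc i} {suc j} _ j<i ¬u refl refl)
      with low-head X∈ lX
    ... | inj₁ a≺a = ≺-irrefl a≺a
    ... | inj₂ r   = side-irrefl k r

    above-∷ : ∀ {X Y} → Y ∈ᶜ as → ¬ Low Y → X ∈ᶜ a ∷ as → head X ≡ a → ¬ Edge U Y X
    above-∷ {_ ∷ X} {y ∷ Y} Y∈ lY X∈ refl (step (here s)) with ¬low-head Y∈ lY
    ... | inj₁ a≺y = ≺⇒¬side (suc k) a≺y s
    ... | inj₂ r   = side-asym k s r
    above-∷ {_ ∷ X} {y ∷ Y} Y∈ lY X∈ refl (step (there s)) with ¬low-head Y∈ lY
    ... | inj₁ a≺y = ≺-irrefl a≺y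
    ... | inj₂ r   = side-irrefl k r
    above-∷ Y∈ lY X∈ refl (lexᵉ (z ∷ z′ ∷ Z) {suc i} {zero} ((z≺a ∷ _) ∷ _) j<i ¬u refl refl)
      with ¬low-head Y∈ lY
    ... | inj₁ a≺z = ≺-irrefl (≺-trans z≺a a≺z)
    ... | inj₂ r   = ≺⇒¬side (suc k) z≺a r
    above-∷ Y∈ lY X∈ refl (lexᵉ (z ∷ z′ ∷ Z) {suc i} {suc j} _ j<i ¬u refl refl)
      with ¬low-head Y∈ lY
    ... | inj₁ a≺a = ≺-irrefl a≺a
    ... | inj₂ r   = side-irrefl k r
    above-∷ Y∈ lY X∈ refl (antilexᵉ (z ∷ Z@(_ ∷ _)) {zero} {suc j}
        ((a≺z ∷ _) ∷ _) i<j u refl refl) =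
      ¬low⇒¬U lY a≺z u
    above-∷ Y∈ lY X∈ refl (antilexᵉ (z ∷ z′ ∷ Z) {suc i} {suc j} _ i<j u refl refl)
      with ¬low-head Y∈ lY
    ... | inj₁ a≺a = ≺-irrefl a≺a
    ... | inj₂ r   = side-irrefl k r

    private
      packet-∈ᶜ : ∀ {Z : Vec A (2 ℕ.+ k)} {i j} → i ≢ j → Chain Z →
                  removeAt Z i ∈ᶜ as → removeAt Z j ∈ᶜ as → Z ∈ᶜ as
      packet-∈ᶜ {Z} i≢j cZ (_ , p) (_ , q) = cZ , all-removeAt⁻ Z i≢j p q

      ≺head-removeAt : ∀ {Z : Vec A (2 ℕ.+ k)} → a ≺ head Z → Chain Z → ∀ i →
                       a ≺ head (removeAt Z i)
      ≺head-removeAt {Z} a≺z cZ i = head≺ (all-removeAt (a≺ (chain-∷ a≺z cZ)) i)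
        where
        a≺ : Chain (a ∷ Z) → VAll (a ≺_) Z
        a≺ (p ∷ _) = p
        head≺ : ∀ {X : Vec A (suc k)} → VAll (a ≺_) X → a ≺ head X
        head≺ (p ∷ _) = p

    -- If `a ≺ head Z`, the faces of `a ∷ Z` at `zero`, `suc i` and `suc (suc j)` would be in,
    -- outside and in `U`, against convexity. Otherwise the sides leave only `i` zero with `a ≺ z′`;
    -- then `a ∷ removeAt Z zero` is one step below `Z` and would lie in `U`.
    antilex-low : ∀ Z {i j} → Z ∈ᶜ as → i Fin.< j → ¬ Low (removeAt Z i) → Low (removeAt Z j) →
                  ¬ U Z
    antilex-low Z@(z ∷ z′ ∷ _) {i} {suc j} Z∈@((z≺z′ ∷ _) ∷ _ , _) i<j ¬l l u
      with low-head (∈ᶜ-removeAt Z∈ (suc j)) l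
    ... | inj₁ a≺z = ¬low⇒¬U ¬l (≺head-removeAt a≺z (proj₁ Z∈) i)
          (convex (a ∷ Z) {zero} {suc i} {suc (suc j)} (∈ᶜ-∷ a≺z Z∈) (s≤s z≤n) (s≤s i<j)
            u (low⇒U l (≺head-removeAt a≺z (proj₁ Z∈) (suc j))))
    antilex-low Z@(z ∷ _) {suc i} {suc j} Z∈ i<j ¬l l u | inj₂ r
      with ¬low-head (∈ᶜ-removeAt Z∈ (suc i)) ¬l
    ... | inj₁ a≺z  = ≺⇒¬side (suc k) a≺z r
    ... | inj₂ q    = side-asym k q r
    antilex-low Z@(z ∷ z′ ∷ _) {zero} {suc j} Z∈@((z≺z′ ∷ _) ∷ _ , _) i<j ¬l l u | inj₂ r
      with ¬low-head (∈ᶜ-removeAt Z∈ zero) ¬l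
    ... | inj₂ q    = ≺⇒¬side k z≺z′ (side-trans k r q)
    ... | inj₁ a≺z′ = ¬low⇒¬U ¬l a≺z′
          (lower (∈ᶜ-∷ a≺z′ (∈ᶜ-removeAt Z∈ zero)) (∈ᶜ-there Z∈) (here r) u)

    -- The argument of `antilex-low` for complements: it uses `coconvex`, or the step from `Z` up to
    -- `a ∷ removeAt Z zero`.
    lex-low : ∀ Z {i j} → Z ∈ᶜ as → j Fin.< i → ¬ Low (removeAt Z i) → Low (removeAt Z j) → ¬ ¬ U Z
    lex-low Z@(z ∷ z′ ∷ _) {suc i} {j} Z∈@((z≺z′ ∷ _) ∷ _ , _) j<i ¬l l ¬u
      with ¬low-head (∈ᶜ-removeAt Z∈ (suc i)) ¬l
    ... | inj₁ a≺z = coconvex (a ∷ Z) {zero} {suc j} {suc (suc i)} (∈ᶜ-∷ a≺z Z∈) (s≤s z≤n) (s≤s j<i)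
            ¬u (¬low⇒¬U ¬l (≺head-removeAt a≺z (proj₁ Z∈) (suc i)))
            (low⇒U l (≺head-removeAt a≺z (proj₁ Z∈) j))
    lex-low Z@(z ∷ _) {suc i} {suc j} Z∈ j<i ¬l l ¬u | inj₂ r with low-head
        (∈ᶜ-removeAt Z∈ (suc j)) l
    ... | inj₁ a≺z  = ≺⇒¬side k a≺z r
    ... | inj₂ q    = side-asym k q r
    lex-low Z@(z ∷ z′ ∷ _) {suc i} {zero} Z∈@((z≺z′ ∷ _) ∷ _ , _) j<i ¬l l ¬u | inj₂ r
      with low-head (∈ᶜ-removeAt Z∈ zero) l
    ... | inj₂ q    = ≺⇒¬side (suc k) z≺z′ (side-trans k q r)
    ... | inj₁ a≺z′ = ¬u
          (lower (∈ᶜ-there Z∈) (∈ᶜ-∷ a≺z′ (∈ᶜ-removeAt Z∈ zero)) (here r) (low⇒U l a≺z′))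

    step-low : ∀ {X Y} → X ∈ᶜ as → Y ∈ᶜ as → Low X → ¬ Low Y → ¬ Step Y X
    step-low {x ∷ X} {y ∷ Y} X∈ Y∈ lX lY s with low-head X∈ lX | ¬low-head Y∈ lY
    ... | inj₁ a≺x | inj₁ a≺y =
      ¬low⇒¬U lY a≺y (lower (∈ᶜ-∷ a≺y Y∈) (∈ᶜ-∷ a≺x X∈) (there s) (low⇒U lX a≺x))
    step-low X∈ Y∈ lX lY (here s)  | inj₁ a≺x | inj₂ r   = ≺⇒¬side k a≺x (side-trans k r s)
    step-low X∈ Y∈ lX lY (there s) | inj₁ a≺x | inj₂ r   = ≺⇒¬side k a≺x r
    step-low X∈ Y∈ lX lY (here s)  | inj₂ q   | inj₁ a≺y = ≺⇒¬side (suc k) a≺y (side-trans k s q)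
    step-low X∈ Y∈ lX lY (there s) | inj₂ q   | inj₁ a≺y = ≺⇒¬side (suc k) a≺y q
    step-low X∈ Y∈ lX lY (here s)  | inj₂ q   | inj₂ r   = side-asym k r (side-trans k s q)
    step-low X∈ Y∈ lX lY (there s) | inj₂ q   | inj₂ r   = side-asym k r q

    edge-low : ∀ {X Y} → X ∈ᶜ as → Y ∈ᶜ as → Low X → ¬ Low Y → ¬ Edge U Y X
    edge-low X∈ Y∈ lX lY (step s) = step-low X∈ Y∈ lX lY s
    edge-low X∈ Y∈ lX lY (antilexᵉ Z cZ i<j u refl refl) =
      antilex-low Z (packet-∈ᶜ {Z} (Fin.<⇒≢ i<j) cZ Y∈ X∈) i<j lY lX u
    edge-low X∈ Y∈ lX lY (lexᵉ Z cZ j<i ¬u refl refl) =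
      lex-low Z (packet-∈ᶜ {Z} (Fin.<⇒≢ j<i ∘ sym) cZ Y∈ X∈) j<i lY lX ¬u

    -- Chains through `a` are sorted by their tails, which are chains of elements above `a`; by
    -- `edge-∷⁻` no further edges have to be respected. Nothing is missed, because `a-minimal`
    -- prevents `a` from occurring behind another element of a chain.
    sorted-∷ : Sorted as U → Sorted (List.filter (a ≺?_) as) (U ∘ (a ∷_)) → Sorted (a ∷ as) U
    sorted-∷ ρ σ = record
      { list = lows ++ mids ++ highs
      ; sound = All.++⁺ (All.tabulate (∈ᶜ-there ∘ proj₁ ∘ low⁻))
          (All.++⁺ (All.tabulate (proj₁ ∘ mid⁻)) (All.tabulate (∈ᶜ-there ∘ proj₁ ∘ high⁻)))
      ; complete = complete′
      ; sorted = AllPairs.++⁺ (AllPairs.filter⁺ low? ρ.sorted)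
          (AllPairs.++⁺
            (AllPairs.map⁺ (AllPairs.map (λ (X≢Y , ¬e) → X≢Y ∘ Vec.∷-injectiveʳ ,
                ¬e ∘ edge-∷⁻) σ.sorted))
            (AllPairs.filter⁺ (¬? ∘ low?) ρ.sorted)
            (All.tabulate λ X∈ → All.tabulate (mid-high X∈)))
          (All.tabulate λ X∈ → All.++⁺ (All.tabulate (low-mid X∈)) (All.tabulate (low-high X∈))) }
      where
      module ρ = Sorted ρ
      module σ = Sorted σ
      lows = List.filter low? ρ.list
      mids = List.map (a ∷_) σ.list
      highs = List.filter (¬? ∘ low?) ρ.list

      low⁻ : ∀ {X} → X ∈ lows → X ∈ᶜ as × Low X
      low⁻ X∈ = let X∈ρ , l = ∈-filter⁻ low? X∈ in All.lookup ρ.sound X∈ρ , l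
      high⁻ : ∀ {X} → X ∈ highs → X ∈ᶜ as × ¬ Low X
      high⁻ X∈ = let X∈ρ , l = ∈-filter⁻ (¬? ∘ low?) X∈ in All.lookup ρ.sound X∈ρ , l
      mid⁻ : ∀ {X} → X ∈ mids → X ∈ᶜ a ∷ as × head X ≡ a
      mid⁻ X∈ with Y , Y∈σ , refl ← ∈-map⁻ (a ∷_) X∈ =
        let cY , Y⊆ = All.lookup σ.sound Y∈σ in
        (VAll.map (λ p → proj₂ (∈-filter⁻ (a ≺?_) {xs = as} p)) Y⊆ ∷ cY ,
         here refl ∷ VAll.map (λ p → there (proj₁ (∈-filter⁻ (a ≺?_) {xs = as} p))) Y⊆) , refl

      low-mid : ∀ {X Y} → X ∈ lows → Y ∈ mids → X ≢ Y × ¬ Edge U Y X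
      low-mid X∈ Y∈ = let X∈as , l = low⁻ X∈; Y∈as , eq = mid⁻ Y∈ in
        (λ { refl → [ (λ p → ≺-irrefl (subst (a ≺_) eq p)) ,
            (λ r → side-irrefl k (subst (λ x → Side k x a) eq r)) ]′
                    (low-head X∈as l) }) ,
        below-∷ X∈as l Y∈as eq
      mid-high : ∀ {X Y} → X ∈ mids → Y ∈ highs → X ≢ Y × ¬ Edge U Y X
      mid-high X∈ Y∈ = let X∈as , eq = mid⁻ X∈; Y∈as , ¬l = high⁻ Y∈ in
        (λ { refl → [ (λ p → ≺-irrefl (subst (a ≺_) eq p)) ,
            (λ r → side-irrefl k (subst (Side k a) eq r)) ]′
                    (¬low-head Y∈as ¬l) }) ,
        above-∷ Y∈as ¬l X∈as eq
      low-high : ∀ {X Y} → X ∈ lows → Y ∈ highs → X ≢ Y × ¬ Edge U Y X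
      low-high X∈ Y∈ = let X∈as , l = low⁻ X∈; Y∈as , ¬l = high⁻ Y∈ in
        (λ { refl → ¬l l }) , edge-low X∈as Y∈as l ¬l

      complete′ : ∀ {X} → X ∈ᶜ a ∷ as → X ∈ lows ++ mids ++ highs
      complete′ {_ ∷ X} (a≺X ∷ cX , here refl ∷ X⊆) =
        ∈-++⁺ʳ lows (∈-++⁺ˡ (∈-map⁺ (a ∷_) (σ.complete (cX , tail-⊆ a≺X X⊆))))
        where
        tail-⊆ : ∀ {m} {X : Vec A m} → VAll (a ≺_) X → VAll (_∈ a ∷ as) X →
                 VAll (_∈ List.filter (a ≺?_) as) X
        tail-⊆ [] [] = []
        tail-⊆ (p ∷ _) (here refl ∷ _) = contradiction p ≺-irrefl
        tail-⊆ (p ∷ ps) (there q ∷ qs) = ∈-filter⁺ (a ≺?_) q p ∷ tail-⊆ ps qs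
      complete′ {X} (cX@(x≺X ∷ _) , there x∈ ∷ X⊆) = by-low (low? X)
        where
        tail-⊆ : ∀ {m x} {X : Vec A m} → x ∈ as → VAll (x ≺_) X → VAll (_∈ a ∷ as) X →
                 VAll (_∈ as) X
        tail-⊆ x∈ [] [] = []
        tail-⊆ x∈ (x≺a ∷ _) (here refl ∷ _) = contradiction x≺a (a-minimal x∈)
        tail-⊆ x∈ (p ∷ ps) (there q ∷ qs) = q ∷ tail-⊆ x∈ ps qs
        X∈ρ : X ∈ ρ.list
        X∈ρ = ρ.complete (cX , x∈ ∷ tail-⊆ x∈ x≺X X⊆)
        by-low : Dec (Low X) → X ∈ lows ++ mids ++ highs
        by-low (yes l) = ∈-++⁺ˡ (∈-filter⁺ low? X∈ρ l)
        by-low (no ¬l) = ∈-++⁺ʳ lows (∈-++⁺ʳ mids (∈-filter⁺ (¬? ∘ low?) X∈ρ ¬l))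

  -- The faces of `Z` correspond to the faces of `a ∷ Z` other than the first, in the same order.
  consistent-∷ : ∀ {a as k} {U : Pred (Vec A (2 ℕ.+ k)) 0ℓ} →
                 Consistent (a ∷ as) U → Consistent (List.filter (a ≺?_) as) (U ∘ (a ∷_))
  consistent-∷ {a} {as} {k} con = record
    { dec = dec ∘ (a ∷_)
    ; lower = λ X∈ Y∈ s → lower (∷-∈ᶜ X∈) (∷-∈ᶜ Y∈) (there s)
    ; convex = λ { Z@(_ ∷ _) Z∈ i<j j<l → convex (a ∷ Z) (∷-∈ᶜ Z∈) (s<s i<j) (s<s j<l) }
    ; coconvex = λ { Z@(_ ∷ _) Z∈ i<j j<l → coconvex (a ∷ Z) (∷-∈ᶜ Z∈) (s<s i<j) (s<s j<l) } }
    where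
    open Consistent con
    ∷-∈ᶜ : ∀ {m} {X : Vec A m} → X ∈ᶜ List.filter (a ≺?_) as → a ∷ X ∈ᶜ a ∷ as
    ∷-∈ᶜ (cX , X⊆) =
      VAll.map (λ p → proj₂ (∈-filter⁻ (a ≺?_) {xs = as} p)) X⊆ ∷ cX ,
      here refl ∷ VAll.map (λ p → there (proj₁ (∈-filter⁻ (a ≺?_) {xs = as} p))) X⊆

  Extremal : ℕ → A → A → Set
  Extremal d a x = a ≺ x ⊎ Side d a x

  -- The bound `N` carries the induction, since the chains through `a` are sorted over a filtered
  -- list. Either kind of extremality works: comparing the parities of `d` and `k` tells on which
  -- side of `a` the heads lie that are not above it.
  consistent⇒sorted : ∀ d N as → List.length as ℕ.≤ N → AllPairs (Extremal d) as →
                      ∀ {k} {U : Pred (Vec A (suc k)) 0ℓ} → Consistent as U → Sorted as U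
  consistent⇒sorted d N as len ext {zero} con = record
    { list = [ [] ] ; sound = ([] , []) ∷ []
    ; complete = λ { {[]} _ → here refl } ; sorted = [] ∷ [] }
  consistent⇒sorted d N [] len ext {suc k} con = record
    { list = [] ; sound = [] ; complete = λ { (_ , () ∷ _) } ; sorted = [] }
  consistent⇒sorted d (suc N) (a ∷ as) (s≤s len) (a-ext ∷ ext) {suc k} {U} con =
    [ below , above ]′ (same-or-opposite-side d k)
    where
    open Consistent con
    ρ : Sorted as U
    ρ = consistent⇒sorted d N as len ext (consistent-⊆ there con)
    σ : Sorted (List.filter (a ≺?_) as) (U ∘ (a ∷_))
    σ = consistent⇒sorted d N (List.filter (a ≺?_) as) (filter-length≤ (a ≺?_) {as} len)
          (AllPairs.filter⁺ (a ≺?_) ext) (consistent-∷ con)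
    a-minimal : ∀ {x} → x ∈ as → ¬ x ≺ a
    a-minimal x∈ x≺a with All.lookup a-ext x∈
    ... | inj₁ a≺x = ≺-irrefl (≺-trans a≺x x≺a)
    ... | inj₂ r   = ≺⇒¬side (suc d) x≺a r

    -- Heads not above `a` may follow `a`, so only the chains that `U` forces to be low are low.
    below : (∀ {x y} → Side d x y → Side k x y) → Sorted (a ∷ as) U
    below d⇒k = sorted-∷ con a-minimal
      (λ X → (a ≺? head X) ×-dec dec (a ∷ X))
      (λ (_ , u) _ → u) (λ ¬l a≺x u → ¬l (a≺x , u))
      (λ _ (a≺x , _) → inj₁ a≺x)
      (λ { {_ ∷ _} (_ , x∈ ∷ _) _ → Sum.map₂ d⇒k (All.lookup a-ext x∈) }) ρ σ

    -- Heads not above `a` have to precede `a`, so every chain is low unless `U` forces it to be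
    -- high.
    above : (∀ {x y} → Side d x y → Side k y x) → Sorted (a ∷ as) U
    above d⇒k = sorted-∷ con a-minimal
      (λ X → ¬? ((a ≺? head X) ×-dec ¬? (dec (a ∷ X))))
      (λ {X} l a≺x → decidable-stable (dec (a ∷ X)) (λ ¬u → l (a≺x , ¬u)))
      (λ ¬l a≺x u → ¬l (λ (_ , ¬u) → ¬u u))
      (λ { {_ ∷ _} (_ , x∈ ∷ _) _ → Sum.map₂ d⇒k (All.lookup a-ext x∈) })
      (λ {X} _ ¬l → inj₁ (proj₁ (decidable-stable ((a ≺? head X) ×-dec ¬? (dec (a ∷ X))) ¬l))) ρ σ

  -- Removing one element from a consistent set

  infixl 7 _without_

  _without_ : ∀ {k} → Pred (Vec A k) 0ℓ → Vec A k → Pred (Vec A k) 0ℓ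
  (R without X) Y = R Y × Y ≢ X

  infix 4 _≟ᶜ_

  _≟ᶜ_ : ∀ {k} → DecidableEquality (Vec A k)
  _≟ᶜ_ = Vec.≡-dec _≟_

  not-without : ∀ {k} {R : Pred (Vec A k) 0ℓ} {X Y} → ¬ (R without X) Y → ¬ R Y ⊎ Y ≡ X
  not-without {X = X} {Y} ¬r with Y ≟ᶜ X
  ... | yes Y≡X = inj₂ Y≡X
  ... | no Y≢X  = inj₁ (λ r → ¬r (r , Y≢X))

  module _ {k} {a : A} {as : List A} (a-ext : ∀ {x} → x ∈ as → a ≺ x ⊎ Side (suc k) a x)
           {R : Pred (Vec A (suc k)) 0ℓ} (con : Consistent (a ∷ as) R) where
    open Consistent con

    private
      ≺-minimal : ∀ {x} → x ∈ a ∷ as → ¬ x ≺ a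
      ≺-minimal (here refl) = ≺-irrefl
      ≺-minimal (there x∈) x≺a with a-ext x∈
      ... | inj₁ a≺x = ≺-irrefl (≺-trans a≺x x≺a)
      ... | inj₂ r   = ≺⇒¬side k x≺a r

    -- The parity in `a-ext` rules out a step from `a ∷ Y` that moves its head. The packets that
    -- need care are those of chains `a ∷ Z`: whether `R Z` holds orients the faces of `Z`, and a
    -- critical violation then produces an edge from `Y` to another remaining chain, against
    -- `maximal`.
    without-consistent : ∀ {Y} →
      (∀ {V} → a ∷ V ∈ᶜ a ∷ as → (R without (a ∷ Y)) (a ∷ V) → ¬ Edge R Y V) →
      Consistent (a ∷ as) (R without (a ∷ Y))
    without-consistent {Y} maximal = record
      { dec = λ X → dec X ×-dec ¬? (X ≟ᶜ a ∷ Y)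
      ; lower = λ { X∈ V∈ s (rV , V≢) → lower X∈ V∈ s rV , λ { refl → lower′ V∈ s (rV , V≢) } }
      ; convex = λ { Z Z∈ i<j j<l p q → convex Z Z∈ i<j j<l (proj₁ p) (proj₁ q) ,
                                        λ J≡ → convex′ Z Z∈ i<j j<l p q J≡ }
      ; coconvex = λ { Z Z∈ i<j j<l p q → coconvex′ Z Z∈ i<j j<l (not-without {R = R} p)
          (not-without {R = R} q) } }
      where
      lower′ : ∀ {V} → V ∈ᶜ a ∷ as → Step (a ∷ Y) V → ¬ (R without (a ∷ Y)) V
      lower′ V∈ (there s) r = maximal V∈ r (step s)
      lower′ (_ , here refl ∷ _) (here s) r = side-irrefl k s
      lower′ (_ , there x∈ ∷ _) (here s) r with a-ext x∈
      ... | inj₁ a≺x = ≺⇒¬side k a≺x s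
      ... | inj₂ q   = side-asym k q s

      convex′ : ∀ Z {i j l} → Z ∈ᶜ a ∷ as → i Fin.< j → j Fin.< l →
                (R without (a ∷ Y)) (removeAt Z i) → (R without (a ∷ Y)) (removeAt Z l) →
                removeAt Z j ≢ a ∷ Y
      convex′ (a ∷ Z@(_ ∷ _)) {i} {suc j} {suc l} Z∈@(_ ∷ cZ , _) i<j (s<s j<l) p q refl with dec Z
      ... | yes rZ = maximal (∈ᶜ-removeAt Z∈ (suc l)) q (antilexᵉ Z cZ j<l rZ refl refl)
      convex′ (a ∷ Z@(_ ∷ _)) {zero} Z∈ i<j j<l p q refl | no ¬rZ = ¬rZ (proj₁ p)
      convex′ (a ∷ Z@(_ ∷ _)) {suc i} Z∈@(_ ∷ cZ , _) (s<s i<j) j<l p q refl | no ¬rZ =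
        maximal (∈ᶜ-removeAt Z∈ (suc i)) p (lexᵉ Z cZ i<j ¬rZ refl refl)

      coconvex′ : ∀ Z {i j l} → Z ∈ᶜ a ∷ as → i Fin.< j → j Fin.< l →
                  ¬ R (removeAt Z i) ⊎ removeAt Z i ≡ a ∷ Y →
                  ¬ R (removeAt Z l) ⊎ removeAt Z l ≡ a ∷ Y → ¬ (R without (a ∷ Y)) (removeAt Z j)
      coconvex′ Z Z∈ i<j j<l (inj₁ ¬p) (inj₁ ¬q) (r , _) = coconvex Z Z∈ i<j j<l ¬p ¬q r
      coconvex′ (z ∷ .(a ∷ Y)) {zero} ((z≺a ∷ _) ∷ _ , z∈ ∷ _) i<j j<l (inj₂ refl) q r =
          ≺-minimal z∈ z≺a
      coconvex′ (a ∷ Z@(_ ∷ _)) {suc i} {suc j} {suc l} Z∈@(_ ∷ cZ , _) (s<s i<j) (s<s j<l)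
          (inj₂ refl) q r
        with dec Z | q
      ... | yes rZ | _       = maximal (∈ᶜ-removeAt Z∈ (suc j)) r (antilexᵉ Z cZ i<j rZ refl refl)
      ... | no ¬rZ | inj₁ ¬q = coconvex (a ∷ Z) Z∈ (s≤s z≤n) (s<s j<l) ¬rZ ¬q (proj₁ r)
      ... | no ¬rZ | inj₂ eq = maximal (∈ᶜ-removeAt Z∈ (suc j)) r
              (lexᵉ Z cZ j<l ¬rZ (sym (Vec.∷-injectiveʳ eq)) refl)
      coconvex′ (a ∷ Z@(_ ∷ _)) {i} {suc j} {suc l} Z∈@(_ ∷ cZ , _) i<j (s<s j<l) (inj₁ ¬p)
          (inj₂ refl) r
        with dec Z
      ... | no ¬rZ = maximal (∈ᶜ-removeAt Z∈ (suc j)) r (lexᵉ Z cZ j<l ¬rZ refl refl)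
      coconvex′ (a ∷ Z@(_ ∷ _)) {zero} Z∈ i<j j<l (inj₁ ¬p) (inj₂ refl) r | yes rZ = ¬p rZ
      coconvex′ (a ∷ Z@(_ ∷ _)) {suc i} Z∈ i<j j<l (inj₁ ¬p) (inj₂ refl) r | yes rZ =
        ¬p (convex (a ∷ Z) Z∈ (s≤s z≤n) i<j rZ (proj₁ r))

    ∷-∈ᶜ⁻ : ∀ {m} {Y : Vec A m} → a ∷ Y ∈ᶜ a ∷ as → Y ∈ᶜ as
    ∷-∈ᶜ⁻ (a≺Y ∷ cY , _ ∷ Y⊆) = cY ,
      VAll.map (λ { (p , here refl) → contradiction p ≺-irrefl ; (_ , there q) → q })
          (VAll.zip (a≺Y , Y⊆))

    ∈ᶜ-there⁻ : ∀ {m} {X : Vec A (suc m)} → X ∈ᶜ a ∷ as → (∃ λ Y → X ≡ a ∷ Y) ⊎ X ∈ᶜ as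
    ∈ᶜ-there⁻ (_ , here refl ∷ _) = inj₁ (_ , refl)
    ∈ᶜ-there⁻ (cX@(x≺X ∷ _) , there x∈ ∷ X⊆) = inj₂ (cX , x∈ ∷
      VAll.map (λ { (p , here refl) → contradiction p (≺-minimal (there x∈)) ; (_ , there q) → q })
          (VAll.zip (x≺X , X⊆)))

    -- The packet of a chain through `a` can meet `R` only in its first face, so it imposes nothing.
    -- A step between two elements at issue cannot involve `a` either, since `R` is closed
    -- downwards.
    without-there-consistent : ∀ {X} → Consistent as (R without X) →
                               (∀ {Y} → a ∷ Y ∈ᶜ a ∷ as → ¬ R (a ∷ Y)) →
                                   Consistent (a ∷ as) (R without X)
    without-there-consistent {X} con′ empty = record
      { dec = Consistent.dec con′
      ; lower = λ V∈ W∈ s r → lower V∈ W∈ s (proj₁ r) , λ { refl → lower′ V∈ W∈ s r }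
      ; convex = λ Z Z∈ i<j j<l p q → convex Z Z∈ i<j j<l (proj₁ p) (proj₁ q) ,
          convex′ Z Z∈ i<j j<l p q (∈ᶜ-there⁻ Z∈)
      ; coconvex = λ Z Z∈ i<j j<l p q r → coconvex′ Z Z∈ i<j j<l p q (∈ᶜ-there⁻ Z∈) r }
      where
      module con′ = Consistent con′
      lower′ : ∀ {W} → X ∈ᶜ a ∷ as → W ∈ᶜ a ∷ as → Step X W → ¬ (R without X) W
      lower′ X∈ W∈ s r with ∈ᶜ-there⁻ X∈ | ∈ᶜ-there⁻ W∈
      ... | _                | inj₁ (_ , refl) = empty W∈ (proj₁ r)
      ... | inj₁ (_ , refl) | inj₂ _ = empty X∈ (lower X∈ W∈ s (proj₁ r))
      ... | inj₂ X∈′ | inj₂ W∈′ = proj₂ (con′.lower X∈′ W∈′ s r) refl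
      convex′ : ∀ Z {i j l} → Z ∈ᶜ a ∷ as → i Fin.< j → j Fin.< l →
                (R without X) (removeAt Z i) → (R without X) (removeAt Z l) →
                (∃ λ Y → Z ≡ a ∷ Y) ⊎ Z ∈ᶜ as → removeAt Z j ≢ X
      convex′ Z {l = suc l} Z∈ i<j j<l p q (inj₁ (_ ∷ _ , refl)) =
          ⊥-elim (empty (∈ᶜ-removeAt Z∈ (suc l)) (proj₁ q))
      convex′ Z Z∈ i<j j<l p q (inj₂ Z∈′) = proj₂ (con′.convex Z Z∈′ i<j j<l p q)
      coconvex′ : ∀ Z {i j l} → Z ∈ᶜ a ∷ as → i Fin.< j → j Fin.< l →
                  ¬ (R without X) (removeAt Z i) → ¬ (R without X) (removeAt Z l) →
                  (∃ λ Y → Z ≡ a ∷ Y) ⊎ Z ∈ᶜ as → ¬ (R without X) (removeAt Z j)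
      coconvex′ Z {j = suc j} Z∈ i<j j<l p q (inj₁ (_ ∷ _ , refl)) r =
          empty (∈ᶜ-removeAt Z∈ (suc j)) (proj₁ r)
      coconvex′ Z Z∈ i<j j<l p q (inj₂ Z∈′) r = con′.coconvex Z Z∈′ i<j j<l p q r

  -- The tails of the elements of `R` through `a` have one entry less than these, so `R` itself can
  -- serve as the set along which they are sorted. No edge leads from the last such tail to an
  -- earlier one, which is what `without-consistent` requires. If there is no such tail, the search
  -- continues without `a`.
  removable : ∀ {k} as → AllPairs (Extremal (suc k)) as →
              ∀ {R : Pred (Vec A (suc k)) 0ℓ} → Consistent as R →
              (∀ {X} → X ∈ᶜ as → ¬ R X) ⊎ ∃ λ X → X ∈ᶜ as × R X × Consistent as (R without X)
  removable [] _ con = inj₁ λ { (_ , () ∷ _) }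
  removable {k} (a ∷ as) (a-ext ∷ ext) {R} con =
    case last-satisfying (λ Y → VAll.all? (a ≺?_) Y ×-dec dec (a ∷ Y)) ρ.sorted of λ where
      (inj₁ none)  → without-there (∷-empty none) (removable as ext (consistent-⊆ there con))
      (inj₂ found) → without-∷ found
    where
    open Consistent con
    module ρ = Sorted (consistent⇒sorted (suc k) (List.length as) as ℕ.≤-refl ext
        (consistent-⊆ there con))

    Removable = ∃ λ X → X ∈ᶜ a ∷ as × R X × Consistent (a ∷ as) (R without X)

    extremal : ∀ {x} → x ∈ as → Extremal (suc k) a x
    extremal = All.lookup a-ext

    without-∷ : (∃ λ Y → Y ∈ ρ.list × (VAll (a ≺_) Y × R (a ∷ Y)) ×
                 (∀ {V} → V ∈ ρ.list → VAll (a ≺_) V × R (a ∷ V) → V ≡ Y ⊎ V ≢ Y × ¬ Edge R Y V)) →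
                (∀ {X} → X ∈ᶜ a ∷ as → ¬ R X) ⊎ Removable
    without-∷ (Y , Y∈ , (a≺Y , r) , last) = inj₂
      ( a ∷ Y , (a≺Y ∷ proj₁ Y∈as , here refl ∷ proj₂ (∈ᶜ-there Y∈as)) , r
      , without-consistent extremal con maximal )
      where
      Y∈as = All.lookup ρ.sound Y∈
      maximal : ∀ {V} → a ∷ V ∈ᶜ a ∷ as → (R without (a ∷ Y)) (a ∷ V) → ¬ Edge R Y V
      maximal V∈@(a≺V ∷ _ , _) (rV , V≢Y) e
        with last (ρ.complete (∷-∈ᶜ⁻ extremal con V∈)) (a≺V , rV)
      ... | inj₁ refl     = V≢Y refl
      ... | inj₂ (_ , ¬e) = ¬e e

    ∷-empty : (∀ {Y} → Y ∈ ρ.list → ¬ (VAll (a ≺_) Y × R (a ∷ Y))) → ∀ {Y} → a ∷ Y ∈ᶜ a ∷ as →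
              ¬ R (a ∷ Y)
    ∷-empty none V∈@(a≺V ∷ _ , _) r = none (ρ.complete (∷-∈ᶜ⁻ extremal con V∈)) (a≺V , r)

    without-there : (∀ {Y} → a ∷ Y ∈ᶜ a ∷ as → ¬ R (a ∷ Y)) →
                    (∀ {X} → X ∈ᶜ as → ¬ R X) ⊎
                    (∃ λ X → X ∈ᶜ as × R X × Consistent as (R without X)) →
                    (∀ {X} → X ∈ᶜ a ∷ as → ¬ R X) ⊎ Removable
    without-there none (inj₂ (X , X∈ , r , con′)) =
      inj₂ (X , ∈ᶜ-there X∈ , r , without-there-consistent extremal con con′ none)
    without-there none (inj₁ empty) = inj₁ λ X∈ r → empty′ X∈ r (∈ᶜ-there⁻ extremal con X∈)
      where
      empty′ : ∀ {X} → X ∈ᶜ a ∷ as → R X → ¬ ((∃ λ Y → X ≡ a ∷ Y) ⊎ X ∈ᶜ as)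
      empty′ X∈ r (inj₁ (_ , refl)) = none X∈ r
      empty′ X∈ r (inj₂ X∈as)       = empty X∈as r

-- The order of the elements of a list

module _ {a} {A : Set a} where

  data Before (x y : A) : List A → Set a where
    here  : ∀ {xs} → y ∈ xs → Before x y (x ∷ xs)
    there : ∀ {z xs} → Before x y xs → Before x y (z ∷ xs)

  before-∈ˡ : ∀ {x y xs} → Before x y xs → x ∈ xs
  before-∈ˡ (here _)  = here refl
  before-∈ˡ (there b) = there (before-∈ˡ b)

  before-∈ʳ : ∀ {x y xs} → Before x y xs → y ∈ xs
  before-∈ʳ (here y∈) = there y∈
  before-∈ʳ (there b) = there (before-∈ʳ b)

  before-++⁺ˡ : ∀ {x y xs ys} → Before x y xs → Before x y (xs ++ ys)
  before-++⁺ˡ (here y∈) = here (∈-++⁺ˡ y∈)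
  before-++⁺ˡ (there b) = there (before-++⁺ˡ b)

  before-++⁺ʳ : ∀ {x y} xs {ys} → Before x y ys → Before x y (xs ++ ys)
  before-++⁺ʳ []       b = b
  before-++⁺ʳ (x ∷ xs) b = there (before-++⁺ʳ xs b)

  before-++⁺ : ∀ {x y xs ys} → x ∈ xs → y ∈ ys → Before x y (xs ++ ys)
  before-++⁺ {xs = _ ∷ xs} (here refl) y∈ = here (∈-++⁺ʳ xs y∈)
  before-++⁺ (there x∈)  y∈ = there (before-++⁺ x∈ y∈)

  before-++⁻ : ∀ {x y} xs {ys} → Before x y (xs ++ ys) →
               Before x y xs ⊎ (x ∈ xs × y ∈ ys) ⊎ Before x y ys
  before-++⁻ []       b         = inj₂ (inj₂ b)
  before-++⁻ (x ∷ xs) (here y∈) =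
    [ inj₁ ∘ here , (λ y∈ys → inj₂ (inj₁ (here refl , y∈ys))) ]′ (∈-++⁻ xs y∈)
  before-++⁻ (x ∷ xs) (there b) with before-++⁻ xs b
  ... | inj₁ b′               = inj₁ (there b′)
  ... | inj₂ (inj₁ (x∈ , y∈)) = inj₂ (inj₁ (there x∈ , y∈))
  ... | inj₂ (inj₂ b′)        = inj₂ (inj₂ b′)

  before-reverse : ∀ {x y} xs → Before x y xs → Before y x (reverse xs)
  before-reverse (x ∷ xs) b rewrite List.unfold-reverse x xs with b
  ... | here y∈  = before-++⁺ (Any.reverse⁺ y∈) (here refl)
  ... | there b′ = before-++⁺ˡ (before-reverse xs b′)

  before-reverse⁻ : ∀ {x y} xs → Before x y (reverse xs) → Before y x xs
  before-reverse⁻ xs b = subst (Before _ _) (List.reverse-involutive xs)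
      (before-reverse (reverse xs) b)

  before-total : ∀ {x y xs} → x ∈ xs → y ∈ xs → x ≢ y → Before x y xs ⊎ Before y x xs
  before-total (here refl) (here refl) x≢y = contradiction refl x≢y
  before-total (here refl) (there y∈)  x≢y = inj₁ (here y∈)
  before-total (there x∈)  (here refl) x≢y = inj₂ (here x∈)
  before-total (there x∈)  (there y∈)  x≢y = Sum.map there there (before-total x∈ y∈ x≢y)

  allPairs⇒before : ∀ {r} {R : Rel A r} {x y xs} → AllPairs R xs → Before x y xs → R x y
  allPairs⇒before (Rx ∷ _) (here y∈) = All.lookup Rx y∈
  allPairs⇒before (_ ∷ Rs) (there b) = allPairs⇒before Rs b

  before-irrefl : ∀ {x xs} → Unique xs → ¬ Before x x xs
  before-irrefl u b = allPairs⇒before u b refl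

  before-asym : ∀ {x y xs} → Unique xs → Before x y xs → ¬ Before y x xs
  before-asym (x∉ ∷ _) (here y∈) (here _)  = All.lookup x∉ y∈ refl
  before-asym (x∉ ∷ _) (here y∈) (there b) = All.lookup x∉ (before-∈ʳ b) refl
  before-asym (y∉ ∷ _) (there b) (here x∈) = All.lookup y∉ (before-∈ʳ b) refl
  before-asym (_ ∷ u)  (there b) (there c) = before-asym u b c

  before-trans : ∀ {x y z xs} → Unique xs → Before x y xs → Before y z xs → Before x z xs
  before-trans (_ ∷ _)  (here y∈) (here z∈) = here z∈
  before-trans (_ ∷ _)  (here y∈) (there c) = here (before-∈ʳ c)
  before-trans (y∉ ∷ _) (there b) (here z∈) = contradiction refl (All.lookup y∉ (before-∈ʳ b))
  before-trans (_ ∷ u)  (there b) (there c) = there (before-trans u b c)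

  before-lookup⁺ : ∀ xs {i j} → i Fin.< j → Before (List.lookup xs i) (List.lookup xs j) xs
  before-lookup⁺ (x ∷ xs) {zero}  {suc j} _         = here (∈-lookup j)
  before-lookup⁺ (x ∷ xs) {suc i} {suc j} (s<s i<j) = there (before-lookup⁺ xs i<j)

  before-lookup⁻ : ∀ {x y xs} → Before x y xs →
                   ∃₂ λ i j → i Fin.< j × x ≡ List.lookup xs i × y ≡ List.lookup xs j
  before-lookup⁻ {xs = _ ∷ xs} (here y∈) = zero , suc (index y∈) , s≤s z≤n , refl ,
      Any.lookup-index y∈
    where open import Data.List.Relation.Unary.Any using (index)
  before-lookup⁻ (there b) =
    let i , j , i<j , p , q = before-lookup⁻ b in suc i , suc j , s<s i<j , p , q

  before-tabulate⁺ : ∀ {n} (f : Fin n → A) {i j} → i Fin.< j → Before (f i) (f j) (List.tabulate f)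
  before-tabulate⁺ f {zero}  {suc j} _         = here (∈-tabulate⁺ {f = f ∘ suc} j)
  before-tabulate⁺ f {suc i} {suc j} (s<s i<j) = there (before-tabulate⁺ (f ∘ suc) i<j)

  before-tabulate⁻ : ∀ {n} (f : Fin n → A) {x y} → Before x y (List.tabulate f) →
                     ∃₂ λ i j → i Fin.< j × x ≡ f i × y ≡ f j
  before-tabulate⁻ {suc n} f (here y∈) =
    let j , eq = ∈-tabulate⁻ y∈ in zero , suc j , s≤s z≤n , refl , eq
  before-tabulate⁻ {suc n} f (there b) =
    let i , j , i<j , p , q = before-tabulate⁻ (f ∘ suc) b in suc i , suc j , s<s i<j , p , q

  before? : DecidableEquality A → ∀ x y xs → Dec (Before x y xs)
  before? _≟_ x y [] = no λ ()
  before? _≟_ x y (z ∷ xs) =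
    map′ (λ { (inj₁ (refl , y∈)) → here y∈ ; (inj₂ b) → there b })
         (λ { (here y∈) → inj₁ (refl , y∈) ; (there b) → inj₂ b })
         (((x ≟ z) ×-dec (y ∈? xs)) ⊎-dec before? _≟_ x y xs)
    where open DecMembership _≟_ using (_∈?_)

  module _ {p} {P : Pred A p} (P? : Decidable P) where

    before-filter⁺ : ∀ {x y xs} → P x → P y → Before x y xs → Before x y (filter P? xs)
    before-filter⁺ {x} px py (here y∈) with P? x
    ... | yes _  = here (∈-filter⁺ P? y∈ py)
    ... | no ¬px = contradiction px ¬px
    before-filter⁺ px py (there {z} b) with P? z
    ... | yes _ = there (before-filter⁺ px py b)
    ... | no _  = before-filter⁺ px py b

    before-filter⁻ : ∀ {x y} xs → Before x y (filter P? xs) → Before x y xs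
    before-filter⁻ (z ∷ xs) b with P? z
    before-filter⁻ (z ∷ xs) (here y∈) | yes _ = here (proj₁ (∈-filter⁻ P? y∈))
    before-filter⁻ (z ∷ xs) (there b) | yes _ = there (before-filter⁻ xs b)
    before-filter⁻ (z ∷ xs) b         | no _  = there (before-filter⁻ xs b)

  before-delete : ∀ {x y z} xs {ys} → Before x y (xs ++ ys) → Before x y (xs ++ z ∷ ys)
  before-delete xs b with before-++⁻ xs b
  ... | inj₁ b′               = before-++⁺ˡ b′
  ... | inj₂ (inj₁ (x∈ , y∈)) = before-++⁺ x∈ (there y∈)
  ... | inj₂ (inj₂ b′)        = before-++⁺ʳ xs (there b′)

  unique-delete : ∀ xs {y : A} {ys} → Unique (xs ++ y ∷ ys) → Unique (xs ++ ys) × y ∉ xs ++ ys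
  unique-delete [] (y∉ ∷ u) = u , λ y∈ → All.lookup y∉ y∈ refl
  unique-delete (x ∷ xs) {y} {ys} (x∉ ∷ u) =
    let u′ , y∉ = unique-delete xs u in
    All.tabulate (λ z∈ → All.lookup x∉ ([ ∈-++⁺ˡ , ∈-++⁺ʳ xs ∘ there ]′ (∈-++⁻ xs z∈))) ∷ u′ ,
    λ { (here refl) → All.lookup x∉ (∈-insert xs) refl ; (there y∈) → y∉ y∈ }

  data Swap {c} (C : Rel A c) : Rel (List A) (a ⊔ c) where
    here  : ∀ {x y xs} → C x y → Swap C (x ∷ y ∷ xs) (y ∷ x ∷ xs)
    there : ∀ {x xs ys} → Swap C xs ys → Swap C (x ∷ xs) (x ∷ ys)

  bubble : ∀ {c} {C : Rel A c} {xs y ys} → All (λ x → C x y) xs →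
           Star (Swap C) (xs ++ y ∷ ys) (y ∷ xs ++ ys)
  bubble []       = ε
  bubble (c ∷ cs) = Star.gmap _ there (bubble cs) ◅◅ (here c ◅ ε)

  -- The first element of `ys` is moved to the front of `xs`. It passes only elements that precede
  -- it in `xs` and follow it in `ys`, and deleting it creates no new inverted pair.
  sort : ∀ {c} {C : Rel A c} ys {xs} → Unique xs → Unique ys →
         (∀ {x} → x ∈ xs → x ∈ ys) → (∀ {x} → x ∈ ys → x ∈ xs) →
         (∀ {x y} → Before x y xs → Before y x ys → C x y) → Star (Swap C) xs ys
  sort [] {[]} _ _ _ _ _ = ε
  sort [] {x ∷ xs} _ _ xs⊆ _ _ with () ← xs⊆ (here refl)
  sort {C = C} (y ∷ ys) {xs} xs! (y∉ ∷ ys!) xs⊆ ys⊆ inv with ∈-∃++ (ys⊆ (here refl))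
  ... | as , bs , refl =
    bubble (All.tabulate λ {x} x∈ → inv (before-++⁺ x∈ (here refl))
             (here (tail-∈ (λ { refl → y∉′ (∈-++⁺ˡ x∈) }) (xs⊆ (∈-++⁺ˡ x∈)))))
    ◅◅ Star.gmap (y ∷_) there
         (sort ys as++bs! ys!
           (λ x∈ → tail-∈ (λ { refl → y∉′ x∈ })
               (xs⊆ ([ ∈-++⁺ˡ , ∈-++⁺ʳ as ∘ there ]′ (∈-++⁻ as x∈))))
           (λ x∈ → case ∈-++⁻ as (ys⊆ (there x∈)) of λ where
             (inj₁ x∈as)         → ∈-++⁺ˡ x∈as
             (inj₂ (here refl))  → contradiction refl (All.lookup y∉ x∈)
             (inj₂ (there x∈bs)) → ∈-++⁺ʳ as x∈bs)
           (λ b c → inv (before-delete as b) (there c)))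
    where
    as++bs! = proj₁ (unique-delete as xs!)
    y∉′ = proj₂ (unique-delete as xs!)
    tail-∈ : ∀ {x} → x ≢ y → x ∈ y ∷ ys → x ∈ ys
    tail-∈ x≢y (here refl) = contradiction refl x≢y
    tail-∈ x≢y (there x∈)  = x∈

  -- Without inverted pairs, `sort` succeeds even when no swap is permitted, and then it changes
  -- nothing.
  before⇒≡ : ∀ {xs ys : List A} → Unique xs → Unique ys →
             (∀ {x} → x ∈ xs → x ∈ ys) → (∀ {x} → x ∈ ys → x ∈ xs) →
             (∀ {x y} → Before x y xs → Before x y ys) → xs ≡ ys
  before⇒≡ {ys = ys} xs! ys! xs⊆ ys⊆ mono = no-swaps (sort {C = λ _ _ → ⊥} ys xs! ys! xs⊆ ys⊆
                                          (λ b c → before-asym ys! (mono b) c))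
    where
    no-swap : ∀ {xs ys} → ¬ Swap (λ _ _ → ⊥) xs ys
    no-swap (here ())
    no-swap (there s) = no-swap s
    no-swaps : ∀ {xs ys} → Star (Swap λ _ _ → ⊥) xs ys → xs ≡ ys
    no-swaps ε       = refl
    no-swaps (s ◅ _) = ⊥-elim (no-swap s)

-- Thresholds, reversed blocks and shared faces

upward-threshold : ∀ {p m} {P : Pred (Fin m) p} → Decidable P → (∀ {i j} → i Fin.< j → P i → P j) →
                   ∃ λ t → ∀ j → P j ⇔ t ℕ.≤ toℕ j
upward-threshold {m = zero} P? up = 0 , λ ()
upward-threshold {m = suc m} P? up with P? zero
... | yes p₀ = 0 , λ where
        zero    → mk⇔ (λ _ → z≤n) (λ _ → p₀)
        (suc j) → mk⇔ (λ _ → z≤n) (λ _ → up (s≤s z≤n) p₀)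
... | no ¬p₀ = let t , iff = upward-threshold (P? ∘ suc) (up ∘ s<s) in suc t , λ where
        zero    → mk⇔ (λ p₀ → contradiction p₀ ¬p₀) (λ ())
        (suc j) → mk⇔ (s≤s ∘ Equivalence.to (iff j))
            (λ { (s≤s t≤j) → Equivalence.from (iff j) t≤j })

downward-threshold : ∀ {p m} {P : Pred (Fin m) p} → Decidable P →
                     (∀ {i j} → i Fin.< j → P j → P i) →
                     ∃ λ t → ∀ j → P j ⇔ toℕ j ℕ.< t
downward-threshold {P = P} P? down =
  let t , iff = upward-threshold (¬? ∘ P?) (λ i<j ¬p p → ¬p (down i<j p)) in
  t , λ j → mk⇔ (λ p → ℕ.≰⇒> (λ t≤j → Equivalence.from (iff j) t≤j p))
                (λ j<t → decidable-stable (P? j) (λ ¬p → ℕ.<⇒≱ j<t (Equivalence.to (iff j) ¬p)))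

≤-fromℕ : ∀ {m} (j : Fin (suc m)) → j ≡ Fin.fromℕ m ⊎ j Fin.< Fin.fromℕ m
≤-fromℕ {m} j with j Fin.≟ Fin.fromℕ m
... | yes eq = inj₁ eq
... | no ≢   = inj₂ (Fin.≤∧≢⇒< (Fin.≤fromℕ j) ≢)

module _ {a} {A : Set a} where

  unique-before : {xs : List A} → (∀ {x} → ¬ Before x x xs) → Unique xs
  unique-before {[]}     irr = []
  unique-before {x ∷ xs} irr = All.tabulate (λ { y∈ refl → irr (here y∈) }) ∷ unique-before
      (irr ∘ there)

  ∈-block : ∀ {x : A} xs B {ys} → x ∈ xs ++ B ++ ys → x ∈ xs ++ reverse B ++ ys
  ∈-block xs B {ys} x∈ with ∈-++⁻ xs x∈
  ... | inj₁ x∈xs = ∈-++⁺ˡ x∈xs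
  ... | inj₂ x∈′ with ∈-++⁻ B x∈′
  ...   | inj₁ x∈B  = ∈-++⁺ʳ xs (∈-++⁺ˡ (Any.reverse⁺ x∈B))
  ...   | inj₂ x∈ys = ∈-++⁺ʳ xs (∈-++⁺ʳ (reverse B) x∈ys)

  before-block : ∀ {x y : A} xs B {ys} → Before x y (xs ++ B ++ ys) →
                 Before x y (xs ++ reverse B ++ ys) ⊎ Before x y B
  before-block xs B {ys} b with before-++⁻ xs b
  ... | inj₁ b′ = inj₁ (before-++⁺ˡ b′)
  ... | inj₂ (inj₁ (x∈ , y∈)) = inj₁ (before-++⁺ x∈ (∈-block [] B y∈))
  ... | inj₂ (inj₂ b′) with before-++⁻ B b′
  ...   | inj₁ b″               = inj₂ b″
  ...   | inj₂ (inj₁ (x∈ , y∈)) = inj₁ (before-++⁺ʳ xs (before-++⁺ (Any.reverse⁺ x∈) y∈))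
  ...   | inj₂ (inj₂ b″)        = inj₁ (before-++⁺ʳ xs (before-++⁺ʳ (reverse B) b″))

module _ {a} {A : Set a} where

  removeAt-∷-cong : ∀ {m} z (X Y : Vec A (suc m)) {c d} → removeAt X c ≡ removeAt Y d →
                    removeAt (z ∷ X) (suc c) ≡ removeAt (z ∷ Y) (suc d)
  removeAt-∷-cong z (_ ∷ _) (_ ∷ _) = cong (z ∷_)

  -- Removing position `i` and then position `j - 1` leaves the same entries as removing `j` and
  -- then `i`.
  common-subface : ∀ {m} (Z : Vec A (suc (suc m))) {i j} → i Fin.< j →
                   ∃₂ λ c d → removeAt (removeAt Z i) c ≡ removeAt (removeAt Z j) d
  common-subface (_ ∷ _ ∷ _)         {zero}     {suc j}    _         = j , zero , refl
  common-subface (_ ∷ _ ∷ [])        {suc zero} {suc zero} (s<s ())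
  common-subface (z ∷ Z@(_ ∷ _ ∷ _)) {suc i}    {suc j}    (s<s i<j) =
    let c , d , eq = common-subface Z i<j in
    suc c , suc d , removeAt-∷-cong z (removeAt Z i) (removeAt Z j) eq

  -- Write ij for the face shared by the faces `i` and `j`, and so on. If the outer packets are
  -- antilex, ij precedes il and il precedes jl, so the middle packet cannot be lex; if they are
  -- lex, the chain is reversed. This is the source of both convexity conditions for reversal sets.
  common-subfaces : ∀ {m} (Z : Vec A (suc (suc (suc m)))) {i j l} → i Fin.< j → j Fin.< l →
    ∃₂ λ a b → ∃₂ λ c d → ∃₂ λ e f → a Fin.< b × c Fin.< d × e Fin.< f ×
      removeAt (removeAt Z i) a ≡ removeAt (removeAt Z j) c ×
      removeAt (removeAt Z i) b ≡ removeAt (removeAt Z l) e ×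
      removeAt (removeAt Z j) d ≡ removeAt (removeAt Z l) f
  common-subfaces (z ∷ Z@(_ ∷ _ ∷ _)) {zero} {suc j} {suc l} _ (s<s j<l) =
    let d , f , eq = common-subface Z j<l in
    j , l , zero , suc d , zero , suc f , j<l , s≤s z≤n , s≤s z≤n , refl , refl ,
    removeAt-∷-cong z (removeAt Z j) (removeAt Z l) eq
  common-subfaces (z ∷ _ ∷ _ ∷ []) {suc zero} {suc (suc zero)} {suc (suc zero)} (s<s i<j)
      (s<s (s<s ()))
  common-subfaces (z ∷ Z@(_ ∷ _ ∷ _ ∷ _)) {suc i} {suc j} {suc l} (s<s i<j) (s<s j<l) =
    let a , b , c , d , e , f , a<b , c<d , e<f , p , q , r = common-subfaces Z i<j j<l in
    suc a , suc b , suc c , suc d , suc e , suc f , s<s a<b , s<s c<d , s<s e<f ,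
    removeAt-∷-cong z (removeAt Z i) (removeAt Z j) p , removeAt-∷-cong z (removeAt Z i)
        (removeAt Z l) q ,
    removeAt-∷-cong z (removeAt Z j) (removeAt Z l) r

-- Counting the elements of a decidable set

module _ {a} {A : Set a} where

  count : ∀ {p} {P : Pred A p} → Decidable P → List A → ℕ
  count P? xs = List.length (filter P? xs)

  count-⊆ : ∀ {p q} {P : Pred A p} {Q : Pred A q} (P? : Decidable P) (Q? : Decidable Q) →
            ∀ xs → (∀ {x} → x ∈ xs → P x → Q x) → count P? xs ℕ.≤ count Q? xs
  count-⊆ P? Q? [] P⊆Q = z≤n
  count-⊆ P? Q? (x ∷ xs) P⊆Q with P? x | Q? x
  ... | yes p | yes q = s≤s (count-⊆ P? Q? xs (P⊆Q ∘ there))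
  ... | yes p | no ¬q = contradiction (P⊆Q (here refl) p) ¬q
  ... | no ¬p | yes q = ℕ.m≤n⇒m≤1+n (count-⊆ P? Q? xs (P⊆Q ∘ there))
  ... | no ¬p | no ¬q = count-⊆ P? Q? xs (P⊆Q ∘ there)

  count-insert : ∀ {p q} {P : Pred A p} {Q : Pred A q} (P? : Decidable P) (Q? : Decidable Q) →
                 ∀ {xs y} → Unique xs → y ∈ xs → ¬ P y → Q y → (∀ {x} → P x → Q x) →
                 (∀ {x} → x ≢ y → Q x → P x) → count Q? xs ≡ suc (count P? xs)
  count-insert P? Q? {y ∷ xs} (y∉ ∷ xs!) (here refl) ¬py qy P⊆Q Q⊆P with P? y | Q? y
  ... | yes py | _     = contradiction py ¬py
  ... | no _   | no ¬q = contradiction qy ¬q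
  ... | no _   | yes _ = cong suc (ℕ.≤-antisym
          (count-⊆ Q? P? xs (λ x∈ → Q⊆P (λ { refl → All.lookup y∉ x∈ refl })))
          (count-⊆ P? Q? xs (λ _ → P⊆Q)))
  count-insert P? Q? {x ∷ xs} (x∉ ∷ xs!) (there y∈) ¬py qy P⊆Q Q⊆P
    with P? x | Q? x | count-insert P? Q? xs! y∈ ¬py qy P⊆Q Q⊆P
  ... | yes p | yes q | eq = cong suc eq
  ... | yes p | no ¬q | _  = contradiction (P⊆Q p) ¬q
  ... | no ¬p | yes q | _  = contradiction (Q⊆P (λ { refl → All.lookup x∉ y∈ refl }) q) ¬p
  ... | no ¬p | no ¬q | eq = eq

-- Transfer of extremal elements, covers and ranks along an order isomorphism

module OrderIsomorphism {a b ℓ₁ ℓ₂ ℓ₃ ℓ₄} {A : Set a} {B : Set b} {_≈ᵃ_ : Rel A ℓ₁} {_≤ᵃ_ : Rel A ℓ₂}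
                        {_≈ᵇ_ : Rel B ℓ₃} {_≤ᵇ_ : Rel B ℓ₄}
                        (A-poset : IsPartialOrder _≈ᵃ_ _≤ᵃ_) (B-poset : IsPartialOrder _≈ᵇ_ _≤ᵇ_)
                        (f : A → B) (iso : IsOrderIsomorphism _≈ᵃ_ _≈ᵇ_ _≤ᵃ_ _≤ᵇ_ f) where
  private
    module A = IsPartialOrder A-poset
    module B = IsPartialOrder B-poset
    open IsOrderIsomorphism iso renaming (cong to f-cong)

    preimage : ∀ y → ∃ λ x → f x ≈ᵇ y
    preimage y = let x , eq = surjective y in x , eq A.Eq.refl

  minimal⁺ : ∀ {x} → Minimal _≈ᵃ_ _≤ᵃ_ x → Minimal _≈ᵇ_ _≤ᵇ_ (f x)
  minimal⁺ min y y≤ with preimage y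
  ... | x , fx≈y = B.Eq.trans (B.Eq.sym fx≈y)
          (f-cong (min x (cancel (B.trans (B.reflexive fx≈y) y≤))))

  minimal⁻ : ∀ {x} → Minimal _≈ᵇ_ _≤ᵇ_ (f x) → Minimal _≈ᵃ_ _≤ᵃ_ x
  minimal⁻ min y y≤ = injective (min (f y) (mono y≤))

  maximal⁺ : ∀ {x} → Maximal _≈ᵃ_ _≤ᵃ_ x → Maximal _≈ᵇ_ _≤ᵇ_ (f x)
  maximal⁺ max y ≤y with preimage y
  ... | x , fx≈y = B.Eq.trans (f-cong
          (max x (cancel (B.trans ≤y (B.reflexive (B.Eq.sym fx≈y)))))) fx≈y

  maximal⁻ : ∀ {x} → Maximal _≈ᵇ_ _≤ᵇ_ (f x) → Maximal _≈ᵃ_ _≤ᵃ_ x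
  maximal⁻ max y ≤y = injective (max (f y) (mono ≤y))

  uniqueMinimal⁻ : ∀ {x y} → f x ≈ᵇ y → IsUniqueMinimal _≈ᵇ_ _≤ᵇ_ y → IsUniqueMinimal _≈ᵃ_ _≤ᵃ_ x
  uniqueMinimal⁻ fx≈y (min , uniq) =
    minimal⁻ (λ z z≤ → B.Eq.trans (min z (B.trans z≤ (B.reflexive fx≈y))) (B.Eq.sym fx≈y)) ,
    λ z z-min → injective (B.Eq.trans (uniq (f z) (minimal⁺ z-min)) (B.Eq.sym fx≈y))

  uniqueMaximal⁻ : ∀ {x y} → f x ≈ᵇ y → IsUniqueMaximal _≈ᵇ_ _≤ᵇ_ y → IsUniqueMaximal _≈ᵃ_ _≤ᵃ_ x
  uniqueMaximal⁻ fx≈y (max , uniq) =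
    maximal⁻ (λ z ≤z → B.Eq.trans fx≈y (max z (B.trans (B.reflexive (B.Eq.sym fx≈y)) ≤z))) ,
    λ z z-max → injective (B.Eq.trans (uniq (f z) (maximal⁺ z-max)) (B.Eq.sym fx≈y))

  covers⁺ : ∀ {x y} → Covers _≈ᵃ_ _≤ᵃ_ y x → Covers _≈ᵇ_ _≤ᵇ_ (f y) (f x)
  covers⁺ ((x≤y , x≉y) , nothing-between) = (mono x≤y , x≉y ∘ injective) ,
    λ (z , (x≤z , x≉z) , (z≤y , z≉y)) → case preimage z of λ (z′ , fz≈z) → nothing-between
      ( z′ , (cancel (B.trans x≤z (B.reflexive (B.Eq.sym fz≈z))) , λ x≈z →
          x≉z (B.Eq.trans (f-cong x≈z) fz≈z))
      , (cancel (B.trans (B.reflexive fz≈z) z≤y) , λ z≈y →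
          z≉y (B.Eq.trans (B.Eq.sym fz≈z) (f-cong z≈y))) )

  isRanked⁻ : IsRanked _≈ᵇ_ _≤ᵇ_ → IsRanked _≈ᵃ_ _≤ᵃ_
  isRanked⁻ ranked = record
    { rank = rank ∘ f
    ; rank-cong = λ x≈y → rank-cong (f-cong x≈y)
    ; rank-minimal = λ min → rank-minimal (minimal⁺ min)
    ; rank-mono = λ (x≤y , x≉y) → rank-mono (mono x≤y , x≉y ∘ injective)
    ; rank-cover = λ cov → rank-cover (covers⁺ cov) }
    where open IsRanked ranked

-- Pairwise relations in vectors, and the two orders of a permutation

module _ {a r} {A : Set a} {R : Rel A r} where

  allPairs-lookup⁺ : ∀ {k} {X : Vec A k} → VAllPairs R X → ∀ {i j} → i Fin.< j →
                     R (lookup X i) (lookup X j)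
  allPairs-lookup⁺ (rx ∷ rX) {zero}  {suc j} _         = VAll.lookup⁺ rx j
  allPairs-lookup⁺ (rx ∷ rX) {suc i} {suc j} (s<s i<j) = allPairs-lookup⁺ rX i<j

  allPairs-lookup⁻ : ∀ {k} {X : Vec A k} → (∀ {i j} → i Fin.< j → R (lookup X i) (lookup X j)) →
                     VAllPairs R X
  allPairs-lookup⁻ {X = []}    r = []
  allPairs-lookup⁻ {X = x ∷ X} r =
      VAll.lookup⁻ (λ j → r {zero} {suc j} (s≤s z≤n)) ∷ allPairs-lookup⁻ (r ∘ s<s)

  allPairs-removeAt-lookup : ∀ {k} {X : Vec A (suc k)} {c} → VAllPairs R (removeAt X c) →
                             ∀ {a b} → a ≢ c → b ≢ c → a Fin.< b → R (lookup X a) (lookup X b)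
  allPairs-removeAt-lookup {X = _ ∷ _} {zero} rX {zero} a≢ b≢ a<b = contradiction refl a≢
  allPairs-removeAt-lookup {X = _ ∷ _} {zero} rX {suc a} {suc b} a≢ b≢ (s<s a<b) =
      allPairs-lookup⁺ rX a<b
  allPairs-removeAt-lookup {X = _ ∷ X@(_ ∷ _)} {suc c} (rx ∷ rX) {zero} {suc b} a≢ b≢ a<b =
    lookup-removeAt X rx (b≢ ∘ cong suc)
    where
    lookup-removeAt : ∀ {p k} {P : Pred A p} (X : Vec A (suc k)) {c b} →
                      VAll P (removeAt X c) → b ≢ c → P (lookup X b)
    lookup-removeAt (x ∷ X) {zero} {zero} pX b≢ = contradiction refl b≢
    lookup-removeAt (x ∷ X) {zero} {suc b} pX b≢ = VAll.lookup⁺ pX b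
    lookup-removeAt (x ∷ X@(_ ∷ _)) {suc c} {zero} (px ∷ pX) b≢ = px
    lookup-removeAt (x ∷ X@(_ ∷ _)) {suc c} {suc b} (px ∷ pX) b≢ =
        lookup-removeAt X pX (b≢ ∘ cong suc)
  allPairs-removeAt-lookup {X = _ ∷ X@(_ ∷ _)} {suc c} (rx ∷ rX) {suc a} {suc b} a≢ b≢ (s<s a<b) =
    allPairs-removeAt-lookup {X = X} rX (a≢ ∘ cong suc) (b≢ ∘ cong suc) a<b

orders : ∀ {n} → Permutation′ n → TwoOrders (Fin n)
orders w = record
  { _≺_ = λ x y → x Fin.< y × (w ⟨$⟩ˡ y) Fin.< (w ⟨$⟩ˡ x)
  ; _◁_ = λ x y → x Fin.< y × (w ⟨$⟩ˡ x) Fin.< (w ⟨$⟩ˡ y)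
  ; ≺-trans = λ (p , q) (r , s) → Fin.<-trans p r , Fin.<-trans s q
  ; ≺-irrefl = λ (p , _) → Fin.<-irrefl refl p
  ; ◁-trans = λ (p , q) (r , s) → Fin.<-trans p r , Fin.<-trans q s
  ; ◁-irrefl = λ (p , _) → Fin.<-irrefl refl p
  ; ≺⇒⋪ = λ (_ , q) (_ , s) → Fin.<-asym q s
  ; ≺⇒⋫ = λ (p , _) (r , _) → Fin.<-asym p r
  ; _≺?_ = λ x y → (x Fin.<? y) ×-dec ((w ⟨$⟩ˡ y) Fin.<? (w ⟨$⟩ˡ x))
  ; _≟_ = Fin._≟_ }

module HigherBruhat {n : ℕ} (w : Permutation′ n) where
  open Chains (orders w) public

  -- Inversions and the permanent order

  ⟨$⟩ˡ-injective : ∀ {x y} → w ⟨$⟩ˡ x ≡ w ⟨$⟩ˡ y → x ≡ y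
  ⟨$⟩ˡ-injective eq = trans (sym (inverseʳ w)) (trans (cong (w ⟨$⟩ʳ_) eq) (inverseʳ w))

  <⇒≺⊎◁ : ∀ {x y} → x Fin.< y → x ≺ y ⊎ x ◁ y
  <⇒≺⊎◁ {x} {y} x<y with Fin.<-cmp (w ⟨$⟩ˡ x) (w ⟨$⟩ˡ y)
  ... | tri< p _ _ = inj₂ (x<y , p)
  ... | tri≈ _ p _ = contradiction (⟨$⟩ˡ-injective p) (Fin.<⇒≢ x<y)
  ... | tri> _ _ p = inj₁ (x<y , p)

  inv⇒chain : ∀ {k} {X : Vec (Fin n) k} → Inv w X → Chain X
  inv⇒chain (inc , dec) = allPairs-lookup⁻ λ i<j → inc i<j , dec i<j

  chain⇒inv : ∀ {k} {X : Vec (Fin n) k} → Chain X → Inv w X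
  chain⇒inv cX = (λ i<j → proj₁ (allPairs-lookup⁺ cX i<j)) ,
      (λ i<j → proj₂ (allPairs-lookup⁺ cX i<j))

  chain? : ∀ {k} → Decidable (Chain {k})
  chain? = VAllPairs.allPairs? _≺?_

  Ascending : ∀ {k} → Pred (Vec (Fin n) k) 0ℓ
  Ascending = VAllPairs Fin._<_

  chain⇒ascending : ∀ {k} {X : Vec (Fin n) k} → Chain X → Ascending X
  chain⇒ascending = VAllPairs.map proj₁

  side-even : ∀ t → 2 ∣ t → ∀ {x y} → x ◁ y → Side t x y
  side-even zero          _ r = r
  side-even (suc zero)    e r = case ∣1⇒≡1 e of λ ()
  side-even (suc (suc t)) e r = side-even t (∣m+n∣m⇒∣n e ∣-refl) r

  side-odd : ∀ t → ¬ 2 ∣ t → ∀ {x y} → x ◁ y → Side t y x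
  side-odd zero          o r = contradiction (2 ∣0) o
  side-odd (suc zero)    o r = r
  side-odd (suc (suc t)) o r = side-odd t (o ∘ ∣m∣n⇒∣m+n ∣-refl) r

  side-parity : ∀ t {x y} → Side t x y → (2 ∣ t × x ◁ y) ⊎ (¬ 2 ∣ t × y ◁ x)
  side-parity zero          r = inj₁ (2 ∣0 , r)
  side-parity (suc zero)    r = inj₂ ((λ e → case ∣1⇒≡1 e of λ ()) , r)
  side-parity (suc (suc t)) r with side-parity t r
  ... | inj₁ (e , q) = inj₁ (∣m∣n⇒∣m+n ∣-refl e , q)
  ... | inj₂ (o , q) = inj₂ ((λ e → o (∣m+n∣m⇒∣n e ∣-refl)) , q)

  -- If Z is ascending and both removeAt Z (inject₁ c) and removeAt Z (suc c) are chains, then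
  -- Adjacent Z c says that Z is a quasi-inversion with the non-inverted pair at c and c + 1.

  data Adjacent : ∀ {k} → Vec (Fin n) (suc k) → Fin k → Set where
    here  : ∀ {k x y} {Z : Vec (Fin n) k} → x ◁ y → Adjacent (x ∷ y ∷ Z) zero
    there : ∀ {k x} {Z : Vec (Fin n) (suc k)} {i} → Adjacent Z i → Adjacent (x ∷ Z) (suc i)

  -- Every pair of positions except `i` and `j` survives in one of the two faces, so only this pair
  -- can fail to be inverted. If another position lies between them, the pair is inverted by
  -- transitivity.
  chain-or-adjacent : ∀ {k} (Z : Vec (Fin n) (suc k)) {i j} → Ascending Z → i Fin.< j →
                      Chain (removeAt Z i) → Chain (removeAt Z j) →
                      Chain Z ⊎ ∃ λ c → i ≡ inject₁ c × j ≡ suc c × Adjacent Z c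
  chain-or-adjacent (x ∷ y ∷ Z) {zero} {suc zero} ((x<y ∷ _) ∷ _) i<j cI (x≺Z ∷ _) with <⇒≺⊎◁ x<y
  ... | inj₁ x≺y = inj₁ ((x≺y ∷ x≺Z) ∷ cI)
  ... | inj₂ x◁y = inj₂ (zero , refl , refl , here x◁y)
  chain-or-adjacent (x ∷ y ∷ z ∷ Z) {zero} {suc (suc j)} _ i<j cI ((x≺y ∷ _) ∷ _) =
    inj₁ (chain-∷ x≺y cI)
  chain-or-adjacent (x ∷ Z@(_ ∷ _)) {suc i} {suc j} (_ ∷ incZ) (s<s i<j) (p ∷ cI) (q ∷ cJ)
    with chain-or-adjacent Z incZ i<j cI cJ
  ... | inj₁ cZ = inj₁ (all-removeAt⁻ Z (Fin.<⇒≢ i<j) p q ∷ cZ)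
  ... | inj₂ (c , refl , refl , adj) = inj₂ (suc c , refl , refl , there adj)

  adjacent-◁ : ∀ {k} {Z : Vec (Fin n) (suc k)} {c} → Adjacent Z c → lookup Z (inject₁ c) ◁ lookup Z
               (suc c)
  adjacent-◁ (here r)    = r
  adjacent-◁ (there adj) = adjacent-◁ adj

  -- The number `k ∸ suc (toℕ c)` counts the entries behind the pair at `c` and `c + 1`, hence the
  -- coordinates behind the one that moves.
  adjacent-step-even : ∀ {k} {Z : Vec (Fin n) (suc k)} {c} → Adjacent Z c → 2 ∣ k ∸ suc (toℕ c) →
                       Step (removeAt Z (suc c)) (removeAt Z (inject₁ c))
  adjacent-step-even (here r) e = here (side-even _ e r)
  adjacent-step-even {Z = _ ∷ _ ∷ _} (there adj) e = there (adjacent-step-even adj e)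

  adjacent-step-odd : ∀ {k} {Z : Vec (Fin n) (suc k)} {c} → Adjacent Z c → ¬ 2 ∣ k ∸ suc (toℕ c) →
                      Step (removeAt Z (inject₁ c)) (removeAt Z (suc c))
  adjacent-step-odd (here r) o = here (side-odd _ o r)
  adjacent-step-odd {Z = _ ∷ _ ∷ _} (there adj) o = there (adjacent-step-odd adj o)

  inject₁≢suc : ∀ {k} (c : Fin k) → inject₁ c ≢ suc c
  inject₁≢suc (suc c) eq = inject₁≢suc c (Fin.suc-injective eq)

  inject₁<suc : ∀ {k} (c : Fin k) → inject₁ c Fin.< suc c
  inject₁<suc zero    = s≤s z≤n
  inject₁<suc (suc c) = s<s (inject₁<suc c)

  pair-chain : ∀ {x y} → x ≺ y → Chain (x ∷ y ∷ [])
  pair-chain x≺y = (x≺y ∷ []) ∷ [] ∷ []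

  quasi⇒adjacent : ∀ {k} (Z : Vec (Fin n) (suc k)) i → IsQuasiInversion w Z →
                   Inv w (removeAt Z (inject₁ i)) → Inv w (removeAt Z (suc i)) →
             Adjacent Z i
  quasi⇒adjacent Z i (inc , _ , (a<b , ¬inv) , _) p q
    with chain-or-adjacent Z (allPairs-lookup⁻ inc) (inject₁<suc i) (inv⇒chain p) (inv⇒chain q)
  ... | inj₁ cZ = contradiction (chain⇒inv (pair-chain (allPairs-lookup⁺ cZ a<b))) ¬inv
  ... | inj₂ (c , _ , refl , adj) = adj

  permanentStep⇒step : ∀ {k} {X Y : Vec (Fin n) k} → PermanentStep w X Y →
                       Chain X × Chain Y × Step X Y
  permanentStep⇒step (odd Z i quasi (_ , faces) o) =
    let p = proj₂ (faces (inj₁ refl)); q = proj₂ (faces (inj₂ refl)) in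
    inv⇒chain p , inv⇒chain q , adjacent-step-odd (quasi⇒adjacent Z i quasi p q) o
  permanentStep⇒step (even Z i quasi (_ , faces) e) =
    let p = proj₂ (faces (inj₁ refl)); q = proj₂ (faces (inj₂ refl)) in
    inv⇒chain q , inv⇒chain p , adjacent-step-even (quasi⇒adjacent Z i quasi p q) e

  module _ {k} {Z : Vec (Fin n) (suc k)} {c : Fin k} (incZ : Ascending Z) (adj : Adjacent Z c)
           (c₁ : Chain (removeAt Z (inject₁ c))) (c₂ : Chain (removeAt Z (suc c))) where

    -- Any other pair of positions avoids `c` or `c + 1`, so it survives in one of the two faces,
    -- which are chains.
    quasiInversion : IsQuasiInversion w Z
    quasiInversion = allPairs-lookup⁺ incZ , (inject₁ c , suc c) ,
      (inject₁<suc c , λ inv → case inv⇒chain {X = lookup Z (inject₁ c) ∷ lookup Z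
          (suc c) ∷ []} inv of λ { ((p ∷ _) ∷ _) → ≺⇒⋪ p (adjacent-◁ adj) }) , unique _ _
      where
      unique : ∀ a b → a Fin.< b × ¬ Inv w (lookup Z a ∷ lookup Z b ∷ []) →
               (inject₁ c , suc c) ≡ (a , b)
      unique a b (a<b , ¬inv) with a Fin.≟ inject₁ c | b Fin.≟ suc c
      ... | yes refl | yes refl = refl
      ... | yes refl | no b≢  = contradiction
              (chain⇒inv (pair-chain (allPairs-removeAt-lookup {X = Z} c₂
                  (inject₁≢suc c) b≢ a<b))) ¬inv
      ... | no a≢  | yes refl = contradiction
              (chain⇒inv (pair-chain (allPairs-removeAt-lookup {X = Z} c₁ a≢
                  (inject₁≢suc c ∘ sym) a<b))) ¬inv
      ... | no a≢  | no b≢ with b Fin.≟ inject₁ c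
      ...   | no b≢′ = contradiction
                (chain⇒inv (pair-chain (allPairs-removeAt-lookup {X = Z} c₁ a≢ b≢′ a<b))) ¬inv
      ...   | yes refl = contradiction
                (chain⇒inv (pair-chain (allPairs-removeAt-lookup {X = Z} c₂
                  (λ { refl → Fin.<-asym a<b (inject₁<suc c) }) b≢ a<b))) ¬inv

    -- Every other face retains the pair that is not inverted.
    packet∩inv : Packet Z ∩ Inv w ≐ ｛ removeAt Z (inject₁ c) ｝ ∪ ｛ removeAt Z (suc c) ｝
    packet∩inv = (λ (Y∈ , inv) → only Y∈ inv) , λ where
        (inj₁ refl) → ∈-tabulate⁺ {f = removeAt Z} (inject₁ c) , chain⇒inv c₁
        (inj₂ refl) → ∈-tabulate⁺ {f = removeAt Z} (suc c) , chain⇒inv c₂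
      where
      only : ∀ {Y} → Y ∈ antilex Z → Inv w Y →
             (｛ removeAt Z (inject₁ c) ｝ ∪ ｛ removeAt Z (suc c) ｝) Y
      only Y∈ inv with ∈-tabulate⁻ {f = removeAt Z} Y∈
      ... | j , refl with j Fin.≟ inject₁ c | j Fin.≟ suc c
      ...   | yes refl | _        = inj₁ refl
      ...   | no _     | yes refl = inj₂ refl
      ...   | no j≢    | no j≢′   = contradiction (adjacent-◁ adj)
              (≺⇒⋪ (allPairs-removeAt-lookup {X = Z} (inv⇒chain inv) (j≢ ∘ sym) (j≢′ ∘ sym)
                  (inject₁<suc c)))

  -- `Z` is the union of the two chains. They differ in one coordinate, the smaller of the two
  -- values comes first in `Z`, and the parity decides which of them belongs to the lower chain.
  step-packet : ∀ {k} {X Y : Vec (Fin n) k} → Chain X → Chain Y → Step X Y →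
                ∃₂ λ Z c → Ascending Z × Adjacent Z c ×
                  ((2 ∣ k ∸ suc (toℕ c) × X ≡ removeAt Z (suc c) × Y ≡ removeAt Z (inject₁ c)) ⊎
                   (¬ 2 ∣ k ∸ suc (toℕ c) × X ≡ removeAt Z (inject₁ c) × Y ≡ removeAt Z (suc c)))
  step-packet {suc k} {x ∷ X} {y ∷ X} cX cY (here r)
    with chain⇒ascending cX | chain⇒ascending cY | side-parity k r
  ... | x<X ∷ iX | y<X ∷ _ | inj₁ (e , x◁y) = x ∷ y ∷ X , zero ,
          (proj₁ x◁y ∷ x<X) ∷ y<X ∷ iX , here x◁y , inj₁ (e , refl , refl)
  ... | x<X ∷ iX | y<X ∷ _ | inj₂ (o , y◁x) = y ∷ x ∷ X , zero ,
          (proj₁ y◁x ∷ y<X) ∷ x<X ∷ iX , here y◁x , inj₂ (o , refl , refl)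
  step-packet {suc k} {x ∷ X} {x ∷ Y} (x≺X ∷ cX) (x≺Y ∷ cY) (there s) with step-packet cX cY s
  ... | Z@(_ ∷ _) , c , incZ , adj , eqs = x ∷ Z , suc c , ascending eqs ∷ incZ , there adj ,
          eqs′ eqs
    where
    ascending : ∀ {P Q : Set} → (P × X ≡ removeAt Z (suc c) × Y ≡ removeAt Z (inject₁ c)) ⊎
                (Q × X ≡ removeAt Z (inject₁ c) × Y ≡ removeAt Z (suc c)) → VAll (x Fin.<_) Z
    ascending (inj₁ (_ , refl , refl)) =
      all-removeAt⁻ Z (inject₁≢suc c ∘ sym) (VAll.map proj₁ x≺X) (VAll.map proj₁ x≺Y)
    ascending (inj₂ (_ , refl , refl)) =
      all-removeAt⁻ Z (inject₁≢suc c) (VAll.map proj₁ x≺X) (VAll.map proj₁ x≺Y)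
    eqs′ : ∀ {P Q : Set} → (P × X ≡ removeAt Z (suc c) × Y ≡ removeAt Z (inject₁ c)) ⊎
           (Q × X ≡ removeAt Z (inject₁ c) × Y ≡ removeAt Z (suc c)) →
           (P × x ∷ X ≡ x ∷ removeAt Z (suc c) × x ∷ Y ≡ x ∷ removeAt Z (inject₁ c)) ⊎
           (Q × x ∷ X ≡ x ∷ removeAt Z (inject₁ c) × x ∷ Y ≡ x ∷ removeAt Z (suc c))
    eqs′ (inj₁ (e , refl , refl)) = inj₁ (e , refl , refl)
    eqs′ (inj₂ (o , refl , refl)) = inj₂ (o , refl , refl)

  step⇒permanentStep : ∀ {k} {X Y : Vec (Fin n) k} → Chain X → Chain Y → Step X Y →
                       PermanentStep w X Y
  step⇒permanentStep cX cY s with step-packet cX cY s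
  ... | Z , c , incZ , adj , inj₁ (e , refl , refl) =
    even Z c (quasiInversion incZ adj cY cX) (packet∩inv incZ adj cY cX) e
  ... | Z , c , incZ , adj , inj₂ (o , refl , refl) =
    odd Z c (quasiInversion incZ adj cX cY) (packet∩inv incZ adj cX cY) o

  -- Consistent sets

  removeAt-injective : ∀ {k} {Z : Vec (Fin n) (suc k)} {i j} → Chain Z →
                       removeAt Z i ≡ removeAt Z j → i ≡ j
  removeAt-injective {i = zero} {zero} cZ eq = refl
  removeAt-injective {Z = _ ∷ _ ∷ _} {zero} {suc j} ((z≺z ∷ _) ∷ _) eq
    with refl ← Vec.∷-injectiveˡ eq = contradiction z≺z ≺-irrefl
  removeAt-injective {Z = _ ∷ _ ∷ _} {suc i} {zero} ((z≺z ∷ _) ∷ _) eq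
    with refl ← Vec.∷-injectiveˡ eq = contradiction z≺z ≺-irrefl
  removeAt-injective {Z = _ ∷ _ ∷ _} {suc i} {suc j} (_ ∷ cZ) eq =
    cong suc (removeAt-injective cZ (Vec.∷-injectiveʳ eq))

  -- Two distinct faces of `X` contain all its entries between them. Thus `Z` contains them too, and
  -- both are increasing of the same length.
  two-faces-< : ∀ {k} {X Z : Vec (Fin n) (suc k)} → Chain X → Chain Z → ∀ {i j a b} → i Fin.< j →
                removeAt X i ≡ removeAt Z a → removeAt X j ≡ removeAt Z b → X ≡ Z
  two-faces-< {X = x ∷ y ∷ X} {z ∷ u ∷ Z} cX cZ {zero} {suc j} {zero} {suc b} _ refl q
    with refl ← Vec.∷-injectiveˡ q = refl
  two-faces-< {X = x ∷ y ∷ X} {z ∷ u ∷ Z} ((x≺y ∷ _) ∷ _) cZ {zero} {suc j} {suc a} {suc b} _ p q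
    with refl ← Vec.∷-injectiveˡ p | refl ← Vec.∷-injectiveˡ q = contradiction x≺y ≺-irrefl
  two-faces-< {X = x ∷ y ∷ X} {z ∷ u ∷ Z} ((x≺y ∷ _) ∷ _) _ {zero} {suc j} {zero} {zero} _ p q
    with refl ← Vec.∷-injectiveˡ (trans p (sym q)) = contradiction x≺y ≺-irrefl
  two-faces-< {X = x ∷ y ∷ X} {z ∷ u ∷ Z} ((x≺y ∷ _) ∷ _)
      ((z≺u ∷ _) ∷ _) {zero} {suc j} {suc a} {zero} _ p q
    with refl ← Vec.∷-injectiveˡ p | refl ← Vec.∷-injectiveˡ q =
        contradiction (≺-trans x≺y z≺u) ≺-irrefl
  two-faces-< {X = x ∷ X@(_ ∷ _)} {z ∷ Z@(_ ∷ _)} (_ ∷ cX) (_ ∷ cZ) {suc i} {suc j} {suc a} {suc b}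
      (s<s i<j) p q =
    cong₂ _∷_ (Vec.∷-injectiveˡ p) (two-faces-< cX cZ {a = a} {b} i<j (Vec.∷-injectiveʳ p)
        (Vec.∷-injectiveʳ q))
  two-faces-< {X = x ∷ X@(_ ∷ _)} {z ∷ Z@(_ ∷ _)} cX
      ((z≺u ∷ _) ∷ _) {suc i} {suc j} {zero} {suc b} _ p q
    with refl ← Vec.∷-injectiveˡ p | refl ← Vec.∷-injectiveˡ q = contradiction z≺u ≺-irrefl
  two-faces-< {X = x ∷ X@(_ ∷ _)} {z ∷ Z@(_ ∷ _)} cX
      ((z≺u ∷ _) ∷ _) {suc i} {suc j} {suc a} {zero} _ p q
    with refl ← Vec.∷-injectiveˡ p | refl ← Vec.∷-injectiveˡ q = contradiction z≺u ≺-irrefl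
  two-faces-< {X = x ∷ X@(_ ∷ _)} {z ∷ Z@(_ ∷ _)} (_ ∷ cX) cZ {suc i} {suc j} {zero} {zero}
      (s<s i<j) p q =
    contradiction (removeAt-injective cX (Vec.∷-injectiveʳ (trans p (sym q)))) (Fin.<⇒≢ i<j)

  two-faces : ∀ {k} {X Z : Vec (Fin n) (suc k)} → Chain X → Chain Z → ∀ {i j a b} → i ≢ j →
              removeAt X i ≡ removeAt Z a → removeAt X j ≡ removeAt Z b → X ≡ Z
  two-faces cX cZ {i} {j} {a} {b} i≢j p q with Fin.<-cmp i j
  ... | tri< i<j _ _ = two-faces-< cX cZ {a = a} {b} i<j p q
  ... | tri≈ _ i≡j _ = contradiction i≡j i≢j
  ... | tri> _ _ j<i = two-faces-< cX cZ {a = b} {a} j<i q p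

  step-∷⁻ : ∀ {k x y} {X Y : Vec (Fin n) k} → Step (x ∷ X) (y ∷ Y) → Side k x y ⊎ (x ≡ y × Step X Y)
  step-∷⁻ (here r)  = inj₁ r
  step-∷⁻ (there s) = inj₂ (refl , s)

  -- Where two faces of a chain first differ, their entries are related by `≺`, hence by no `Side`.
  faces-no-step : ∀ {k} {Z : Vec (Fin n) (suc k)} → Chain Z → ∀ {i j} → i ≢ j →
                  ¬ Step (removeAt Z i) (removeAt Z j)
  faces-no-step cZ {zero} {zero} i≢j s = i≢j refl
  faces-no-step {suc k} {_ ∷ _ ∷ _} ((z≺z′ ∷ _) ∷ _) {zero} {suc j} i≢j s with step-∷⁻ s
  ... | inj₁ r          = ≺⇒¬side (suc k) z≺z′ r
  ... | inj₂ (refl , _) = ≺-irrefl z≺z′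
  faces-no-step {suc k} {_ ∷ _ ∷ _} ((z≺z′ ∷ _) ∷ _) {suc i} {zero} i≢j s with step-∷⁻ s
  ... | inj₁ r          = ≺⇒¬side k z≺z′ r
  ... | inj₂ (refl , _) = ≺-irrefl z≺z′
  faces-no-step {suc k} {_ ∷ _ ∷ _} (_ ∷ cZ) {suc i} {suc j} i≢j s with step-∷⁻ s
  ... | inj₁ r       = side-irrefl k r
  ... | inj₂ (_ , s) = faces-no-step cZ (i≢j ∘ cong suc) s

  univ : List (Fin n)
  univ = List.allFin n

  chain⇒∈ᶜ : ∀ {k} {X : Vec (Fin n) k} → Chain X → X ∈ᶜ univ
  chain⇒∈ᶜ {X = X} cX = cX , VAll.universal ∈-allFin X

  Con : ∀ {k} → Pred (Vec (Fin n) (suc k)) 0ℓ → Set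
  Con = Consistent univ

  module _ {k} (U : Pred (Vec (Fin n) (suc k)) 0ℓ) (U⊆chain : U ⊆ Chain) (con : Con U) where
    open Consistent con

    private
      packet-prefixOrSuffix : ∀ Z → Chain Z → IsPrefix Z (Packet Z ∩ U) ⊎ IsSuffix Z (Packet Z ∩ U)
      -- A nonempty prefix contains the last face, with which the lex order begins. Membership of
      -- this face therefore tells which alternative to prove.
      packet-prefixOrSuffix Z cZ with dec (removeAt Z (Fin.fromℕ (suc k)))
      ... | yes u-last =
        let t , iff = upward-threshold (dec ∘ removeAt Z) up in
        inj₁ (t , (λ { (Y∈ , uY) → case ∈-tabulate⁻ {f = removeAt Z} Y∈ of
            λ { (j , refl) → j , Equivalence.to (iff j) uY , refl } })
                , (λ { (j , t≤j , refl) → ∈-tabulate⁺ {f = removeAt Z} j , Equivalence.from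
                    (iff j) t≤j }))
        where
        up : ∀ {i j} → i Fin.< j → U (removeAt Z i) → U (removeAt Z j)
        up {j = j} i<j u with ≤-fromℕ j
        ... | inj₁ refl = u-last
        ... | inj₂ j<l  = convex Z (chain⇒∈ᶜ cZ) i<j j<l u u-last
      ... | no ¬u-last =
        let t , iff = downward-threshold (dec ∘ removeAt Z) down in
        inj₂ (t , (λ { (Y∈ , uY) → case ∈-tabulate⁻ {f = removeAt Z} Y∈ of
            λ { (j , refl) → j , Equivalence.to (iff j) uY , refl } })
                , (λ { (j , j<t , refl) → ∈-tabulate⁺ {f = removeAt Z} j , Equivalence.from
                    (iff j) j<t }))
        where
        down : ∀ {i j} → i Fin.< j → U (removeAt Z j) → U (removeAt Z i)
        down {i} {j} i<j u with ≤-fromℕ j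
        ... | inj₁ refl = contradiction u ¬u-last
        ... | inj₂ j<l  = decidable-stable (dec (removeAt Z i))
                (λ ¬u → coconvex Z (chain⇒∈ᶜ cZ) i<j j<l ¬u ¬u-last u)

    consistentSet : ConsistentSet w (suc k)
    consistentSet = record
      { set = U
      ; decidable = dec
      ; inversions = chain⇒inv ∘ U⊆chain
      ; lowerIdeal = lower*
      ; prefixOrSuffix = λ Z invZ → packet-prefixOrSuffix Z (inv⇒chain invZ) }
      where
      lower* : ∀ {X Y} → Permanent w X Y → U Y → U X
      lower* ε u = u
      lower* (s ◅ ss) u = let cX , cY , s′ = permanentStep⇒step s in
        lower (chain⇒∈ᶜ cX) (chain⇒∈ᶜ cY) s′ (lower* ss u)

  set-chain : ∀ {k} (R : ConsistentSet w k) → set R ⊆ Chain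
  set-chain R = inv⇒chain ∘ ConsistentSet.inversions R

  set-con : ∀ {k} (R : ConsistentSet w (suc k)) → Con (set R)
  set-con {k} R = record
    { dec = decidable
    ; lower = λ X∈ Y∈ s → lowerIdeal (step⇒permanentStep (proj₁ X∈) (proj₁ Y∈) s ◅ ε)
    ; convex = λ Z Z∈ i<j j<l → convex′ Z (proj₁ Z∈)
        (prefixOrSuffix Z (chain⇒inv (proj₁ Z∈))) i<j j<l
    ; coconvex = λ Z Z∈ i<j j<l → coconvex′ Z (proj₁ Z∈)
        (prefixOrSuffix Z (chain⇒inv (proj₁ Z∈))) i<j j<l }
    where
    open ConsistentSet R renaming (set to U)
    module _ (Z : Vec (Fin n) (suc (suc k))) (cZ : Chain Z) where
      face⁻ : ∀ {P : Pred (Fin (suc (suc k))) 0ℓ} →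
              (Packet Z ∩ U) ≐ (λ Y → ∃ λ j → P j × Y ≡ removeAt Z j) →
              ∀ {i} → U (removeAt Z i) → P i
      face⁻ (sub , _) {i} u with sub (∈-tabulate⁺ {f = removeAt Z} i , u)
      ... | j , p , eq with refl ← removeAt-injective cZ eq = p
      face⁺ : ∀ {P : Pred (Fin (suc (suc k))) 0ℓ} →
              (Packet Z ∩ U) ≐ (λ Y → ∃ λ j → P j × Y ≡ removeAt Z j) →
              ∀ {i} → P i → U (removeAt Z i)
      face⁺ (_ , sup) p = proj₂ (sup (_ , p , refl))
      convex′ : IsPrefix Z (Packet Z ∩ U) ⊎ IsSuffix Z (Packet Z ∩ U) → ∀ {i j l} → i Fin.< j →
                j Fin.< l →
                U (removeAt Z i) → U (removeAt Z l) → U (removeAt Z j)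
      convex′ (inj₁ (t , eq)) i<j j<l p q = face⁺ eq (ℕ.≤-trans (face⁻ eq p) (ℕ.<⇒≤ i<j))
      convex′ (inj₂ (t , eq)) i<j j<l p q = face⁺ eq (ℕ.<-trans j<l (face⁻ eq q))
      coconvex′ : IsPrefix Z (Packet Z ∩ U) ⊎ IsSuffix Z (Packet Z ∩ U) → ∀ {i j l} → i Fin.< j →
                  j Fin.< l →
                  ¬ U (removeAt Z i) → ¬ U (removeAt Z l) → ¬ U (removeAt Z j)
      coconvex′ (inj₁ (t , eq)) i<j j<l ¬p ¬q u = ¬q (face⁺ eq (ℕ.≤-trans (face⁻ eq u) (ℕ.<⇒≤ j<l)))
      coconvex′ (inj₂ (t , eq)) i<j j<l ¬p ¬q u = ¬p (face⁺ eq (ℕ.<-trans i<j (face⁻ eq u)))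

  -- Admissible orders and their reversal sets

  record Lex {k} (ρ : List (Vec (Fin n) k)) (Z : Vec (Fin n) (suc k)) : Set where
    constructor mkLex
    field lex-before : ∀ {i j} → i Fin.< j → Before (removeAt Z j) (removeAt Z i) ρ

  record Antilex {k} (ρ : List (Vec (Fin n) k)) (Z : Vec (Fin n) (suc k)) : Set where
    constructor mkAntilex
    field antilex-before : ∀ {i j} → i Fin.< j → Before (removeAt Z i) (removeAt Z j) ρ

  open Lex public
  open Antilex public

  record Admissible {k} (ρ : List (Vec (Fin n) k)) : Set where
    field
      unique   : Unique ρ
      sound    : ∀ {X} → X ∈ ρ → Chain X
      complete : ∀ {X} → Chain X → X ∈ ρ
      no-back  : ∀ {X Y} → Before X Y ρ → ¬ Step Y X
      packets  : ∀ {Z} → Chain Z → Lex ρ Z ⊎ Antilex ρ Z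

    face-∈ : ∀ {Z} → Chain Z → ∀ i → removeAt Z i ∈ ρ
    face-∈ cZ i = complete (allPairs-removeAt cZ i)

    -- Both ends of each single step occur in `ρ`, so the step goes strictly forward there, and
    -- these moves compose.
    no-back* : ∀ {X Y} → Before X Y ρ → ¬ Permanent w Y X
    no-back* b p with forward p
      where
      forward : ∀ {X Y} → Permanent w X Y → X ≡ Y ⊎ Before X Y ρ
      forward ε = inj₁ refl
      forward {X} (_◅_ {j = V} s ss) with permanentStep⇒step s
      ... | cX , cV , s′ with before-total (complete cX) (complete cV) (λ { refl → step-irrefl s′ })
      ...   | inj₂ b = contradiction s′ (no-back b)
      ...   | inj₁ b with forward ss
      ...     | inj₁ refl = inj₂ b
      ...     | inj₂ c    = inj₂ (before-trans unique b c)
    ... | inj₁ refl = before-irrefl unique b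
    ... | inj₂ c    = before-asym unique b c

  lex-antilex-disjoint : ∀ {k} {ρ : List (Vec (Fin n) (suc k))} {Z} → Unique ρ → Lex ρ Z →
      ¬ Antilex ρ Z
  lex-antilex-disjoint ρ! l a =
    before-asym ρ! (antilex-before a {zero} {suc zero} (s≤s z≤n))
        (lex-before l {zero} {suc zero} (s≤s z≤n))

  antilex-unique : ∀ {k} {Z : Vec (Fin n) (suc k)} → Chain Z → Unique (antilex Z)
  antilex-unique cZ = Unique.tabulate⁺ (removeAt-injective cZ)

  ∈-lex⁻ : ∀ {k} (Z : Vec (Fin n) (suc k)) {X} → X ∈ lex Z → ∃ λ i → X ≡ removeAt Z i
  ∈-lex⁻ Z X∈ = ∈-tabulate⁻ {f = removeAt Z} (Any.reverse⁻ X∈)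

  before-lex⁻ : ∀ {k} (Z : Vec (Fin n) (suc k)) {X Y} → Before X Y (lex Z) →
                ∃₂ λ i j → i Fin.< j × Y ≡ removeAt Z i × X ≡ removeAt Z j
  before-lex⁻ Z b = before-tabulate⁻ (removeAt Z) (before-reverse⁻ (antilex Z) b)

  lex-unique : ∀ {k} {Z : Vec (Fin n) (suc k)} → Chain Z → Unique (lex Z)
  lex-unique {Z = Z} cZ = unique-before λ b →
    before-irrefl (antilex-unique cZ) (before-reverse⁻ (antilex Z) b)

  module _ {k} {ρ : List (Vec (Fin n) k)} (ρ! : Unique ρ) {Z : Vec (Fin n) (suc k)} (cZ : Chain Z)
           (faces-∈ : ∀ i → removeAt Z i ∈ ρ) where
    open DecMembership (_≟ᵛ_ {n} {k}) using (_∈?_)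

    -- Both lists enumerate the faces of `Z` without repetition, so it suffices to compare relative
    -- orders.
    antilex-restriction⁺ : Antilex ρ Z → ρ ∣ₚ Z ≡ antilex Z
    antilex-restriction⁺ a = sym (before⇒≡ (antilex-unique cZ) (Unique.filter⁺ (_∈? antilex Z) ρ!)
      (λ X∈ → case ∈-tabulate⁻ {f = removeAt Z} X∈ of
          λ { (i , refl) → ∈-filter⁺ (_∈? antilex Z) (faces-∈ i) X∈ })
      (λ X∈ → proj₂ (∈-filter⁻ (_∈? antilex Z) {xs = ρ} X∈))
      (λ b → case before-tabulate⁻ (removeAt Z) b of λ { (i , j , i<j , refl , refl) →
        before-filter⁺ (_∈? antilex Z) (before-∈ˡ b) (before-∈ʳ b) (antilex-before a i<j) }))

    antilex-restriction⁻ : ρ ∣ₚ Z ≡ antilex Z → Antilex ρ Z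
    antilex-restriction⁻ eq = mkAntilex λ i<j → before-filter⁻ (_∈? antilex Z) ρ
      (subst (Before _ _) (sym eq) (before-tabulate⁺ (removeAt Z) i<j))

    lex-restriction⁺ : Lex ρ Z → ρ ∣ₚ Z ≡ lex Z
    lex-restriction⁺ l = sym (before⇒≡ (lex-unique cZ) (Unique.filter⁺ (_∈? antilex Z) ρ!)
      (λ X∈ → case ∈-lex⁻ Z X∈ of λ { (i , refl) → ∈-filter⁺ (_∈? antilex Z) (faces-∈ i)
          (∈-tabulate⁺ {f = removeAt Z} i) })
      (λ X∈ → Any.reverse⁺ (proj₂ (∈-filter⁻ (_∈? antilex Z) {xs = ρ} X∈)))
      (λ b → case before-lex⁻ Z b of λ { (i , j , i<j , refl , refl) →
        before-filter⁺ (_∈? antilex Z) (∈-tabulate⁺ {f = removeAt Z} j)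
            (∈-tabulate⁺ {f = removeAt Z} i) (lex-before l i<j) }))

    lex-restriction⁻ : ρ ∣ₚ Z ≡ lex Z → Lex ρ Z
    lex-restriction⁻ eq = mkLex λ i<j → before-filter⁻ (_∈? antilex Z) ρ
      (subst (Before _ _) (sym eq) (before-reverse (antilex Z) (before-tabulate⁺ (removeAt Z) i<j)))

  admissible : ∀ {k} (ρ : AdmissibleOrder w k) → Admissible (order ρ)
  admissible ρ = record
    { unique = proj₁ totalOrder
    ; sound = λ {X} X∈ → inv⇒chain (Equivalence.to (proj₂ totalOrder X) X∈)
    ; complete = complete′
    ; no-back = λ b s → case before-lookup⁻ b of λ where
        (i , j , i<j , refl , refl) → ℕ.<⇒≱ i<j (linearExtension j i
          (step⇒permanentStep (sound′ j) (sound′ i) s ◅ ε))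
    ; packets = λ {Z} cZ → Sum.map
        (lex-restriction⁻ (proj₁ totalOrder) cZ (λ i → complete′ (allPairs-removeAt cZ i)))
        (antilex-restriction⁻ (proj₁ totalOrder) cZ (λ i → complete′ (allPairs-removeAt cZ i)))
        (lexOrAntilex Z (chain⇒inv cZ)) }
    where
    open AdmissibleOrder ρ using (totalOrder; linearExtension; lexOrAntilex)
    complete′ : ∀ {X} → Chain X → X ∈ order ρ
    complete′ {X} cX = Equivalence.from (proj₂ totalOrder X) (chain⇒inv cX)
    sound′ : ∀ i → Chain (List.lookup (order ρ) i)
    sound′ i = inv⇒chain (Equivalence.to (proj₂ totalOrder _) (∈-lookup i))

  admissibleOrder : ∀ {k} {ρ : List (Vec (Fin n) k)} → Admissible ρ → AdmissibleOrder w k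
  admissibleOrder {ρ = ρ} adm = record
    { order = ρ
    ; totalOrder = unique , λ X → mk⇔ (λ X∈ → chain⇒inv (sound X∈))
        (λ inv → complete (inv⇒chain inv))
    ; linearExtension = λ i j p → ℕ.≮⇒≥ λ j<i → no-back* (before-lookup⁺ ρ j<i) p
    ; lexOrAntilex = λ Z invZ → let cZ = inv⇒chain {X = Z} invZ in
        Sum.map (lex-restriction⁺ unique cZ (face-∈ cZ))
            (antilex-restriction⁺ unique cZ (face-∈ cZ)) (packets cZ) }
    where open Admissible adm

  Reversals : ∀ {k} → List (Vec (Fin n) k) → Pred (Vec (Fin n) (suc k)) 0ℓ
  Reversals ρ Z = Chain Z × Antilex ρ Z

  rev≐reversals : ∀ {k} (ρ : AdmissibleOrder w k) → Rev w ρ ≐ Reversals (order ρ)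
  rev≐reversals ρ =
    (λ (inv , eq) → let cZ = inv⇒chain inv in cZ , antilex-restriction⁻ unique cZ (face-∈ cZ) eq) ,
    (λ (cZ , a) → chain⇒inv cZ , antilex-restriction⁺ unique cZ (face-∈ cZ) a)
    where open Admissible (admissible ρ)

  common-face : ∀ {k} {X Y : Vec (Fin n) (suc k)} → Step X Y → ∃ λ i → removeAt X i ≡ removeAt Y i
  common-face (here _) = zero , refl
  common-face {X = _ ∷ _ ∷ _} {_ ∷ _ ∷ _} (there s) = let i , eq = common-face s in suc i , cong
      (_ ∷_) eq

  module _ {k} {ρ : List (Vec (Fin n) (suc k))} (adm : Admissible ρ) where
    open Admissible adm

    reversals-dec : Decidable (Reversals ρ)
    reversals-dec Z with chain? Z
    ... | no ¬cZ = no (¬cZ ∘ proj₁)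
    ... | yes cZ with packets cZ
    ...   | inj₁ l = no (lex-antilex-disjoint unique l ∘ proj₂)
    ...   | inj₂ a = yes (cZ , a)

    ¬reversal⇒lex : ∀ {Z} → Chain Z → ¬ Reversals ρ Z → Lex ρ Z
    ¬reversal⇒lex cZ ¬r with packets cZ
    ... | inj₁ l = l
    ... | inj₂ a = contradiction (cZ , a) ¬r

    step-before : ∀ {X Y} → Chain X → Chain Y → Step X Y → Before X Y ρ
    step-before cX cY s with before-total (complete cX) (complete cY) (λ { refl → step-irrefl s })
    ... | inj₁ b = b
    ... | inj₂ b = contradiction s (no-back b)

    -- One pair of faces in increasing order already excludes lex.
    antilex-from : ∀ {Z} → Chain Z → ∀ {i j} → i Fin.< j → Before (removeAt Z i) (removeAt Z j) ρ →
                   Antilex ρ Z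
    antilex-from cZ i<j b with packets cZ
    ... | inj₁ l = contradiction b (before-asym unique (lex-before l i<j))
    ... | inj₂ a = a


  module _ {k} {ρ : List (Vec (Fin n) (suc k))} (adm : Admissible ρ) where
    open Admissible adm

    -- In each case one face is shared. If the head moves, the shared tail precedes
    -- `removeAt Y (suc zero)`, and this is one step below `removeAt X (suc zero)`, because one
    -- coordinate less reverses the direction. If the tail moves, the tail of `X` precedes the tail
    -- of `Y`, which precedes the shared face.
    reversals-lower : ∀ {X Y} → Chain X → Chain Y → Step X Y → Antilex ρ Y → Antilex ρ X
    reversals-lower {x ∷ i ∷ I} {y ∷ _} cX cY (here r) a =
      antilex-from adm cX {zero} {suc zero} (s≤s z≤n)
        (before-trans unique (antilex-before a {zero} {suc zero} (s≤s z≤n))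
          (step-before adm (allPairs-removeAt cY (suc zero)) (allPairs-removeAt cX (suc zero))
              (here r)))
    reversals-lower {x ∷ X@(_ ∷ _)} {_ ∷ Y@(_ ∷ _)} cX cY (there s) a with common-face s
    ... | i , eq = antilex-from adm cX {zero} {suc i} (s≤s z≤n)
          (subst (λ V → Before X (x ∷ V) ρ) (sym eq)
            (before-trans unique (step-before adm (allPairs-removeAt cX zero)
                (allPairs-removeAt cY zero) s)
              (antilex-before a {zero} {suc i} (s≤s z≤n))))

    reversals-con : Con (Reversals ρ)
    reversals-con = record
      { dec = reversals-dec adm
      ; lower = λ (cX , _) (cY , _) s (_ , a) → cX , reversals-lower cX cY s a
      ; convex = λ Z {i} {j} {l} (cZ , _) i<j j<l (_ , aI) (_ , aL) →
          let a , b , c , d , e , f , a<b , c<d , e<f , p , q , r = common-subfaces Z i<j j<l in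
          allPairs-removeAt cZ j , antilex-from adm (allPairs-removeAt cZ j) c<d
            (subst₂ (λ U V → Before U V ρ) p (sym r)
              (before-trans unique (antilex-before aI a<b)
                (subst (λ U → Before U (removeAt (removeAt Z l) f) ρ) (sym q)
                    (antilex-before aL e<f))))
      ; coconvex = λ Z {i} {j} {l} (cZ , _) i<j j<l ¬I ¬L (_ , aJ) →
          let a , b , c , d , e , f , a<b , c<d , e<f , p , q , r = common-subfaces Z i<j j<l
              lI = ¬reversal⇒lex adm (allPairs-removeAt cZ i) ¬I
              lL = ¬reversal⇒lex adm (allPairs-removeAt cZ l) ¬L in
          before-asym unique (antilex-before aJ c<d)
            (subst₂ (λ U V → Before U V ρ) (sym r) p
              (before-trans unique (lex-before lL e<f)
                (subst (λ U → Before U (removeAt (removeAt Z i) a) ρ) q (lex-before lI a<b)))) }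

  permanent-step : ∀ {k} {X Y : Vec (Fin n) k} → Chain X → Chain Y → Step X Y → Permanent w X Y
  permanent-step cX cY s = step⇒permanentStep cX cY s ◅ ε

  adjacent⇒permanent : ∀ {k} {Z : Vec (Fin n) (suc k)} {c} → Adjacent Z c →
    Chain (removeAt Z (inject₁ c)) → Chain (removeAt Z (suc c)) →
    Permanent w (removeAt Z (suc c)) (removeAt Z (inject₁ c)) ⊎
    Permanent w (removeAt Z (inject₁ c)) (removeAt Z (suc c))
  adjacent⇒permanent {k} {c = c} adj c₁ c₂ with 2 ∣? k ∸ suc (toℕ c)
  ... | yes e = inj₁ (permanent-step c₂ c₁ (adjacent-step-even adj e))
  ... | no o  = inj₂ (permanent-step c₁ c₂ (adjacent-step-odd adj o))

  -- Only packets of inversions have to be excluded: if two inversions lie in the packet of an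
  -- increasing vector that is not a chain, this vector is a quasi-inversion and makes them
  -- comparable.
  commute : ∀ {k} {X Y : Vec (Fin n) k} → Chain X → Chain Y → X ≢ Y →
            ¬ Permanent w X Y → ¬ Permanent w Y X →
            (∀ Z {i j} → Chain Z → i ≢ j → X ≡ removeAt Z i → Y ≡ removeAt Z j → ⊥) → Commute w X Y
  commute cX cY X≢Y ¬XY ¬YX ¬packet = ¬XY , ¬YX , λ (Z , inc , X∈ , Y∈) →
    let i , p = ∈-tabulate⁻ {f = removeAt Z} X∈
        j , q = ∈-tabulate⁻ {f = removeAt Z} Y∈ in
    common-packet Z (allPairs-lookup⁻ inc) i j p q cX cY X≢Y ¬XY ¬YX (¬packet Z)
    where
    common-packet : ∀ {k} {X Y : Vec (Fin n) k} Z → Ascending Z → ∀ i j → X ≡ removeAt Z i →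
                    Y ≡ removeAt Z j →
                    Chain X → Chain Y → X ≢ Y → ¬ Permanent w X Y → ¬ Permanent w Y X →
                    ¬ (∀ {a b} → Chain Z → a ≢ b → X ≡ removeAt Z a → Y ≡ removeAt Z b → ⊥)
    common-packet Z asc i j refl refl cX cY X≢Y ¬XY ¬YX ¬packet with Fin.<-cmp i j
    ... | tri≈ _ refl _ = X≢Y refl
    ... | tri< i<j i≢j _ with chain-or-adjacent Z asc i<j cX cY
    ...   | inj₁ cZ = ¬packet cZ i≢j refl refl
    ...   | inj₂ (c , refl , refl , adj) = [ ¬YX , ¬XY ]′ (adjacent⇒permanent adj cX cY)
    common-packet Z asc i j refl refl cX cY X≢Y ¬XY ¬YX ¬packet | tri> _ i≢j j<i with chain-or-adjacent Z asc j<i cY cX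
    ...   | inj₁ cZ = ¬packet cZ i≢j refl refl
    ...   | inj₂ (c , refl , refl , adj) = [ ¬XY , ¬YX ]′ (adjacent⇒permanent adj cY cX)

  -- Commutations and packet flips

  swap⇒commutation : ∀ {k} {ρ σ : List (Vec (Fin n) k)} → Swap (Commute w) ρ σ → Commutation w ρ σ
  swap⇒commutation (here c) = swap [] _ c
  swap⇒commutation (there s) with swap⇒commutation s
  ... | swap xs ys c = swap (_ ∷ xs) ys c

  module _ {k} {ρ σ : List (Vec (Fin n) (suc k))} (ρ-adm : Admissible ρ)
      (σ-adm : Admissible σ) where
    private
      module ρ = Admissible ρ-adm
      module σ = Admissible σ-adm

    -- Suppose that `σ` has `Y` before `X`. Both orders are linear extensions, so `X` and `Y` are
    -- incomparable. A common packet would be oriented differently by `ρ` and `σ`, contrary to the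
    -- hypothesis.
    same-order-or-commute : ∀ {X Y} → Before X Y ρ →
      (∀ Z {i j} → Chain Z → X ≡ removeAt Z i → Y ≡ removeAt Z j →
       (Antilex ρ Z → Antilex σ Z) × (Antilex σ Z → Antilex ρ Z)) →
      Before X Y σ ⊎ Commute w X Y
    same-order-or-commute {X} {Y} b same with before-total (σ.complete cX) (σ.complete cY) X≢Y
      where
      cX = ρ.sound (before-∈ˡ b)
      cY = ρ.sound (before-∈ʳ b)
      X≢Y : X ≢ Y
      X≢Y refl = before-irrefl ρ.unique b
    ... | inj₁ b′ = inj₁ b′
    ... | inj₂ b′ = inj₂ (commute (ρ.sound (before-∈ˡ b)) (ρ.sound (before-∈ʳ b))
            (λ { refl → before-irrefl ρ.unique b }) (σ.no-back* b′) (ρ.no-back* b) same-packet)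
      where
      same-packet : ∀ Z {i j} → Chain Z → i ≢ j → X ≡ removeAt Z i → Y ≡ removeAt Z j → ⊥
      same-packet Z {i} {j} cZ i≢j refl refl with same Z cZ refl refl | Fin.<-cmp i j
      ... | _       | tri≈ _ i≡j _ = i≢j i≡j
      ... | ρ⇒σ , _ | tri< i<j _ _ =
        before-asym σ.unique (antilex-before (ρ⇒σ (antilex-from ρ-adm cZ i<j b)) i<j) b′
      ... | _ , σ⇒ρ | tri> _ _ j<i =
        before-asym ρ.unique (antilex-before (σ⇒ρ (antilex-from σ-adm cZ j<i b′)) j<i) b

  same-reversals⇒commutations : ∀ {k} {ρ σ : List (Vec (Fin n) (suc k))} → Admissible ρ →
      Admissible σ →
                                Reversals ρ ≐ Reversals σ → Star (Commutation w) ρ σ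
  same-reversals⇒commutations {ρ = ρ} {σ} ρ-adm σ-adm (ρ⊆σ , σ⊆ρ) = Star.map swap⇒commutation
    (sort σ ρ.unique σ.unique (λ X∈ → σ.complete (ρ.sound X∈)) (λ X∈ → ρ.complete (σ.sound X∈))
      (λ b b′ → [ (λ b″ → contradiction b′ (before-asym σ.unique b″)) , id ]′
        (same-order-or-commute ρ-adm σ-adm b
          λ Z cZ _ _ → (λ a → proj₂ (ρ⊆σ (cZ , a))) , (λ a → proj₂ (σ⊆ρ (cZ , a))))))
    where
    module ρ = Admissible ρ-adm
    module σ = Admissible σ-adm

  -- A commutation and a packet flip both reverse a consecutive block, of two commuting elements or
  -- of a whole packet. A packet without two elements in the block keeps its order.
  module Block {k} (xs : List (Vec (Fin n) (suc k))) B {ys}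
      (ρ-adm : Admissible (xs ++ B ++ ys)) where
    open Admissible ρ-adm

    private
      ρ = xs ++ B ++ ys
      σ = xs ++ reverse B ++ ys

      ∈⁻ : ∀ {X} → X ∈ σ → X ∈ ρ
      ∈⁻ {X} X∈ = subst (λ C → X ∈ xs ++ C ++ ys) (List.reverse-involutive B)
          (∈-block xs (reverse B) X∈)

      before⁻ : ∀ {X Y} → Before X Y σ → Before X Y ρ ⊎ Before Y X B
      before⁻ {X} {Y} b = Sum.map (subst (λ C → Before X Y (xs ++ C ++ ys))
          (List.reverse-involutive B))
                                  (before-reverse⁻ B) (before-block xs (reverse B) b)

      before-B : ∀ {X Y} → Before X Y B → Before X Y ρ
      before-B b = before-++⁺ʳ xs (before-++⁺ˡ b)

    reverse-unique : Unique σ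
    reverse-unique = unique-before λ b →
      [ before-irrefl unique , (λ b′ → before-irrefl unique (before-B b′)) ]′ (before⁻ b)

    reverse-admissible : (∀ {X Y} → Before X Y B → ¬ Step X Y) →
                         (∀ {Z} → Chain Z → Lex σ Z ⊎ Antilex σ Z) → Admissible σ
    reverse-admissible ¬step σ-packets = record
      { unique = reverse-unique
      ; sound = sound ∘ ∈⁻
      ; complete = ∈-block xs B ∘ complete
      ; no-back = λ b s → [ (λ b′ → no-back b′ s) , (λ b′ → ¬step b′ s) ]′ (before⁻ b)
      ; packets = σ-packets }

    module _ {Z} (outside : ∀ {i j} → ¬ Before (removeAt Z i) (removeAt Z j) B) where

      outside-lex⁺ : Lex ρ Z → Lex σ Z
      outside-lex⁺ l = mkLex λ i<j → [ id , (λ b → contradiction b outside) ]′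
          (before-block xs B (lex-before l i<j))

      outside-antilex⁺ : Antilex ρ Z → Antilex σ Z
      outside-antilex⁺ a = mkAntilex λ i<j →
        [ id , (λ b → contradiction b outside) ]′ (before-block xs B (antilex-before a i<j))

      outside-antilex⁻ : Antilex σ Z → Antilex ρ Z
      outside-antilex⁻ a = mkAntilex λ i<j →
        [ id , (λ b → contradiction b outside) ]′ (before⁻ (antilex-before a i<j))

  commutation-admissible : ∀ {k} {ρ σ : List (Vec (Fin n) (suc k))} → Commutation w ρ σ →
      Admissible ρ →
                           Admissible σ × Reversals ρ ≐ Reversals σ
  commutation-admissible (swap xs {X} {Y} ys (¬XY , ¬YX , ¬packet)) ρ-adm =
    reverse-admissible (λ { (here (here refl)) s → ¬XY (permanent-step cX cY s) ;
        (there (here ())) })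
      (λ {Z} cZ → Sum.map (outside-lex⁺ (outside cZ)) (outside-antilex⁺ (outside cZ))
          (packets cZ)) ,
    (λ (cZ , a) → cZ , outside-antilex⁺ (outside cZ) a) ,
    (λ (cZ , a) → cZ , outside-antilex⁻ (outside cZ) a)
    where
    open Admissible ρ-adm
    open Block xs (X ∷ Y ∷ []) ρ-adm
    cX = sound (∈-++⁺ʳ xs (here refl))
    cY = sound (∈-++⁺ʳ xs (there (here refl)))
    outside : ∀ {Z} → Chain Z → ∀ {i j} → ¬ Before (removeAt Z i) (removeAt Z j) (X ∷ Y ∷ [])
    outside {Z} cZ {i} {j} (here (here refl)) =
      ¬packet (Z , proj₁ (chain⇒inv cZ) , ∈-tabulate⁺ {f = removeAt Z} i ,
          ∈-tabulate⁺ {f = removeAt Z} j)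
    outside cZ (there (here ()))

  -- By `two-faces`, the packets of distinct chains share at most one element.
  lex-outside : ∀ {k} {X Z : Vec (Fin n) (suc k)} → Chain X → Chain Z → X ≢ Z →
                ∀ {i j} → ¬ Before (removeAt Z i) (removeAt Z j) (lex X)
  lex-outside {X = X} {Z} cX cZ X≢Z {i} {j} b with before-lex⁻ X b | i Fin.≟ j
  ... | _                     | yes refl = before-irrefl (lex-unique cX) b
  ... | a , c , a<c , p , q   | no i≢j   = X≢Z (sym (two-faces cZ cX {a = c} {b = a} i≢j q p))

  -- `faces-no-step` keeps the order a linear extension, and `lex-outside` keeps all other packets
  -- as they were.
  flip-admissible : ∀ {k} xs (X : Vec (Fin n) (suc (suc k))) ys → Chain X →
                    Admissible (xs ++ lex X ++ ys) →
                    Admissible (xs ++ antilex X ++ ys) × ¬ Reversals (xs ++ lex X ++ ys) X ×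
                    Reversals (xs ++ antilex X ++ ys) ≐ Reversals (xs ++ lex X ++ ys) ∪ ｛ X ｝
  flip-admissible {k} xs X ys cX ρ-adm =
    subst (λ C → Admissible (xs ++ C ++ ys) × ¬ Reversals ρ X × Reversals
        (xs ++ C ++ ys) ≐ Reversals ρ ∪ ｛ X ｝)
      (List.reverse-involutive (antilex X))
      ( reverse-admissible
          (λ b s → case before-lex⁻ X b of λ { (i , j , i<j , refl , refl) →
            faces-no-step cX (Fin.<⇒≢ i<j ∘ sym) s })
          σ-packets
      , (λ (_ , a) → lex-antilex-disjoint unique ρ-lex a)
      , σ⊆ , λ { (inj₁ (cZ , a)) → cZ , antilex-σ cZ a ; (inj₂ refl) → cX , σ-antilex })
    where
    open Admissible ρ-adm
    open Block xs (lex X) ρ-adm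
    ρ = xs ++ lex X ++ ys
    σ = xs ++ reverse (lex X) ++ ys

    ρ-lex : Lex ρ X
    ρ-lex = mkLex λ i<j → before-++⁺ʳ xs
        (before-++⁺ˡ (before-reverse (antilex X) (before-tabulate⁺ (removeAt X) i<j)))

    σ-antilex : Antilex σ X
    σ-antilex = mkAntilex λ i<j → before-++⁺ʳ xs (before-++⁺ˡ
      (before-reverse (lex X) (before-reverse (antilex X) (before-tabulate⁺ (removeAt X) i<j))))

    antilex-σ : ∀ {Z} → Chain Z → Antilex ρ Z → Antilex σ Z
    antilex-σ {Z} cZ a with X ≟ᵛ Z
    ... | yes refl = σ-antilex
    ... | no X≢Z   = outside-antilex⁺ (lex-outside cX cZ X≢Z) a

    σ-packets : ∀ {Z} → Chain Z → Lex σ Z ⊎ Antilex σ Z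
    σ-packets {Z} cZ with X ≟ᵛ Z
    ... | yes refl = inj₂ σ-antilex
    ... | no X≢Z   = Sum.map (outside-lex⁺ (lex-outside cX cZ X≢Z))
            (outside-antilex⁺ (lex-outside cX cZ X≢Z)) (packets cZ)

    σ⊆ : ∀ {Z} → Reversals σ Z → (Reversals ρ ∪ ｛ X ｝) Z
    σ⊆ {Z} (cZ , a) with X ≟ᵛ Z
    ... | yes refl = inj₂ refl
    ... | no X≢Z   = inj₁ (cZ , outside-antilex⁻ (lex-outside cX cZ X≢Z) a)

  commutations-admissible : ∀ {k} {ρ σ : List (Vec (Fin n) (suc k))} → Star (Commutation w) ρ σ →
      Admissible ρ →
                            Admissible σ × Reversals ρ ≐ Reversals σ
  commutations-admissible ε adm = adm , id , id
  commutations-admissible (c ◅ cs) adm =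
    let adm₁ , p , q = commutation-admissible c adm
        adm₂ , r , s = commutations-admissible cs adm₁ in
    adm₂ , r ∘ p , q ∘ s

  -- Two admissible orders whose reversal sets differ by one element

  module AdjacentReversals {k} {ρ σ : List (Vec (Fin n) (suc k))} (ρ-adm : Admissible ρ)
      (σ-adm : Admissible σ)
                           {X} (cX : Chain X) (X∉ : ¬ Reversals ρ X)
                               (σ≐ : Reversals σ ≐ Reversals ρ ∪ ｛ X ｝) where
    private
      module ρ = Admissible ρ-adm
      module σ = Admissible σ-adm
      open DecMembership (_≟ᵛ_ {n} {suc k}) using (_∈?_)

      P : Pred (Vec (Fin n) (suc k)) 0ℓ
      P V = V ∈ antilex X

      -- The elements that have to stay above the packet once it is made contiguous.
      Above : Pred (Vec (Fin n) (suc k)) 0ℓ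
      Above V = Any (λ U → Before U V ρ × Before U V σ) (antilex X)

      above? : Decidable Above
      above? V = Any.any? (λ U → before? _≟ᵛ_ U V ρ ×-dec before? _≟ᵛ_ U V σ) (antilex X)

      low? : Decidable (λ V → ¬ P V × ¬ Above V)
      low? V = ¬? (V ∈? antilex X) ×-dec ¬? (above? V)

      high? : Decidable (λ V → ¬ P V × Above V)
      high? V = ¬? (V ∈? antilex X) ×-dec above? V

      lows = filter low? ρ
      highs = filter high? ρ
      τ = lows ++ lex X ++ highs

      ρ-lex : Lex ρ X
      ρ-lex = ¬reversal⇒lex ρ-adm cX X∉

      σ-antilex : Antilex σ X
      σ-antilex = proj₂ (proj₂ σ≐ (inj₂ refl))

      lex⇒ρ : ∀ {U V} → Before U V (lex X) → Before U V ρ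
      lex⇒ρ b = case before-lex⁻ X b of λ { (i , j , i<j , refl , refl) → lex-before ρ-lex i<j }

      packet-reversed : ∀ {U V} → P U → P V → Before U V ρ → ¬ Before U V σ
      packet-reversed U∈ V∈ b b′ with ∈-tabulate⁻ {f = removeAt X} U∈ | ∈-tabulate⁻ {f =
          removeAt X} V∈
      ... | i , refl | j , refl with Fin.<-cmp i j
      ...   | tri< i<j _ _ = before-asym ρ.unique b (lex-before ρ-lex i<j)
      ...   | tri≈ _ refl _ = before-irrefl ρ.unique b
      ...   | tri> _ _ j<i = before-asym σ.unique b′ (antilex-before σ-antilex j<i)

      same-or-commute : ∀ {U V} → Before U V ρ → ¬ (P U × P V) → Before U V σ ⊎ Commute w U V
      same-or-commute {U} {V} b ¬P = same-order-or-commute ρ-adm σ-adm b same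
        where
        same : ∀ Z {i j} → Chain Z → U ≡ removeAt Z i → V ≡ removeAt Z j →
               (Antilex ρ Z → Antilex σ Z) × (Antilex σ Z → Antilex ρ Z)
        same Z {i} {j} cZ refl refl =
          (λ a → proj₂ (proj₂ σ≐ (inj₁ (cZ , a)))) ,
          (λ a → case proj₁ σ≐ (cZ , a) of λ where
            (inj₁ (_ , a′)) → a′
            (inj₂ refl) → contradiction (∈-tabulate⁺ {f = removeAt Z} i ,
                ∈-tabulate⁺ {f = removeAt Z} j) ¬P)

      low⁻ : ∀ {V} → V ∈ lows → ¬ P V × ¬ Above V
      low⁻ V∈ = proj₂ (∈-filter⁻ low? {xs = ρ} V∈)

      high⁻ : ∀ {V} → V ∈ highs → ¬ P V × Above V
      high⁻ V∈ = proj₂ (∈-filter⁻ high? {xs = ρ} V∈)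

      lex∈P : ∀ {V} → V ∈ lex X → P V
      lex∈P = Any.reverse⁻

      -- The packet keeps its order in `τ`, so an inverted pair is not contained in it; it commutes
      -- unless `σ` also has `U` before `V`. In that case a low `V` would lie above the packet
      -- because of `U`, or a packet element `V` would follow a high `U` and hence some packet
      -- element in both orders, although `σ` reverses the packet.
      inverted : ∀ {U V} → Before U V ρ → Before V U τ → Commute w U V
      inverted b c with before-++⁻ lows c
      ... | inj₁ c′ = contradiction (before-filter⁻ low? ρ c′) (before-asym ρ.unique b)
      ... | inj₂ (inj₁ (V∈ , U∈))
          with same-or-commute b (λ (_ , pV) → proj₁ (low⁻ V∈) pV) | ∈-++⁻ (lex X) U∈
      ...   | inj₂ com | _ = com
      ...   | inj₁ b′ | inj₁ U∈lex = contradiction (lose (lex∈P U∈lex) (b , b′)) (proj₂ (low⁻ V∈))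
      ...   | inj₁ b′ | inj₂ U∈highs = contradiction
              (Any.map (λ (e , e′) → before-trans ρ.unique e b , before-trans σ.unique e′ b′)
                  (proj₂ (high⁻ U∈highs)))
              (proj₂ (low⁻ V∈))
      inverted b c | inj₂ (inj₂ c′) with before-++⁻ (lex X) c′
      ... | inj₁ c″ = contradiction (lex⇒ρ c″) (before-asym ρ.unique b)
      ... | inj₂ (inj₂ c″) = contradiction (before-filter⁻ high? ρ c″) (before-asym ρ.unique b)
      ... | inj₂ (inj₁ (V∈ , U∈)) with same-or-commute b (λ (pU , _) → proj₁ (high⁻ U∈) pU)
      ...   | inj₂ com = com
      ...   | inj₁ b′ with find (proj₂ (high⁻ U∈))
      ...     | W , W∈ , e , e′ = contradiction (before-trans σ.unique e′ b′)
                (packet-reversed W∈ (lex∈P V∈) (before-trans ρ.unique e b))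

      τ! : Unique τ
      τ! = unique-before irr
        where
        irr : ∀ {V} → ¬ Before V V τ
        irr b with before-++⁻ lows b
        ... | inj₁ b′ = before-irrefl ρ.unique (before-filter⁻ low? ρ b′)
        ... | inj₂ (inj₁ (V∈ , V∈′)) = [ (λ V∈lex → proj₁ (low⁻ V∈) (lex∈P V∈lex)) ,
                                         (λ V∈highs → proj₂ (low⁻ V∈) (proj₂ (high⁻ V∈highs))) ]′
                                             (∈-++⁻ (lex X) V∈′)
        ... | inj₂ (inj₂ b′) with before-++⁻ (lex X) b′
        ...   | inj₁ b″ = before-irrefl (lex-unique cX) b″
        ...   | inj₂ (inj₁ (V∈ , V∈′)) = proj₁ (high⁻ V∈′) (lex∈P V∈)
        ...   | inj₂ (inj₂ b″) = before-irrefl ρ.unique (before-filter⁻ high? ρ b″)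

      ρ⊆τ : ∀ {V} → V ∈ ρ → V ∈ τ
      ρ⊆τ {V} V∈ with V ∈? antilex X | above? V
      ... | yes p | _     = ∈-++⁺ʳ lows (∈-++⁺ˡ (Any.reverse⁺ p))
      ... | no ¬p | yes u = ∈-++⁺ʳ lows (∈-++⁺ʳ (lex X) (∈-filter⁺ high? V∈ (¬p , u)))
      ... | no ¬p | no ¬u = ∈-++⁺ˡ (∈-filter⁺ low? V∈ (¬p , ¬u))

      τ⊆ρ : ∀ {V} → V ∈ τ → V ∈ ρ
      τ⊆ρ V∈ with ∈-++⁻ lows V∈
      ... | inj₁ V∈lows = proj₁ (∈-filter⁻ low? V∈lows)
      ... | inj₂ V∈′ with ∈-++⁻ (lex X) V∈′
      ...   | inj₂ V∈highs = proj₁ (∈-filter⁻ high? V∈highs)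
      ...   | inj₁ V∈lex = case ∈-lex⁻ X V∈lex of λ { (i , refl) → ρ.face-∈ cX i }

    contiguous : Star (Commutation w) ρ τ
    contiguous = Star.map swap⇒commutation (sort τ ρ.unique τ! ρ⊆τ τ⊆ρ inverted)

    flipped : Star (λ τ υ → Commutation w τ υ ⊎ PacketFlip w τ υ) ρ σ
    flipped =
      let τ-adm , ρ⊆ , ⊆ρ = commutations-admissible contiguous ρ-adm
          υ-adm , _ , υ⊆ , ⊆υ = flip-admissible lows X highs cX τ-adm in
      Star.map inj₁ contiguous ◅◅ inj₂ (flip lows X highs (chain⇒inv cX)) ◅
      Star.map inj₁ (same-reversals⇒commutations υ-adm σ-adm
        ( (λ r → proj₂ σ≐ (Sum.map₁ ⊆ρ (υ⊆ r))) , (λ r → ⊆υ (Sum.map₁ ρ⊆ (proj₁ σ≐ r))) ))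

  -- The edges of `U` comprise the permanent steps and the prescribed order of every packet, so a
  -- list without backward edges has all required properties. The increasing universe is extremal
  -- for parity zero.
  consistent⇒admissible : ∀ {k} {U : Pred (Vec (Fin n) (suc (suc k))) 0ℓ} → Con U → U ⊆ Chain →
                          ∃ λ ρ → Admissible ρ × Reversals ρ ≐ U
  consistent⇒admissible {k} {U} con U⊆ = S.list , adm ,
    (λ {Z} (cZ , a) → decidable-stable (dec Z) λ ¬u →
      lex-antilex-disjoint (Admissible.unique adm) (¬u⇒lex cZ ¬u) a) ,
    (λ u → U⊆ u , u⇒antilex (U⊆ u) u)
    where
    open Consistent con using (dec)
    univ-extremal : AllPairs (Extremal 0) univ
    univ-extremal = AllPairs.tabulate⁺-< <⇒≺⊎◁
    module S = Sorted (consistent⇒sorted 0 (List.length univ) univ ℕ.≤-refl univ-extremal con)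

    sorted-before : ∀ {X Y} → Chain X → Chain Y → X ≢ Y → Edge U X Y → Before X Y S.list
    sorted-before cX cY X≢Y e with before-total (S.complete (chain⇒∈ᶜ cX))
        (S.complete (chain⇒∈ᶜ cY)) X≢Y
    ... | inj₁ b = b
    ... | inj₂ b = contradiction e (proj₂ (allPairs⇒before S.sorted b))

    face-before : ∀ {Z} → Chain Z → ∀ {i j} → i ≢ j → Edge U (removeAt Z i) (removeAt Z j) →
                  Before (removeAt Z i) (removeAt Z j) S.list
    face-before cZ i≢j = sorted-before (allPairs-removeAt cZ _) (allPairs-removeAt cZ _)
        (i≢j ∘ removeAt-injective cZ)

    u⇒antilex : ∀ {Z} → Chain Z → U Z → Antilex S.list Z
    u⇒antilex {Z} cZ u = mkAntilex λ i<j → face-before cZ (Fin.<⇒≢ i<j)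
        (antilexᵉ Z cZ i<j u refl refl)

    ¬u⇒lex : ∀ {Z} → Chain Z → ¬ U Z → Lex S.list Z
    ¬u⇒lex {Z} cZ ¬u = mkLex λ i<j → face-before cZ (Fin.<⇒≢ i<j ∘ sym) (lexᵉ Z cZ i<j ¬u refl refl)

    adm : Admissible S.list
    adm = record
      { unique = AllPairs.map proj₁ S.sorted
      ; sound = λ X∈ → proj₁ (All.lookup S.sound X∈)
      ; complete = λ cX → S.complete (chain⇒∈ᶜ cX)
      ; no-back = λ b s → proj₂ (allPairs⇒before S.sorted b) (step s)
      ; packets = λ {Z} cZ → case dec Z of
          λ { (yes u) → inj₂ (u⇒antilex cZ u) ; (no ¬u) → inj₁ (¬u⇒lex cZ ¬u) } }

  -- The poset of consistent sets

  private module M = Chains (mirror (orders w))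

  -- Reversing `◁` amounts to a shift of the parity by one, so all steps change direction.
  mirror-side : ∀ t {x y} → Side (suc t) x y → M.Side t x y
  mirror-side zero    r = r
  mirror-side (suc t) r = mirror-side t r

  mirror-side⁻ : ∀ t {x y} → M.Side t x y → Side (suc t) x y
  mirror-side⁻ zero    r = r
  mirror-side⁻ (suc t) r = mirror-side⁻ t r

  mirror-step : ∀ {k} {X Y : Vec (Fin n) k} → Step X Y → M.Step Y X
  mirror-step {suc k} (here r) = M.here (mirror-side k r)
  mirror-step (there s) = M.there (mirror-step s)

  mirror-step⁻ : ∀ {k} {X Y : Vec (Fin n) k} → M.Step X Y → Step Y X
  mirror-step⁻ {suc k} (M.here r) = here (mirror-side⁻ k r)
  mirror-step⁻ (M.there s) = there (mirror-step⁻ s)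

  -- For even `d` the natural order works. For odd `d` the letters of `w` are listed from last to
  -- first: a letter stands in `w` behind all letters listed after it, so it forms an inversion with
  -- a larger one, while a smaller one is `◁` it.
  extremal-universe : ∀ d → ∃ λ as → (∀ x → x ∈ as) × AllPairs (Extremal d) as
  extremal-universe zero = univ , ∈-allFin , AllPairs.tabulate⁺-< <⇒≺⊎◁
  extremal-universe (suc zero) = List.tabulate f , complete , AllPairs.tabulate⁺-< extremal
    where
    f : Fin n → Fin n
    f i = w ⟨$⟩ʳ Fin.opposite i
    complete : ∀ x → x ∈ List.tabulate f
    complete x = subst (_∈ List.tabulate f)
      (trans (cong (w ⟨$⟩ʳ_) (Fin.opposite-involutive (w ⟨$⟩ˡ x))) (inverseʳ w))
      (∈-tabulate⁺ {f = f} (Fin.opposite (w ⟨$⟩ˡ x)))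
    later : ∀ {i j} → i Fin.< j → (w ⟨$⟩ˡ f j) Fin.< (w ⟨$⟩ˡ f i)
    later {i} {j} i<j
      rewrite inverseˡ w {Fin.opposite i} | inverseˡ w {Fin.opposite j} | Fin.opposite-prop i | Fin.opposite-prop j =
      ℕ.∸-monoʳ-< (s<s i<j) (Fin.toℕ<n j)
    extremal : ∀ {i j} → i Fin.< j → Extremal 1 (f i) (f j)
    extremal {i} {j} i<j with Fin.<-cmp (f i) (f j)
    ... | tri< fi<fj _ _ = inj₁ (fi<fj , later i<j)
    ... | tri≈ _ eq _    = contradiction (cong (w ⟨$⟩ˡ_) (sym eq)) (Fin.<⇒≢ (later i<j))
    ... | tri> _ _ fj<fi = inj₂ (fj<fi , later i<j)
  extremal-universe (suc (suc d)) = extremal-universe d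

  module _ {k} (R : ConsistentSet w (suc k)) where
    open ConsistentSet R using (decidable)

    removable-set : (∀ {X} → ¬ set R X) ⊎ ∃₂ λ X V → Adds X V R
    removable-set with extremal-universe (suc k)
    ... | as , ∈as , ext with removable as ext (consistent-⊆ (λ {x} _ → ∈-allFin x) (set-con R))
    ...   | inj₁ empty = inj₁ λ r → empty (set-chain R r , VAll.universal ∈as _) r
    ...   | inj₂ (X , (cX , _) , rX , con) = inj₂
            ( X , consistentSet (set R without X) (set-chain R ∘ proj₁)
                (consistent-⊆ (λ {x} _ → ∈as x) con)
            , proj₁
            , (λ {Y} (rY , ¬rY) → sym (decidable-stable (Y ≟ᶜ X) (λ Y≢X → ¬rY (rY , Y≢X))))
            , (λ { refl → rX , λ (_ , X≢X) → X≢X refl }) )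

    private
      Complement : Pred (Vec (Fin n) (suc k)) 0ℓ
      Complement X = Chain X × ¬ set R X

      complement-con : M.Consistent univ Complement
      complement-con = record
        { dec = λ X → chain? X ×-dec ¬? (decidable X)
        ; lower = λ X∈ Y∈ s (_ , ¬rY) → proj₁ X∈ , λ rX → ¬rY (con.lower Y∈ X∈ (mirror-step⁻ s) rX)
        ; convex = λ Z {i} {j} Z∈ i<j j<l (_ , ¬rI) (_ , ¬rL) →
            allPairs-removeAt (proj₁ Z∈) j , con.coconvex Z Z∈ i<j j<l ¬rI ¬rL
        ; coconvex = λ Z {i} {j} {l} Z∈ i<j j<l ¬I ¬L (_ , ¬rJ) → ¬rJ (con.convex Z Z∈ i<j j<l
            (decidable-stable (decidable _) (λ ¬rI → ¬I (allPairs-removeAt (proj₁ Z∈) i , ¬rI)))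
            (decidable-stable (decidable _) (λ ¬rL → ¬L (allPairs-removeAt (proj₁ Z∈) l , ¬rL)))) }
        where module con = Consistent (set-con R)

      insert-con : ∀ {X} → Chain X → M.Consistent univ (Complement M.without X) →
                   Con (λ Y → set R Y ⊎ Y ≡ X)
      insert-con {X} cX con = record
        { dec = V?
        ; lower = λ {Y} {Y′} Y∈ Y′∈ s vY′ → decidable-stable (V? Y) λ ¬vY →
            outside vY′ (con.lower Y′∈ Y∈ (mirror-step s) (inside (proj₁ Y∈) ¬vY))
        ; convex = λ Z {i} {j} {l} Z∈ i<j j<l vI vL → decidable-stable (V? _) λ ¬vJ →
            con.coconvex Z Z∈ i<j j<l (outside vI) (outside vL)
                (inside (allPairs-removeAt (proj₁ Z∈) j) ¬vJ)
        ; coconvex = λ Z {i} {j} {l} Z∈ i<j j<l ¬vI ¬vL vJ → outside vJ (con.convex Z Z∈ i<j j<l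
            (inside (allPairs-removeAt (proj₁ Z∈) i) ¬vI)
                (inside (allPairs-removeAt (proj₁ Z∈) l) ¬vL)) }
        where
        module con = M.Consistent con
        V? : Decidable (λ Y → set R Y ⊎ Y ≡ X)
        V? Y = decidable Y ⊎-dec (Y ≟ᶜ X)
        outside : ∀ {Y} → set R Y ⊎ Y ≡ X → ¬ (Complement M.without X) Y
        outside (inj₁ rY) ((_ , ¬rY) , _) = ¬rY rY
        outside (inj₂ eq) (_ , Y≢X)       = Y≢X eq
        inside : ∀ {Y} → Chain Y → ¬ (set R Y ⊎ Y ≡ X) → (Complement M.without X) Y
        inside cY ¬v = (cY , ¬v ∘ inj₁) , ¬v ∘ inj₂

    -- The complement is consistent for the mirrored orders, and an element removable from it is
    -- addable to `R`. The mirror shifts the parity, so the universe is taken for `k` and not for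
    -- `suc k` as in `removable-set`.
    addable-set : (∀ {X} → Chain X → set R X) ⊎ ∃₂ λ X V → Adds X R V
    addable-set with extremal-universe k
    ... | as , ∈as , ext with M.removable as (AllPairs.map (Sum.map₂ (mirror-side (suc k))) ext)
                                (M.consistent-⊆ (λ {x} _ → ∈-allFin x) complement-con)
    ...   | inj₁ full = inj₁ λ {X} cX → decidable-stable (decidable X) λ ¬r →
              full (cX , VAll.universal ∈as _) (cX , ¬r)
    ...   | inj₂ (X , (cX , _) , (_ , ¬rX) , con) = inj₂
            ( X , consistentSet (λ Y → set R Y ⊎ Y ≡ X) [ set-chain R , (λ { refl → cX }) ]′
                    (insert-con cX (M.consistent-⊆ (λ {x} _ → ∈as x) con))
            , inj₁
            , (λ { (inj₁ rY , ¬rY) → contradiction rY ¬rY ; (inj₂ refl , _) → refl })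
            , (λ { refl → inj₂ refl , ¬rX }) )

  empty-con : ∀ {k} → Con {k} (λ _ → ⊥)
  empty-con = record
    { dec = λ _ → no id
    ; lower = λ _ _ _ ()
    ; convex = λ _ _ _ _ ()
    ; coconvex = λ _ _ _ _ _ _ () }

  -- Any sorted list enumerates all chains once; the empty set is one consistent set to sort along.
  chain-enumeration : ∀ m → ∃ λ (Xs : List (Vec (Fin n) m)) → Unique Xs × (∀ {X} → Chain X → X ∈ Xs)
  chain-enumeration m = S.list , AllPairs.map proj₁ S.sorted , (λ cX → S.complete (chain⇒∈ᶜ cX))
    where
    module S = Sorted (consistent⇒sorted 0 (List.length univ) univ ℕ.≤-refl
      (AllPairs.tabulate⁺-< <⇒≺⊎◁) (empty-con {m}))

  module _ {m : ℕ} where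
    private
      Xs = proj₁ (chain-enumeration m)
      Xs! = proj₁ (proj₂ (chain-enumeration m))
      ∈Xs = λ {X} → proj₂ (proj₂ (chain-enumeration m)) {X}

    size : ConsistentSet w m → ℕ
    size R = count (ConsistentSet.decidable R) Xs

    size-⊆ : ∀ {R S : ConsistentSet w m} → set R ⊆ set S → size R ℕ.≤ size S
    size-⊆ {R} {S} R⊆S = count-⊆ (ConsistentSet.decidable R) (ConsistentSet.decidable S) Xs
        (λ _ → R⊆S)

    size-cong : ∀ {R S : ConsistentSet w m} → R ≈ᶜ S → size R ≡ size S
    size-cong {R} {S} (p , q) = ℕ.≤-antisym (size-⊆ {R} {S} p) (size-⊆ {S} {R} q)

    size-adds : ∀ {X} {R S : ConsistentSet w m} → Adds X R S → size S ≡ suc (size R)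
    size-adds {X} {R} {S} (R⊆S , only , new) = count-insert (ConsistentSet.decidable R)
        (ConsistentSet.decidable S)
      Xs! (∈Xs (set-chain S (proj₁ (new refl)))) (proj₂ (new refl)) (proj₁ (new refl)) R⊆S
      (λ {Y} Y≢X sY → decidable-stable (ConsistentSet.decidable R Y) λ ¬rY →
          Y≢X (sym (only (sY , ¬rY))))

    ≈ᶜ-isEquivalence : IsEquivalence (_≈ᶜ_ {m = m} {w = w})
    ≈ᶜ-isEquivalence = record
      { refl = id , id
      ; sym = λ (p , q) → q , p
      ; trans = λ (p , q) (r , s) → (λ x → r (p x)) , (λ x → q (s x)) }

    adds-respˡ : ∀ {X} {R R′ S : ConsistentSet w m} → R ≈ᶜ R′ → Adds X R S → Adds X R′ S
    adds-respˡ (p , q) (R⊆S , only , new) =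
      (λ r → R⊆S (q r)) , (λ (s , ¬r′) → only (s , λ r → ¬r′ (p r))) ,
          (λ eq → let s , ¬r = new eq in s , λ r′ → ¬r (q r′))

    adds-respʳ : ∀ {X} {R S S′ : ConsistentSet w m} → S ≈ᶜ S′ → Adds X R S → Adds X R S′
    adds-respʳ (p , q) (R⊆S , only , new) =
      (λ r → p (R⊆S r)) , (λ (s′ , ¬r) → only (q s′ , ¬r)) ,
          (λ eq → let s , ¬r = new eq in p s , ¬r)

    adds⇒≤ : ∀ {X} {R S : ConsistentSet w m} → Adds X R S → R ≤ᶜ S
    adds⇒≤ {S = S} add = S , (_ , add) ◅ ε , id , id

    ≈⇒≤ : ∀ {R S : ConsistentSet w m} → R ≈ᶜ S → R ≤ᶜ S
    ≈⇒≤ {R} R≈S = R , ε , R≈S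

    ≤⇒≈⊎adds : ∀ {R S : ConsistentSet w m} → R ≤ᶜ S → R ≈ᶜ S ⊎ ∃₂ λ X V → Adds X R V × V ≤ᶜ S
    ≤⇒≈⊎adds (T , ε , T≈S) = inj₁ T≈S
    ≤⇒≈⊎adds (T , (X , add) ◅ adds , T≈S) = inj₂ (X , _ , add , T , adds , T≈S)

    ≤-respˡ : ∀ {R R′ S : ConsistentSet w m} → R ≈ᶜ R′ → R ≤ᶜ S → R′ ≤ᶜ S
    ≤-respˡ {R′ = R′} (p , q) (T , ε , r , s) = R′ , ε , (λ x → r (q x)) , (λ x → p (s x))
    ≤-respˡ {R} {R′} R≈R′ (T , _◅_ {j = V} (X , add) adds , T≈S) =
      T , (X , adds-respˡ {R = R} {R′} {V} R≈R′ add) ◅ adds , T≈S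

    ≤-trans : ∀ {R S T : ConsistentSet w m} → R ≤ᶜ S → S ≤ᶜ T → R ≤ᶜ T
    ≤-trans {S = S} {T} (U , adds , p , q) S≤T =
      let V , adds′ , V≈T = ≤-respˡ {S} {U} {T} (q , p) S≤T in V , adds ◅◅ adds′ , V≈T

    ≤⇒⊆ : ∀ {R S : ConsistentSet w m} → R ≤ᶜ S → set R ⊆ set S
    ≤⇒⊆ (T , adds , p , _) r = p (mono adds r)
      where
      mono : ∀ {R T : ConsistentSet w m} → Star (λ U V → ∃ λ X → Adds X U V) R T → set R ⊆ set T
      mono ε r = r
      mono ((_ , R⊆V , _) ◅ adds) r = mono adds (R⊆V r)

    ≤ᶜ-isPartialOrder : IsPartialOrder (_≈ᶜ_ {m = m} {w = w}) _≤ᶜ_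
    ≤ᶜ-isPartialOrder = record
      { isPreorder = record
        { isEquivalence = ≈ᶜ-isEquivalence
        ; reflexive = λ {R} {S} → ≈⇒≤ {R} {S}
        ; trans = λ {R} {S} {T} → ≤-trans {R} {S} {T} }
      ; antisym = λ {R} {S} R≤S S≤R → ≤⇒⊆ {R} {S} R≤S , ≤⇒⊆ {S} {R} S≤R }

    open ToStrict (_≈ᶜ_ {m = m} {w = w}) _≤ᶜ_ public using () renaming (_<_ to _<ᶜ_)

    <⇒adds : ∀ {R S : ConsistentSet w m} → R <ᶜ S → ∃₂ λ X V → Adds X R V × V ≤ᶜ S
    <⇒adds {R} {S} (R≤S , R≉S) = [ (λ R≈S → contradiction R≈S R≉S) , id ]′ (≤⇒≈⊎adds {R} {S} R≤S)

    size-< : ∀ {R S : ConsistentSet w m} → R <ᶜ S → size R ℕ.< size S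
    size-< {R} {S} R<S = let X , V , add , V≤S = <⇒adds {R} {S} R<S in
      ℕ.≤-trans (ℕ.≤-reflexive (sym (size-adds {X} {R} {V} add))) (size-⊆ {V} {S} (≤⇒⊆ {V} {S} V≤S))

    adds⇒< : ∀ {X} {R S : ConsistentSet w m} → Adds X R S → R <ᶜ S
    adds⇒< {X} {R} {S} add = adds⇒≤ {X} {R} {S} add , λ R≈S →
      ℕ.1+n≢n (trans (sym (size-adds {X} {R} {S} add)) (sym (size-cong {R} {S} R≈S)))

    -- The first set reached by adding one element to `R` is `S` itself, as it would otherwise lie
    -- strictly between.
    covers⇒size : ∀ {R S : ConsistentSet w m} → Covers _≈ᶜ_ _≤ᶜ_ S R → size S ≡ suc (size R)
    covers⇒size {R} {S} (R<S , nothing-between) with <⇒adds {R} {S} R<S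
    ... | X , V , add , V≤S with ≤⇒≈⊎adds {V} {S} V≤S
    ...   | inj₁ V≈S = trans (sym (size-cong {V} {S} V≈S)) (size-adds {X} {R} {V} add)
    ...   | inj₂ (Y , U , add′ , U≤S) = contradiction
            (V , adds⇒< {X} {R} {V} add , V≤S , λ V≈S → ℕ.<-irrefl (size-cong {V} {S} V≈S)
              (ℕ.≤-trans (ℕ.≤-reflexive (sym (size-adds {Y} {V} {U} add′)))
                  (size-⊆ {U} {S} (≤⇒⊆ {U} {S} U≤S))))
            nothing-between

  module _ {k : ℕ} where
    private
      C = ConsistentSet w (suc k)
      _≈_ = _≈ᶜ_ {m = suc k} {w = w}
      _≼_ = _≤ᶜ_ {m = suc k} {w = w}

    bottom : C
    bottom = consistentSet (λ _ → ⊥) (λ ()) empty-con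

    top : C
    top = consistentSet Chain id record
      { dec = chain?
      ; lower = λ X∈ _ _ _ → proj₁ X∈
      ; convex = λ Z {i} {j} Z∈ _ _ _ _ → allPairs-removeAt (proj₁ Z∈) j
      ; coconvex = λ Z {i} Z∈ _ _ ¬cI _ → contradiction (allPairs-removeAt (proj₁ Z∈) i) ¬cI }

    -- Elements are removed one at a time until nothing is left; the size bounds the number of
    -- rounds. Dually, `≤-top` adds elements and counts the missing ones.
    bottom-≤ : ∀ (R : C) → bottom ≼ R
    bottom-≤ R = below (size R) R ℕ.≤-refl
      where
      below : ∀ N (R : C) → size R ℕ.≤ N → bottom ≼ R
      below N R len with removable-set R
      ... | inj₁ empty = ≈⇒≤ {R = bottom} {R} ((λ ()) , empty)
      below zero R len | inj₂ (X , V , add) with () ← ℕ.≤-trans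
          (ℕ.≤-reflexive (sym (size-adds {X = X} {V} {R} add))) len
      below (suc N) R len | inj₂ (X , V , add) = ≤-trans {R = bottom} {V} {R}
        (below N V (ℕ.s≤s⁻¹ (ℕ.≤-trans (ℕ.≤-reflexive (sym (size-adds {X = X} {V} {R} add))) len)))
        (adds⇒≤ {X = X} {V} {R} add)

    ≤-top : ∀ (R : C) → R ≼ top
    ≤-top R = above (size top ∸ size R) R ℕ.≤-refl
      where
      above : ∀ N (R : C) → size top ∸ size R ℕ.≤ N → R ≼ top
      above N R len with addable-set R
      ... | inj₁ full = ≈⇒≤ {R = R} {top} (set-chain R , full)
      ... | inj₂ (X , V , add) with
              ℕ.≤-trans (ℕ.≤-reflexive (sym (size-adds {X = X} {R} {V} add)))
                  (size-⊆ {R = V} {top} (set-chain V))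
      above zero R len | inj₂ (X , V , add) | R<top =
        contradiction R<top (ℕ.≤⇒≯ (ℕ.m∸n≡0⇒m≤n (ℕ.n≤0⇒n≡0 len)))
      above (suc N) R len | inj₂ (X , V , add) | R<top = ≤-trans {R = R} {V} {top}
          (adds⇒≤ {X = X} {R} {V} add)
        (above N V (ℕ.≤-trans (ℕ.≤-reflexive (cong (size top ∸_) (size-adds {X = X} {R} {V} add)))
          (ℕ.s≤s⁻¹ (ℕ.≤-trans (ℕ.∸-monoʳ-< (ℕ.n<1+n (size R)) R<top) len))))

    bottom-uniqueMinimal : IsUniqueMinimal _≈_ _≼_ bottom
    bottom-uniqueMinimal =
      (λ R R≤ → ≤⇒⊆ {R = R} {bottom} R≤ , λ ()) ,
      (λ R min → let p , q = min bottom (bottom-≤ R) in q , p)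

    top-uniqueMaximal : IsUniqueMaximal _≈_ _≼_ top
    top-uniqueMaximal =
      (λ R ≤R → ≤⇒⊆ {R = top} {R} ≤R , set-chain R) ,
      (λ R max → max top (≤-top R))

    ≤ᶜ-isRanked : IsRanked _≈_ _≼_
    ≤ᶜ-isRanked = record
      { rank = size
      ; rank-cong = λ {R} {S} → size-cong {R = R} {S}
      ; rank-minimal = λ {R} min → trans
          (sym (size-cong {R = bottom} {R} (min bottom (bottom-≤ R))))
          (count-none (ConsistentSet.decidable bottom) (proj₁ (chain-enumeration (suc k))) (λ ()))
      ; rank-mono = λ {R} {S} → size-< {R = R} {S}
      ; rank-cover = λ {R} {S} → covers⇒size {R = R} {S} }
      where
      count-none : ∀ {P : Pred (Vec (Fin n) (suc k)) 0ℓ} (P? : Decidable P) Xs → (∀ {X} → ¬ P X) →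
                   count P? Xs ≡ 0
      count-none P? Xs ¬p = cong List.length (List.filter-none P? (All.universal (λ _ → ¬p) Xs))

  -- The isomorphism between commutation classes and consistent sets

  module _ {k : ℕ} where
    private
      B = AdmissibleOrder w (suc k)
      C = ConsistentSet w (suc (suc k))
      _∼_ = _∼ᴮ_ {m = suc k} {w = w}
      _⊑_ = _≤ᴮ_ {m = suc k} {w = w}
      _≈_ = _≈ᶜ_ {m = suc (suc k)} {w = w}
      _≼_ = _≤ᶜ_ {m = suc (suc k)} {w = w}

    reversalSet : ∀ {ρ : List (Vec (Fin n) (suc k))} → Admissible ρ → C
    reversalSet {ρ} adm = consistentSet (Reversals ρ) proj₁ (reversals-con adm)

    rev : B → C
    rev ρ = reversalSet (admissible ρ)

    swap-commutation : ∀ {m} {ρ σ : List (Vec (Fin n) m)} → Commutation w ρ σ → Commutation w σ ρ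
    swap-commutation (swap xs ys (p , q , r)) =
        swap xs ys (q , p , λ (Z , inc , x , y) → r (Z , inc , y , x))

    ∼-isEquivalence : IsEquivalence _∼_
    ∼-isEquivalence = record { refl = ε ; sym = Star.reverse swap-commutation ; trans = _◅◅_ }

    moves-≤ : ∀ {ρ σ : List (Vec (Fin n) (suc k))} (ρ-adm : Admissible ρ) (σ-adm : Admissible σ) →
              Star (λ τ υ → Commutation w τ υ ⊎ PacketFlip w τ υ) ρ σ →
              reversalSet ρ-adm ≼ reversalSet σ-adm
    moves-≤ ρ-adm σ-adm ε = ≈⇒≤ {R = reversalSet ρ-adm} {reversalSet σ-adm} (id , id)
    moves-≤ ρ-adm σ-adm (inj₁ c ◅ ms) =
      let τ-adm , eq = commutation-admissible c ρ-adm in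
      ≤-trans {R = reversalSet ρ-adm} {reversalSet τ-adm} {reversalSet σ-adm}
        (≈⇒≤ {R = reversalSet ρ-adm} {reversalSet τ-adm} eq) (moves-≤ τ-adm σ-adm ms)
    moves-≤ ρ-adm σ-adm (inj₂ (flip xs X ys inv) ◅ ms) =
      let τ-adm , X∉ , τ⊆ , ⊆τ = flip-admissible xs X ys (inv⇒chain inv) ρ-adm in
      ≤-trans {R = reversalSet ρ-adm} {reversalSet τ-adm} {reversalSet σ-adm}
        (adds⇒≤ {X = X} {reversalSet ρ-adm} {reversalSet τ-adm}
          ( (λ r → ⊆τ (inj₁ r)) , (λ (r , r∉) → [ (λ r′ → contradiction r′ r∉) , id ]′ (τ⊆ r))
          , (λ { refl → ⊆τ (inj₂ refl) , X∉ })))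
        (moves-≤ τ-adm σ-adm ms)

    -- Each set in the chain of single additions is the reversal set of some order, and
    -- `AdjacentReversals` joins consecutive orders. Commutations lead from the last of them to `σ`.
    ≤-moves : ∀ {ρ σ : List (Vec (Fin n) (suc k))} (ρ-adm : Admissible ρ) (σ-adm : Admissible σ) →
              reversalSet ρ-adm ≼ reversalSet σ-adm →
              Star (λ τ υ → Commutation w τ υ ⊎ PacketFlip w τ υ) ρ σ
    ≤-moves ρ-adm σ-adm (T , adds , T≈σ) = go ρ-adm (id , id) adds
      where
      go : ∀ {ρ} (ρ-adm : Admissible ρ) {R : C} → reversalSet ρ-adm ≈ R →
           Star (λ U V → ∃ λ X → Adds X U V) R T →
           Star (λ τ υ → Commutation w τ υ ⊎ PacketFlip w τ υ) ρ _
      go ρ-adm (p , q) ε = Star.map inj₁ (same-reversals⇒commutations ρ-adm σ-adm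
        ((λ r → proj₁ T≈σ (p r)) , (λ r → q (proj₂ T≈σ r))))
      go ρ-adm {R} (p , q) (_◅_ {j = V} (X , R⊆V , only , new) adds) =
        let τ , τ-adm , τ⊆ , ⊆τ = consistent⇒admissible (set-con V) (set-chain V)
            vX , X∉R = new refl in
        AdjacentReversals.flipped ρ-adm τ-adm (set-chain V vX) (λ r → X∉R (p r))
          ( (λ {Y} r → case reversals-dec ρ-adm Y of λ where
              (yes r′) → inj₁ r′
              (no ¬r′) → inj₂ (only (τ⊆ r , λ rY → ¬r′ (q rY))))
          , [ (λ r → ⊆τ (R⊆V (p r))) , (λ { refl → ⊆τ vX }) ]′ )
        ◅◅ go τ-adm (τ⊆ , ⊆τ) adds

    ∼⇒≈ : ∀ {ρ σ : B} → ρ ∼ σ → rev ρ ≈ rev σ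
    ∼⇒≈ {ρ} ρ∼σ = proj₂ (commutations-admissible ρ∼σ (admissible ρ))

    rev-injective : ∀ {ρ σ : B} → rev ρ ≈ rev σ → ρ ∼ σ
    rev-injective {ρ} {σ} = same-reversals⇒commutations (admissible ρ) (admissible σ)

    rev-mono : ∀ {ρ σ : B} → ρ ⊑ σ → rev ρ ≼ rev σ
    rev-mono {ρ} {σ} = moves-≤ (admissible ρ) (admissible σ)

    ⊑-isPartialOrder : IsPartialOrder _∼_ _⊑_
    ⊑-isPartialOrder = record
      { isPreorder = record
        { isEquivalence = ∼-isEquivalence ; reflexive = Star.map inj₁ ; trans = _◅◅_ }
      -- Moves in both directions make the reversal sets equal, which leaves only commutations.
      ; antisym = λ {ρ} {σ} ρ≤σ σ≤ρ → rev-injective {ρ} {σ}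
          ( ≤⇒⊆ {R = rev ρ} {rev σ} (rev-mono {ρ} {σ} ρ≤σ)
          , ≤⇒⊆ {R = rev σ} {rev ρ} (rev-mono {σ} {ρ} σ≤ρ) ) }

    rev-surjective : ∀ (R : C) → ∃ λ (ρ : B) → rev ρ ≈ R
    rev-surjective R =
      let ρ , adm , eq = consistent⇒admissible (set-con R) (set-chain R) in admissibleOrder adm , eq

    rev-isOrderIsomorphism : IsOrderIsomorphism _∼_ _≈_ _⊑_ _≼_ rev
    rev-isOrderIsomorphism = record
      { isOrderMonomorphism = record
        { isOrderHomomorphism = record
          { cong = λ {ρ} {σ} → ∼⇒≈ {ρ} {σ}
          ; mono = λ {ρ} {σ} → rev-mono {ρ} {σ} }
        ; injective = λ {ρ} {σ} → rev-injective {ρ} {σ}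
        ; cancel = λ {ρ} {σ} → ≤-moves (admissible ρ) (admissible σ) }
      ; surjective = λ R → let ρ , p , q = rev-surjective R in
          ρ , λ {σ} σ∼ρ → let r , s = ∼⇒≈ {σ} {ρ} σ∼ρ in (λ x → p (r x)) , (λ x → s (q x)) }

  -- Maximal chains

  module _ {k : ℕ} where
    private
      C = ConsistentSet w (suc (suc k))

    increments-∉ : ∀ {R : C} {Rs Xs} → Increments R Rs Xs → ∀ {X} → X ∈ Xs → ¬ set R X
    increments-∉ ((_ , _ , new) ∷ inc) (here refl) rX = proj₂ (new refl) rX
    increments-∉ ((R⊆S , _) ∷ inc)     (there X∈) rX  = increments-∉ inc X∈ (R⊆S rX)

    increments-chain : ∀ {R : C} {Rs Xs} → Increments R Rs Xs → ∀ {X} → X ∈ Xs → Chain X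
    increments-chain (_∷_ {S = S} (_ , _ , new) inc) (here refl) = set-chain S (proj₁ (new refl))
    increments-chain (_ ∷ inc)             (there X∈)  = increments-chain inc X∈

    increments-unique : ∀ {R : C} {Rs Xs} → Increments R Rs Xs → Unique Xs
    increments-unique [] = []
    increments-unique ((_ , _ , new) ∷ inc) =
      All.tabulate (λ { Y∈ refl → increments-∉ inc Y∈ (proj₁ (new refl)) }) ∷ increments-unique inc

    -- `U` and `V` are the sets just before and just after `Y` is added.
    increments-at : ∀ {R : C} {Rs Xs} → Increments R Rs Xs → ∀ {Y} → Y ∈ Xs →
      ∃₂ λ (U V : C) → set R ⊆ set U × Adds Y U V ×
        (∀ {X} → Before X Y Xs → set U X) × (∀ {X} → Before Y X Xs → ¬ set V X)
    increments-at {R} (_∷_ {S = S} (R⊆S , only , new) inc) (here refl) =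
      R , S , id , (R⊆S , only , new) ,
      (λ { (here Y∈) → contradiction (proj₁ (new refl)) (increments-∉ inc Y∈)
         ; (there b) → contradiction (proj₁ (new refl)) (increments-∉ inc (before-∈ʳ b)) }) ,
      (λ { (here X∈) → increments-∉ inc X∈ ; (there b) → increments-∉ inc (before-∈ʳ b) })
    increments-at ((R⊆S , only , new) ∷ inc) (there Y∈) with increments-at inc Y∈
    ... | U , V , S⊆U , adds , earlier , later = U , V , (λ r → S⊆U (R⊆S r)) , adds ,
      (λ { (here _) → S⊆U (proj₁ (new refl)) ; (there b) → earlier b }) ,
      (λ { (here _) → contradiction (proj₁ (new refl)) (increments-∉ inc Y∈) ; (there b) →
          later b })

    module _ {R : C} {Rs Xs} (inc : Increments R Rs Xs) (R≐∅ : set R ≐ ∅)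
             (exhaustive : ∀ {X} → Chain X → set R X ⊎ X ∈ Xs) where
      private
        Xs! = increments-unique inc

        complete : ∀ {X} → Chain X → X ∈ Xs
        complete cX = [ (λ r → ⊥-elim (proj₁ R≐∅ r)) , id ]′ (exhaustive cX)

        module _ {Z : Vec (Fin n) (suc (suc (suc k)))} (cZ : Chain Z) where
          infix 4 _⊲_
          _⊲_ : Fin (suc (suc (suc k))) → Fin (suc (suc (suc k))) → Set
          i ⊲ j = Before (removeAt Z i) (removeAt Z j) Xs

          ⊲-total : ∀ {i j} → i Fin.< j → i ⊲ j ⊎ j ⊲ i
          ⊲-total {i} {j} i<j = before-total (complete (allPairs-removeAt cZ i))
              (complete (allPairs-removeAt cZ j))
            (Fin.<⇒≢ i<j ∘ removeAt-injective cZ)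

          -- The set just before the face `j` is added would contain faces on both sides of it but
          -- not the face itself.
          middle-not-last : ∀ {i j l} → i Fin.< j → j Fin.< l → i ⊲ j → ¬ l ⊲ j
          middle-not-last {i} {j} i<j j<l b c with increments-at inc
              (complete (allPairs-removeAt cZ j))
          ... | U , V , _ , (_ , _ , new) , earlier , _ = proj₂ (new refl)
                (Consistent.convex (set-con U) Z (chain⇒∈ᶜ cZ) i<j j<l (earlier b) (earlier c))

          -- The set just after the face `j` is added would contain it but no face on either side.
          middle-not-first : ∀ {i j l} → i Fin.< j → j Fin.< l → j ⊲ i → ¬ j ⊲ l
          middle-not-first {i} {j} i<j j<l b c with increments-at inc
              (complete (allPairs-removeAt cZ j))
          ... | U , V , _ , (_ , _ , new) , _ , later =
                Consistent.coconvex (set-con V) Z (chain⇒∈ᶜ cZ) i<j j<l (later b) (later c)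
                    (proj₁ (new refl))

          -- The direction propagates: if `i` precedes `j`, then `j` precedes every later `l`, since
          -- the middle face is not last.
          ascending : zero ⊲ suc zero → ∀ {i j} → i Fin.< j → i ⊲ j
          ascending 0⊲1 {i} {j} i<j = from i j i<j
            where
            next : ∀ {i j l} → i Fin.< j → j Fin.< l → i ⊲ j → j ⊲ l
            next i<j j<l b = [ id , (λ c → contradiction c (middle-not-last i<j j<l b)) ]′
                (⊲-total j<l)
            zero⊲ : ∀ j → zero ⊲ suc j
            zero⊲ zero    = 0⊲1
            zero⊲ (suc j) = before-trans Xs! 0⊲1 (next (s≤s z≤n) (s<s (s≤s z≤n)) 0⊲1)
            from : ∀ i j → i Fin.< j → i ⊲ j
            from zero    (suc j) _   = zero⊲ j
            from (suc i) (suc j) i<j = next (s≤s z≤n) i<j (zero⊲ i)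

          descending : suc zero ⊲ zero → ∀ {i j} → i Fin.< j → j ⊲ i
          descending 1⊲0 {i} {j} i<j = from i j i<j
            where
            next : ∀ {i j l} → i Fin.< j → j Fin.< l → j ⊲ i → l ⊲ j
            next i<j j<l b = [ (λ c → contradiction c (middle-not-first i<j j<l b)) , id ]′
                (⊲-total j<l)
            ⊲zero : ∀ j → suc j ⊲ zero
            ⊲zero zero    = 1⊲0
            ⊲zero (suc j) = before-trans Xs! (next (s≤s z≤n) (s<s (s≤s z≤n)) 1⊲0) 1⊲0
            from : ∀ i j → i Fin.< j → j ⊲ i
            from zero    (suc j) _   = ⊲zero j
            from (suc i) (suc j) i<j = next (s≤s z≤n) i<j (⊲zero i)

      increments-admissible : Admissible Xs
      increments-admissible = record
        { unique = Xs!
        ; sound = increments-chain inc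
        ; complete = complete
        -- The set just after `X` is added is a lower ideal, so it would already contain `Y`.
        ; no-back = λ {X} {Y} b s → case increments-at inc (before-∈ˡ b) of λ where
            (U , V , _ , (_ , _ , new) , _ , later) → later b
              (Consistent.lower (set-con V) (chain⇒∈ᶜ (increments-chain inc (before-∈ʳ b)))
                (chain⇒∈ᶜ (increments-chain inc (before-∈ˡ b))) s (proj₁ (new refl)))
        ; packets = λ cZ → case ⊲-total cZ {zero} {suc zero} (s≤s z≤n) of λ where
            (inj₁ 0⊲1) → inj₂ (mkAntilex (ascending cZ 0⊲1))
            (inj₂ 1⊲0) → inj₁ (mkLex (descending cZ 1⊲0)) }

      increments-linked : Linked _<ᶜ_ (R ∷ Rs)
      increments-linked = go inc
        where
        go : ∀ {R : C} {Rs Xs} → Increments R Rs Xs → Linked _<ᶜ_ (R ∷ Rs)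
        go [] = [-]
        go (_∷_ {R = R} {S} {X = X} add inc) = adds⇒< {X = X} {R} {S} add ∷ go inc

      -- The given chain attains every size from that of `R` to that of the full set. A member of a
      -- larger chain thus has the size of one of its sets, and sizes increase strictly along the
      -- larger chain.
      increments-maximal : ∀ ys → Linked _<ᶜ_ ys → Contained _≈ᶜ_ _≤ᶜ_ (R ∷ Rs) ys →
                           Contained _≈ᶜ_ _≤ᶜ_ ys (R ∷ Rs)
      increments-maximal ys ys-chain contained = All.tabulate λ {y} y∈ →
        let U , U∈ , U-size = find (same-size inc exhaustive y (size-⊆ {R = R} {y} (λ r → ⊥-elim (proj₁ R≐∅ r))))
            V , V∈ , p , q = find (All.lookup contained U∈) in
        lose U∈ (subst (_≈ᶜ U)
          (same-size⇒≡ V∈ y∈ (trans (size-cong {R = V} {U} (q , p)) U-size)) (q , p))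
        where
        sizes-increase : AllPairs (λ U V → size U ℕ.< size V) ys
        sizes-increase = Linked.Linked⇒AllPairs ℕ.<-trans
            (Linked.map (λ {U} {V} → size-< {R = U} {V}) ys-chain)

        same-size⇒≡ : ∀ {U V} → U ∈ ys → V ∈ ys → size U ≡ size V → U ≡ V
        same-size⇒≡ U∈ V∈ eq with ∈-AllPairs₂ sizes-increase U∈ V∈
        ... | inj₁ U≡V         = U≡V
        ... | inj₂ (inj₁ U<V) = contradiction U<V (ℕ.<-irrefl eq)
        ... | inj₂ (inj₂ V<U) = contradiction V<U (ℕ.<-irrefl (sym eq))

        same-size : ∀ {R : C} {Rs Xs} → Increments R Rs Xs → (∀ {X} → Chain X → set R X ⊎ X ∈ Xs) →
                    ∀ (y : C) → size R ℕ.≤ size y → Any (λ U → size U ≡ size y) (R ∷ Rs)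
        same-size {R} [] full y R≤y = here (ℕ.≤-antisym R≤y (size-⊆ {R = y} {R} λ yX →
          [ id , (λ ()) ]′ (full (set-chain y yX))))
        same-size {R} (_∷_ {S = S} {X = X} add inc) full y R≤y with size R ℕ.≟ size y
        ... | yes eq = here eq
        ... | no ≢   = there (same-size inc full′ y
                (ℕ.≤-trans (ℕ.≤-reflexive (size-adds {X = X} {R} {S} add)) (ℕ.≤∧≢⇒< R≤y ≢)))
          where
          full′ : ∀ {Y} → Chain Y → set S Y ⊎ Y ∈ _
          full′ cY with full cY
          ... | inj₁ r           = inj₁ (proj₁ add r)
          ... | inj₂ (here refl) = inj₁ (proj₁ (proj₂ (proj₂ add) refl))
          ... | inj₂ (there Y∈)  = inj₂ Y∈

    increments-cong : ∀ {R R′ : C} {Rs Rs′ Xs Xs′} → Increments R Rs Xs → Increments R′ Rs′ Xs′ →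
                      R ≈ᶜ R′ → Pointwise _≈ᶜ_ Rs Rs′ → Xs ≡ Xs′
    increments-cong [] [] _ [] = refl
    increments-cong ((_ , _ , new) ∷ inc) ((_ , only , _) ∷ inc′) (R⊆ , ⊆R) (S≈ ∷ Rs≈) =
      cong₂ _∷_ (sym (only (proj₁ S≈ (proj₁ (new refl)) , λ r′ → proj₂ (new refl) (⊆R r′))))
        (increments-cong inc inc′ S≈ Rs≈)

    increments-injective : ∀ {R R′ : C} {Rs Rs′ Xs} → Increments R Rs Xs → Increments R′ Rs′ Xs →
                           R ≈ᶜ R′ → Pointwise _≈ᶜ_ Rs Rs′
    increments-injective [] [] _ = []
    increments-injective (_∷_ {R = R} {S} {X = X} add inc) (_∷_ {R = R′} {S′} add′ inc′) R≈ =
      S≈ ∷ increments-injective inc inc′ S≈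
      where
      ⊆-adds : ∀ {R S R′ S′ : C} → Adds X R S → Adds X R′ S′ → set R ⊆ set R′ → set S ⊆ set S′
      ⊆-adds {R} (_ , only , _) (R′⊆S′ , _ , new) R⊆R′ {Y} s with ConsistentSet.decidable R Y
      ... | yes r = R′⊆S′ (R⊆R′ r)
      ... | no ¬r with refl ← only (s , ¬r) = proj₁ (new refl)
      S≈ : S ≈ᶜ S′
      S≈ = ⊆-adds {R} {S} {R′} {S′} add add′ (proj₁ R≈) , ⊆-adds {R′} {S′} {R} {S} add′ add
          (proj₂ R≈)

    -- Insertions in front of `R` are left out, so that the property passes to the tail of the
    -- chain.
    Saturated : C → List C → Set₁
    Saturated R Rs = ∀ Us Vs W → Rs ≡ Us ++ Vs → ¬ Linked _<ᶜ_ (R ∷ Us ++ W ∷ Vs)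

    -- The first single addition on the way from `R` to the next set must already reach that set,
    -- and an addable element of the last set would extend the chain.
    saturated⇒increments : ∀ {R : C} {Rs} → Linked _<ᶜ_ (R ∷ Rs) → Saturated R Rs →
                           ∃ λ Xs → Increments R Rs Xs × (∀ {X} → Chain X → set R X ⊎ X ∈ Xs)
    saturated⇒increments {R} {[]} [-] sat with addable-set R
    ... | inj₁ full = [] , [] , λ cX → inj₁ (full cX)
    ... | inj₂ (X , V , add) = contradiction (adds⇒< {X = X} {R} {V} add ∷ [-]) (sat [] [] V refl)
    saturated⇒increments {R} {S ∷ Rs} (R<S ∷ Rs-linked) sat with <⇒adds {R = R} {S} R<S
    ... | X , V , add , V≤S with ≤⇒≈⊎adds {R = V} {S} V≤S
    ...   | inj₂ (Y , U , add′ , U≤S) = contradiction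
            (adds⇒< {X = X} {R} {V} add ∷ (V≤S , V≉S) ∷ Rs-linked) (sat [] (S ∷ Rs) V refl)
      where
      V≉S : ¬ V ≈ᶜ S
      V≉S V≈S = ℕ.<-irrefl (size-cong {R = V} {S} V≈S)
        (ℕ.≤-trans (ℕ.≤-reflexive (sym (size-adds {X = Y} {V} {U} add′)))
            (size-⊆ {R = U} {S} (≤⇒⊆ {R = U} {S} U≤S)))
    ...   | inj₁ V≈S with saturated⇒increments Rs-linked
                            (λ { Us Vs W refl l → sat (S ∷ Us) Vs W refl (R<S ∷ l) })
    ...     | Xs , inc , full = X ∷ Xs , add′ ∷ inc , full′
      where
      add′ : Adds X R S
      add′ = adds-respʳ {X = X} {R} {V} {S} V≈S add
      full′ : ∀ {Y} → Chain Y → set R Y ⊎ Y ∈ X ∷ Xs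
      full′ {Y} cY with full cY | ConsistentSet.decidable R Y
      ... | inj₂ Y∈ | _     = inj₂ (there Y∈)
      ... | inj₁ _  | yes r = inj₁ r
      ... | inj₁ s  | no ¬r = inj₂ (here (sym (proj₁ (proj₂ add′) (s , ¬r))))

    -- By maximality `W` is equivalent to some set of the chain, but along the longer chain their
    -- sizes differ.
    no-insertion : ∀ (c : MaximalChainᶜ w (suc (suc k))) Us Vs (W : C) → chain c ≡ Us ++ Vs →
                   ¬ Linked _<ᶜ_ (Us ++ W ∷ Vs)
    no-insertion c Us Vs W eq l =
      let U , U∈ , W≈U = find (All.lookup (MaximalChain.maximal c (Us ++ W ∷ Vs) l contained) (∈-insert Us)) in
      [ (λ U∈Us → ℕ.<-irrefl (sym (size-cong {R = W} {U} W≈U))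
          (allPairs⇒before sizes-increase (before-++⁺ U∈Us (here refl))))
      , (λ U∈Vs → ℕ.<-irrefl (size-cong {R = W} {U} W≈U)
          (allPairs⇒before sizes-increase (before-++⁺ʳ Us (here U∈Vs)))) ]′
        (∈-++⁻ Us (subst (U ∈_) eq U∈))
      where
      sizes-increase : AllPairs (λ U V → size U ℕ.< size V) (Us ++ W ∷ Vs)
      sizes-increase = Linked.Linked⇒AllPairs ℕ.<-trans
          (Linked.map (λ {U} {V} → size-< {R = U} {V}) l)
      contained : Contained _≈ᶜ_ _≤ᶜ_ (chain c) (Us ++ W ∷ Vs)
      contained = All.tabulate λ {U} U∈ → lose {x = U}
        ([ ∈-++⁺ˡ , (λ U∈Vs → ∈-++⁺ʳ Us (there U∈Vs)) ]′ (∈-++⁻ Us (subst (U ∈_) eq U∈))) (id , id)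

    labelling : ∀ (c : MaximalChainᶜ w (suc (suc k))) → ∃ λ ρ → IsLabelling c ρ
    labelling c = from (chain c) refl (MaximalChain.isChain c)
      where
      from : ∀ Rs → chain c ≡ Rs → Linked _<ᶜ_ Rs → ∃ λ ρ → IsLabelling c ρ
      from [] eq l = contradiction [-] (no-insertion c [] [] bottom eq)
      from (R ∷ Rs) eq l with saturated⇒increments l
                                (λ Us Vs W eq′ → no-insertion c (R ∷ Us) Vs W
                                    (trans eq (cong (R ∷_) eq′)))
      ... | Xs , inc , full = admissibleOrder (increments-admissible inc R≐∅ full) , R , Rs , eq ,
              R≐∅ , inc
        where
        R≐∅ : set R ≐ ∅
        R≐∅ with removable-set R
        ... | inj₁ empty = (λ r → empty r) , λ ()
        -- A removable element of the first set would give a smaller set to put in front.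
        ... | inj₂ (X , V , add) = contradiction (adds⇒< {X = X} {V} {R} add ∷ l)
                (no-insertion c [] (R ∷ Rs) V eq)

    labelling-cong : ∀ {c d : MaximalChainᶜ w (suc (suc k))} {ρ σ} → IsLabelling c ρ →
                     IsLabelling d σ →
                     c ≈ᴹ d → ρ ≡ᴬ σ
    labelling-cong (R , Rs , p , _ , inc) (R′ , Rs′ , q , _ , inc′) c≈d
      with R≈ ∷ Rs≈ ← subst₂ (Pointwise _≈ᶜ_) p q c≈d = increments-cong inc inc′ R≈ Rs≈

    labelling-injective : ∀ {c d : MaximalChainᶜ w (suc (suc k))} {ρ σ} → IsLabelling c ρ →
                          IsLabelling d σ →
                          ρ ≡ᴬ σ → c ≈ᴹ d
    labelling-injective (R , Rs , p , R≐∅ , inc) (R′ , Rs′ , q , R′≐∅ , inc′) eq =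
      subst₂ (Pointwise _≈ᶜ_) (sym p) (sym q)
        (R≈ ∷ increments-injective inc (subst (Increments R′ Rs′) (sym eq) inc′) R≈)
      where
      R≈ : R ≈ᶜ R′
      R≈ = (λ r → ⊥-elim (proj₁ R≐∅ r)) , (λ r → ⊥-elim (proj₁ R′≐∅ r))

    module _ (ρ : AdmissibleOrder w (suc (suc k))) where
      open Admissible (admissible ρ)
      open DecMembership (_≟ᵛ_ {n} {suc (suc k)}) using (_∈?_)

      -- An initial segment of a linear extension is closed downwards. A packet listed in lex or
      -- antilex order cannot have its middle face separated from both outer ones by the cut.
      initial : ∀ Xs Ys → order ρ ≡ Xs ++ Ys → C
      initial Xs Ys eq = consistentSet (_∈ Xs)
          (λ X∈ → sound (subst (_ ∈_) (sym eq) (∈-++⁺ˡ X∈))) record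
        { dec = _∈? Xs
        ; lower = λ {X} {Y} X∈ _ s Y∈ → decidable-stable (X ∈? Xs) λ X∉ →
            no-back (earlier (proj₁ X∈) Y∈ X∉) s
        ; convex = λ Z {i} {j} {l} (cZ , _) i<j j<l I∈ L∈ → decidable-stable (_ ∈? Xs) λ J∉ →
            let i⊲j = earlier (allPairs-removeAt cZ j) I∈ J∉
                l⊲j = earlier (allPairs-removeAt cZ j) L∈ J∉ in
            case packets cZ of λ where
              (inj₁ lx) → before-asym unique i⊲j (lex-before lx i<j)
              (inj₂ al) → before-asym unique l⊲j (antilex-before al j<l)
        ; coconvex = λ Z {i} {j} {l} (cZ , _) i<j j<l I∉ L∉ J∈ →
            let j⊲i = earlier (allPairs-removeAt cZ i) J∈ I∉
                j⊲l = earlier (allPairs-removeAt cZ l) J∈ L∉ in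
            case packets cZ of λ where
              (inj₁ lx) → before-asym unique j⊲l (lex-before lx j<l)
              (inj₂ al) → before-asym unique j⊲i (antilex-before al i<j) }
        where
        earlier : ∀ {X Y} → Chain Y → X ∈ Xs → Y ∉ Xs → Before X Y (order ρ)
        earlier {X} {Y} cY X∈ Y∉ with ∈-++⁻ Xs (subst (Y ∈_) eq (complete cY))
        ... | inj₁ Y∈Xs = contradiction Y∈Xs Y∉
        ... | inj₂ Y∈Ys = subst (Before X Y) (sym eq) (before-++⁺ X∈ Y∈Ys)

      shift : ∀ Xs {Y Ys} → order ρ ≡ Xs ++ Y ∷ Ys → order ρ ≡ (Xs ++ [ Y ]) ++ Ys
      shift Xs eq = trans eq (sym (List.++-assoc Xs _ _))

      initials : ∀ Xs Ys → order ρ ≡ Xs ++ Ys → List C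
      initials Xs []       eq = []
      initials Xs (Y ∷ Ys) eq = initial (Xs ++ [ Y ]) Ys (shift Xs eq) ∷ initials (Xs ++ [ Y ]) Ys
          (shift Xs eq)

      initials-increments : ∀ Xs Ys (eq : order ρ ≡ Xs ++ Ys) → Increments (initial Xs Ys eq)
                            (initials Xs Ys eq) Ys
      initials-increments Xs []       eq = []
      initials-increments Xs (Y ∷ Ys) eq =
        ( (λ X∈ → ∈-++⁺ˡ X∈)
        , (λ (X∈ , X∉) → [ (λ X∈Xs → contradiction X∈Xs X∉) , (λ { (here eq) → sym eq }) ]′
            (∈-++⁻ Xs X∈))
        , (λ { refl → ∈-++⁺ʳ Xs (here refl) ,
               λ Y∈ → before-irrefl unique (subst (Before Y Y) (sym eq)
                   (before-++⁺ Y∈ (here refl))) }) )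
        ∷ initials-increments (Xs ++ [ Y ]) Ys (shift Xs eq)

      maximalChain : MaximalChainᶜ w (suc (suc k))
      maximalChain = record
        { chain = initial [] (order ρ) refl ∷ initials [] (order ρ) refl
        ; isChain = increments-linked inc empty exhaustive
        ; maximal = increments-maximal inc empty exhaustive }
        where
        inc = initials-increments [] (order ρ) refl
        empty : set (initial [] (order ρ) refl) ≐ ∅
        empty = (λ ()) , (λ ())
        exhaustive : ∀ {X} → Chain X → X ∈ [] ⊎ X ∈ order ρ
        exhaustive cX = inj₂ (complete cX)

      maximalChain-labelling : IsLabelling maximalChain ρ
      maximalChain-labelling = _ , _ , refl , ((λ ()) , (λ ())) , initials-increments []
          (order ρ) refl

theorem1p4 :
  (k n : ℕ) → 1 ≤ k → k ≤ n → (w : Permutation′ n) →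
  let B   = AdmissibleOrder w k
      C   = ConsistentSet w (suc k)
      _∼_ = _∼ᴮ_ {m = k} {w = w}
      _⊑_ = _≤ᴮ_ {m = k} {w = w}
      _≈_ = _≈ᶜ_ {m = suc k} {w = w}
      _≼_ = _≤ᶜ_ {m = suc k} {w = w}
  in
  -- (a)
  ( IsPartialOrder _∼_ _⊑_ ×
    IsPartialOrder _≈_ _≼_ ×
    ∃ λ (rev : B → C) →
      (∀ ρ → set (rev ρ) ≐ Rev w ρ) × IsOrderIsomorphism _∼_ _≈_ _⊑_ _≼_ rev ) ×
  -- (b)
  ( IsRanked _∼_ _⊑_ ×
    IsRanked _≈_ _≼_ ×
    (∃ λ (ρ : B) → IsUniqueMinimal _∼_ _⊑_ ρ × Rev w ρ ≐ ∅) ×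
    (∃ λ (ρ : B) → IsUniqueMaximal _∼_ _⊑_ ρ × Rev w ρ ≐ Inv w) ×
    (∃ λ (R : C) → IsUniqueMinimal _≈_ _≼_ R × set R ≐ ∅) ×
    (∃ λ (R : C) → IsUniqueMaximal _≈_ _≼_ R × set R ≐ Inv w) ) ×
  -- (c)
  ( ∃ λ (Φ : MaximalChainᶜ w (suc k) → AdmissibleOrder w (suc k)) →
      (∀ c → IsLabelling c (Φ c)) ×
      Congruent _≈ᴹ_ _≡ᴬ_ Φ ×
      Bijective _≈ᴹ_ _≡ᴬ_ Φ )
theorem1p4 (suc k) n (s≤s _) _ w =
  ( ⊑-isPartialOrder , ≤ᶜ-isPartialOrder
  , rev , (λ ρ → let p , q = rev≐reversals ρ in q , p) , rev-isOrderIsomorphism ) ,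
  ( isRanked⁻ ≤ᶜ-isRanked , ≤ᶜ-isRanked
  , (let ρ , p , q = rev-surjective bottom in
     ρ , uniqueMinimal⁻ {x = ρ} {bottom} (p , q) bottom-uniqueMinimal ,
     (λ {X} r → p {X} (proj₁ (rev≐reversals ρ) {X} r)) , (λ ()))
  , (let ρ , p , q = rev-surjective top in
     ρ , uniqueMaximal⁻ {x = ρ} {top} (p , q) top-uniqueMaximal ,
     (λ {X} r → proj₁ r) , (λ {X} inv → proj₂ (rev≐reversals ρ) {X} (q (inv⇒chain {X = X} inv))))
  , (bottom , bottom-uniqueMinimal , (λ ()) , (λ ()))
  , (top , top-uniqueMaximal , (λ {X} → chain⇒inv {X = X}) , (λ {X} → inv⇒chain {X = X})) ) ,
  ( (λ c → proj₁ (labelling c))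
  , (λ c → proj₂ (labelling c))
  , (λ {c} {d} → labelling-cong {c = c} {d} {proj₁ (labelling c)} {proj₁ (labelling d)}
                   (proj₂ (labelling c)) (proj₂ (labelling d)))
  , (λ {c} {d} → labelling-injective {c = c} {d} {proj₁ (labelling c)} {proj₁ (labelling d)}
                   (proj₂ (labelling c)) (proj₂ (labelling d)))
  -- The initial segments of `ρ` form a maximal chain labelled by `ρ`, and equivalent chains have
  -- the same labels.
  , (λ ρ → maximalChain ρ , λ {c} →
      labelling-cong {c = c} {maximalChain ρ} {proj₁ (labelling c)} {ρ}
                   (proj₂ (labelling c)) (maximalChain-labelling ρ)) )
  where
  open HigherBruhat w
  open OrderIsomorphism ⊑-isPartialOrder ≤ᶜ-isPartialOrder (rev {k}) rev-isOrderIsomorphism
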